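{- Let $\Gamma,\Delta$ be well-formed contexts of MLTT°, let $\rho$ be an environment that fits $\Gamma$, and let $\sigma,\sigma':\Delta\to\Gamma$ be substitutions related over $\rho$. Let $a\in\mathcal{C}$ with $a\in[\![A]\!]_\rho$ and $a:\mathsf{U}$, and let $u\in\mathcal{C}$ with $u\in[\![M]\!]_\rho$ and $u:a$. Then $$\Gamma\vdash A\equiv A':\mathcal{U}\ \Longrightarrow\ \Delta\Vdash A[\sigma]\equiv A'[\sigma']\ \triangleright\ a,$$ $$\Gamma\vdash M\equiv M':A\ \Longrightarrow\ \Delta\Vdash M[\sigma]\equiv M'[\sigma']:A[\sigma]\ \triangleright\ u:a.$$ (In the first implication only $a\in[\![A]\!]_\rho$ and $a:\mathsf{U}$ are relevant.)
   Context: **Syntax.** MLTT° is the following type theory (dependent products and one universe with type-in-type). Terms are $M,N,A,B ::= x \mid \mathcal{U} \mid \Pi_{x:A}B \mid \lambda_{x:A}M \mid M\,N$, up to $\alpha$-equivalence, with capture-avoiding substitution $M[N/x]$. Contexts are finite lists of declarations $x:A$. The judgements $\vdash\Gamma$, $\Gamma\vdash M:A$ and $\Gamma\vdash M\equiv N:A$ are mutually inductively generated as follows. Contexts: the empty context is well-formed; if $\vdash\Gamma$ and $\Gamma\vdash A:\mathcal{U}$ then $\vdash\Gamma,x:A$ ($x$ fresh). Typing: (Var) if $\vdash\Gamma$ and $(x:A)\in\Gamma$ then $\Gamma\vdash x:A$; (Univ) if $\vdash\Gamma$ then $\Gamma\vdash\mathcal{U}:\mathcal{U}$; (Pi) if $\Gamma\vdash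 A:\mathcal{U}$ and $\Gamma,x:A\vdash B:\mathcal{U}$ then $\Gamma\vdash\Pi_{x:A}B:\mathcal{U}$; (Lam) if $\Gamma\vdash A:\mathcal{U}$ and $\Gamma,x:A\vdash M:B$ then $\Gamma\vdash\lambda_{x:A}M:\Pi_{x:A}B$; (App) if $\Gamma\vdash M:\Pi_{x:A}B$ and $\Gamma\vdash N:A$ then $\Gamma\vdash M\,N:B[N/x]$; (Conv) if $\Gamma\vdash M:A$ and $\Gamma\vdash A\equiv B:\mathcal{U}$ then $\Gamma\vdash M:B$. Definitional equality: reflexivity on well-typed terms, symmetry, transitivity; conversion (if $\Gamma\vdash M\equiv N:A$ and $\Gamma\vdash A\equiv B:\mathcal{U}$ then $\Gamma\vdash M\equiv N:B$); congruence for $\Pi$, $\lambda$, application; ($\beta$) if $\Gamma\vdash A:\mathcal{U}$, $\Gamma,x:A\vdash M:B$, $\Gamma\vdash N:A$ then $\Gamma\vdash(\lambda_{x:A}M)\,N\equiv M[N/x]:B[N/x]$; ($\eta$) if $\Gamma\vdash M:\Pi_{x:A}B$, $\Gamma\vdash N:\Pi_{x:A}B$ and $\Gamma,x:A\vdash M\,x\equiv N\,x:B$ ($x$ fresh) then $\Gamma\vdash M\equiv N:\Pi_{x:A}B$. One-step head reduction is generated by $(\lambda_{x:A}M)\,N\rightsquigarrow M[N/x]$ and: $M\rightsquigarrow M'$ implies $M\,N\rightsquigarrow M'\,N$; $\rightsquigarrow^*$ is its reflexive-transitive closure. Typed head reduction $\Gamma\vdash M\rightsquigarrow^* M':A$ means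 $M\rightsquigarrow^*M'$ and $\Gamma\vdash M\equiv M':A$. **Compact elements.** A conditional upper semi-lattice (CUSL) is a poset with least element $\bot$ in which every two elements having a common upper bound have a supremum. For CUSLs $X,Y$, a step function $f:X\to Y$ is a monotone map of the form $f(u)=\bigvee\{v_i\mid u_i\le u\}$ for a finite set of pairs $\{u_1\mapsto v_1,\dots,u_k\mapsto v_k\}$ (a presentation of $f$); step functions ordered pointwise form a CUSL $X\Rightarrow Y$. Define $\mathcal{C}_0=\{\bot\}$, and let $\mathcal{C}_{n+1}$ consist of $\bot$, $\mathsf{U}$, $\mathsf{\lambda}(f)$ for $f\in\mathcal{C}_n\Rightarrow\mathcal{C}_n$, and $\mathsf{\Pi}(a,b)$ for $a\in\mathcal{C}_n$, $b\in\mathcal{C}_n\Rightarrow\mathcal{C}_n$, with the only identification $\mathsf{\lambda}(\bot)=\bot$. Order: $\bot$ is least; $\mathsf{\lambda}(f)\le\mathsf{\lambda}(g)$ iff $f\le g$; $\mathsf{\Pi}(a,b)\le\mathsf{\Pi}(a',b')$ iff $a\le a'$ and $b\le b'$; $\mathsf{U}\le\mathsf{U}$; elements with distinct head constructors (other than $\bot$) are incomparable. $\mathcal{C}_n$ is included in $\mathcal{C}_{n+1}$, recursively, a step function presented by $\{u_i\mapsto v_i\}$ being sent to the step function with the same presentation read one level up. Let $\mathcal{C}=\bigcup_n\mathcal{C}_n$, and $\mathcal{D}$ the set of ideals of $\mathcal{C}$ (nonempty downward closed subsets closed under finite suprema, which must exist), ordered by inclusion; it is a Scott domain. $\mathcal{C}$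 embeds in $\mathcal{D}$ through principal ideals $\downarrow u$; for $u\in\mathcal{C}$, $\alpha\in\mathcal{D}$, $u\le\alpha$ means $u\in\alpha$. **Semantic typing.** For $u,a\in\mathcal{C}_n$ the relation $u:_n a$ is generated by: (Bot) if $a:_n\mathsf{U}$ then $\bot:_n a$; (Univ) $\mathsf{U}:_{n+1}\mathsf{U}$; (Lam) if $a:_n\mathsf{U}$, $\mathrm{dom}_n(f,a)$ and $f(u):_n g(u)$ for all $u\in\mathcal{C}_n$, then $\mathsf{\lambda}(f):_{n+1}\mathsf{\Pi}(a,g)$; (Pi) if $a:_n\mathsf{U}$, $\mathrm{dom}_n(g,a)$ and $g(u):_n\mathsf{U}$ for all $u\in\mathcal{C}_n$, then $\mathsf{\Pi}(a,g):_{n+1}\mathsf{U}$. Here $\mathrm{dom}_n(f,a)$ means: for all $u\in\mathcal{C}_n$ there is $v\in\mathcal{C}_n$ with $v\le u$, $v:_n a$ and $f(u)=f(v)$. For $u,a\in\mathcal{C}$, $u:a$ means $u:_n a$ for some $n$. For $\alpha,\beta\in\mathcal{D}$, $\alpha:\beta$ means: for all $u\in\alpha$ there exist $v\in\alpha$ and $a\in\beta$ with $u\le v$ and $v:a$. **Semantics of terms.** Put $\mathrm{app}(\mathsf{\lambda}(f),u)=f(u)$ and $\mathrm{app}(v,u)=\bot$ otherwise, for $u,v\in\mathcal{C}$. On $\mathcal{D}$: $\mathbf{U}=\{\bot,\mathsf{U}\}$; for continuous $g:\mathcal{D}\to\mathcal{D}$ and $\alpha,\beta\in\mathcal{D}$,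 $\mathbf{\lambda}(g)=\{\mathsf{\lambda}(s)\mid s\text{ a step function on }\mathcal{C},\ s(u)\in g(\downarrow u)\ \forall u\in\mathcal{C}\}$, $\mathbf{\Pi}(\alpha,g)=\{\bot\}\cup\{\mathsf{\Pi}(a,s)\mid a\in\alpha,\ s(u)\in g(\downarrow u)\ \forall u\in\mathcal{C}\}$, $\mathbf{app}(\alpha,\beta)=\{\mathrm{app}(v,u)\mid v\in\alpha,u\in\beta\}$, and $\mathsf{p}\,\alpha\,\omega=\bigvee\{u\in\mathcal{C}\mid u\in\omega,\ \exists a\in\alpha,\ u:a\}$. An environment $\rho$ maps variables to elements of $\mathcal{D}$. Define $[\![x]\!]_\rho=\rho(x)$; $[\![\mathcal{U}]\!]_\rho=\mathbf{U}$; $[\![\Pi_{x:A}B]\!]_\rho=\mathbf{\Pi}([\![A]\!]_\rho,\ u\mapsto[\![B]\!]_{\rho,x\mapsto\mathsf{p}[\![A]\!]_\rho u})$; $[\![\lambda_{x:A}M]\!]_\rho=\mathbf{\lambda}(u\mapsto[\![M]\!]_{\rho,x\mapsto\mathsf{p}[\![A]\!]_\rho u})$; $[\![M\,N]\!]_\rho=\mathbf{app}([\![M]\!]_\rho,[\![N]\!]_\rho)$. The environment $\rho$ fits $\Gamma$ if for all $(x:A)\in\Gamma$, $[\![A]\!]_\rho:\mathbf{U}$ and $\rho(x):[\![A]\!]_\rho$. **Logical relation.** For $a,u\in\mathcal{C}_n$, define two relations $\Gamma\Vdash_n A\equiv A'\triangleright a$ (presupposing $a:_n\mathsf{U}$)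 and $\Gamma\Vdash_n M\equiv M':A\triangleright u:a$ (presupposing $a:_n\mathsf{U}$, $u:_n a$ and $\Gamma\vdash M\equiv M':A$), by recursion on $n$ and cases on $a$: - $a=\bot$: both relations always hold. - Types at $\mathsf{\Pi}(a,b)$: $\Gamma\Vdash_{n+1}T\equiv T'\triangleright\mathsf{\Pi}(a,b)$ iff there are $A,B,A',B'$ with $\Gamma\vdash T\rightsquigarrow^*\Pi_{x:A}B:\mathcal{U}$, $\Gamma\vdash T'\rightsquigarrow^*\Pi_{x:A'}B':\mathcal{U}$, $\Gamma\vdash A\equiv A':\mathcal{U}$, $\Gamma,x:A\vdash B\equiv B':\mathcal{U}$, $\Gamma\Vdash_n A\equiv A'\triangleright a$, and for all $M,M',v$ with $v:_n a$, $\Gamma\vdash M\equiv M':A$ and $\Gamma\Vdash_n M\equiv M':A\triangleright v:a$: $\Gamma\Vdash_n B[M/x]\equiv B[M'/x]\triangleright b(v)$, $\Gamma\Vdash_n B'[M/x]\equiv B'[M'/x]\triangleright b(v)$ and $\Gamma\Vdash_n B[M/x]\equiv B'[M'/x]\triangleright b(v)$. - Terms at $\mathsf{\Pi}(a,b)$: $\Gamma\Vdash_{n+1}M\equiv M':T\triangleright u:\mathsf{\Pi}(a,b)$ iff $\Gamma\Vdash_{n+1}T\equiv T\triangleright\mathsf{\Pi}(a,b)$ and there are $A,B$ with $\Gamma\vdash T\rightsquigarrow^*\Pi_{x:A}B:\mathcal{U}$ such that for all $N,N',w$ with $w:_n a$, $\Gamma\vdash N\equiv N':A$ and $\Gamma\Vdash_n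 N\equiv N':A\triangleright w:a$, the relation $\Gamma\Vdash_n P\equiv Q:B[N/x]\triangleright\mathrm{app}(u,w):b(w)$ holds for $(P,Q)$ each of $(M\,N,M\,N')$, $(M'\,N,M'\,N')$, $(M\,N,M'\,N')$. - Types at $\mathsf{U}$: $\Gamma\Vdash_n A\equiv A'\triangleright\mathsf{U}$ iff $\Gamma\vdash A\rightsquigarrow^*\mathcal{U}:\mathcal{U}$ and $\Gamma\vdash A'\rightsquigarrow^*\mathcal{U}:\mathcal{U}$. - Terms at $\mathsf{U}$: $\Gamma\Vdash_{n+1}M\equiv M':A\triangleright u:\mathsf{U}$ iff $\Gamma\vdash A\rightsquigarrow^*\mathcal{U}:\mathcal{U}$ and $\Gamma\Vdash_{n+1}M\equiv M'\triangleright u$. The relations do not depend on the stage $n$ at which $u$ and $a$ are taken; without index, $\Vdash$ denotes the relation at any such stage. **Related substitutions.** $\sigma,\sigma':\Delta\to\Gamma$ (parallel substitutions assigning a term over $\Delta$ to each variable of $\Gamma$) are related over $\rho$ if for every $(x:A)\in\Gamma$: $\Delta\vdash\sigma(x)\equiv\sigma'(x):A[\sigma]$, and for all $u,a\in\mathcal{C}$ with $u\in\rho(x)$, $a\in[\![A]\!]_\rho$, $a:\mathsf{U}$ and $u:a$, one has $\Delta\Vdash\sigma(x)\equiv\sigma'(x):A[\sigma]\triangleright u:a$. $M[\sigma]$ denotes the action of $\sigma$ on $M$. -}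

module Defs where

open import Level using (0ℓ)
open import Data.Empty using () renaming (⊥ to Empty)
open import Data.Unit using (⊤; tt)
open import Data.Nat as ℕ using (ℕ; zero; suc; z≤n; s≤s; _⊔_)
import Data.Nat.Properties as ℕₚ
open import Data.Fin using (Fin; zero; suc)
open import Data.Fin.Substitution using (Lift; Sub; TermSubst)
open import Data.Vec using (lookup)
open import Data.List as List using (List; []; _∷_; _++_)
open import Data.List.Relation.Unary.Any using (here; there)
open import Data.List.Relation.Unary.All as All using (All; []; _∷_)
open import Data.List.Relation.Unary.All.Properties using (++⁺)
open import Data.List.Membership.Propositional using (_∈_)
open import Data.List.Membership.Propositional.Properties
  using (∈-++⁺ˡ; ∈-++⁺ʳ; ∈-++⁻; ∈-map⁺; ∈-map⁻)
open import Data.Product using (Σ; ∃; ∃-syntax; _×_; _,_; proj₁; proj₂)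
open import Data.Sum using (_⊎_; inj₁; inj₂)
open import Function using (_∘_)
open import Relation.Nullary using (Dec; yes; no; contradiction)
open import Relation.Nullary.Decidable using (map′; _×-dec_)
open import Relation.Binary using (Poset; Minimum; Decidable)
open import Relation.Binary.PropositionalEquality
  using (_≡_; refl)
open import Relation.Binary.Construct.Closure.ReflexiveTransitive using (Star)
import Relation.Binary.Construct.Interior.Symmetric as Sym

------------------------------------------------------------------------
-- Conditional upper semi-lattices

-- Equality of elements is the setoid equality of the poset.  In all the
-- CUSLs built below it is the equivalence  x ≤ y × y ≤ x.

record CUSL : Set₁ where
  no-eta-equality
  constructor mkCUSL
  field
    poset : Poset 0ℓ 0ℓ 0ℓ

  open Poset poset public using (Carrier; _≈_; _≤_)
    renaming (refl to ≤-refl; trans to ≤-trans; reflexive to ≤-reflexive;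
              antisym to ≤-antisym)

  ≥-reflexive : ∀ {x y} → x ≈ y → y ≤ x
  ≥-reflexive x≈y = ≤-reflexive (Poset.Eq.sym poset x≈y)

  IsLub : (Carrier → Set) → Carrier → Set
  IsLub P s = (∀ {x} → P x → x ≤ s) × (∀ {z} → (∀ {x} → P x → x ≤ z) → s ≤ z)

  IsSup : Carrier → Carrier → Carrier → Set
  IsSup x y s = x ≤ s × y ≤ s × (∀ {z} → x ≤ z → y ≤ z → s ≤ z)

  field
    ⊥   : Carrier
    min : Minimum _≤_ ⊥
    sup : ∀ {x y z} → x ≤ z → y ≤ z → ∃ (IsSup x y)

-- With INLINE, record definitions compile to copatterns and so do not unfold.
{-# INLINE mkCUSL #-}

∣_∣ : CUSL → Set
∣ X ∣ = CUSL.Carrier X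

infix 4 le eq

le eq : (X : CUSL) → ∣ X ∣ → ∣ X ∣ → Set
le = CUSL._≤_
eq = CUSL._≈_

syntax le X x y = x ≤[ X ] y
syntax eq X x y = x ≈[ X ] y

DecCUSL : CUSL → Set
DecCUSL X = Decidable (CUSL._≤_ X)

------------------------------------------------------------------------
-- Step functions

record Step (X Y : CUSL) : Set where
  no-eta-equality
  constructor mkStep
  private
    module X = CUSL X
    module Y = CUSL Y
  field
    presentation : List (∣ X ∣ × ∣ Y ∣)
    apply        : ∣ X ∣ → ∣ Y ∣
    isStep       : ∀ u → Y.IsLub (λ v → ∃[ u₀ ] (u₀ , v) ∈ presentation × u₀ X.≤ u) (apply u)

  monotone : ∀ {u u′} → u X.≤ u′ → apply u Y.≤ apply u′
  monotone {u} {u′} u≤u′ = proj₂ (isStep u) λ where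
    (u₀ , ∈p , u₀≤u) → proj₁ (isStep u′) (u₀ , ∈p , X.≤-trans u₀≤u u≤u′)

{-# INLINE mkStep #-}

open Step using (presentation; monotone)

infixl 9 _·_
_·_ : ∀ {X Y} → Step X Y → ∣ X ∣ → ∣ Y ∣
_·_ = Step.apply

module _ {X Y : CUSL} where
  private
    module X = CUSL X
    module Y = CUSL Y

  ⊥ₛ : Step X Y
  ⊥ₛ = record
    { presentation = []
    ; apply        = λ _ → Y.⊥
    ; isStep       = λ _ → (λ { (_ , () , _) }) , λ _ → Y.min _
    }

  -- The concatenated presentation presents the pointwise supremum.
  joinₛ : (f g : Step X Y) → (∀ u → ∃ (Y.IsSup (f · u) (g · u))) → Step X Y
  joinₛ f g h = record
    { presentation = presentation f ++ presentation g
    ; apply        = λ u → proj₁ (h u)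
    ; isStep       = λ u →
        let (_ , f≤ , g≤ , least) = h u in
        (λ { (u₀ , ∈p , u₀≤u) → upper u f≤ g≤ u₀≤u (∈-++⁻ (presentation f) ∈p) }) ,
        λ ub → least
          (proj₂ (Step.isStep f u) λ { (u₀ , ∈p , u₀≤u) → ub (u₀ , ∈-++⁺ˡ ∈p , u₀≤u) })
          (proj₂ (Step.isStep g u) λ { (u₀ , ∈p , u₀≤u) →
             ub (u₀ , ∈-++⁺ʳ (presentation f) ∈p , u₀≤u) })
    }
    where
    upper : ∀ u {s u₀ v} → f · u Y.≤ s → g · u Y.≤ s → u₀ X.≤ u →
            (u₀ , v) ∈ presentation f ⊎ (u₀ , v) ∈ presentation g → v Y.≤ s
    upper u f≤ g≤ u₀≤u (inj₁ ∈p) = Y.≤-trans (proj₁ (Step.isStep f u) (_ , ∈p , u₀≤u)) f≤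
    upper u f≤ g≤ u₀≤u (inj₂ ∈p) = Y.≤-trans (proj₁ (Step.isStep g u) (_ , ∈p , u₀≤u)) g≤

  singleₛ : DecCUSL X → ∣ X ∣ → ∣ Y ∣ → Step X Y
  singleₛ _≤?_ u v = record
    { presentation = (u , v) ∷ []
    ; apply        = λ w → value (u ≤? w)
    ; isStep       = λ w → upper (u ≤? w) , lower (u ≤? w)
    }
    where
    value : ∀ {w} → Dec (u X.≤ w) → ∣ Y ∣
    value (yes _) = v
    value (no _)  = Y.⊥

    P : ∣ X ∣ → ∣ Y ∣ → Set
    P w v′ = ∃[ u₀ ] (u₀ , v′) ∈ (u , v) ∷ [] × u₀ X.≤ w

    upper : ∀ {w} (d : Dec (u X.≤ w)) → ∀ {v′} → P w v′ → v′ Y.≤ value d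
    upper (yes _)   (_ , here refl , _)   = Y.≤-refl
    upper (no u≰w)  (_ , here refl , u≤w) = contradiction u≤w u≰w

    lower : ∀ {w} (d : Dec (u X.≤ w)) → ∀ {z} → (∀ {v′} → P w v′ → v′ Y.≤ z) → value d Y.≤ z
    lower (yes u≤w) ub = ub (u , here refl , u≤w)
    lower (no _)    ub = Y.min _

infix 4 _≤ₛ_
record _≤ₛ_ {X Y : CUSL} (f g : Step X Y) : Set where
  no-eta-equality
  pattern
  constructor pointwise
  field at : ∀ u → f · u ≤[ Y ] g · u

open _≤ₛ_ using (at)

joinₛ-sup : ∀ {X Y} (f g : Step X Y) (h : ∀ u → ∃ (CUSL.IsSup Y (f · u) (g · u))) →
            let s = joinₛ f g h in
            f ≤ₛ s × g ≤ₛ s × (∀ {k} → f ≤ₛ k → g ≤ₛ k → s ≤ₛ k)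
joinₛ-sup f g h =
  pointwise (λ u → proj₁ (proj₂ (h u))) ,
  pointwise (λ u → proj₁ (proj₂ (proj₂ (h u)))) ,
  λ f≤k g≤k → pointwise λ u → proj₂ (proj₂ (proj₂ (h u))) (at f≤k u) (at g≤k u)

infixr 5 _⇒_
_⇒_ : CUSL → CUSL → CUSL
X ⇒ Y = record
  { poset = Sym.poset {R = _≤ₛ_ {X} {Y}}
      (pointwise λ _ → Y.≤-refl)
      (λ f≤g g≤h → pointwise λ u → Y.≤-trans (at f≤g u) (at g≤h u))
  ; ⊥     = ⊥ₛ
  ; min   = λ _ → pointwise λ _ → Y.min _
  ; sup   = λ {f} {g} f≤h g≤h →
      let s = λ u → Y.sup (at f≤h u) (at g≤h u) in joinₛ f g s , joinₛ-sup f g s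
  }
  where module Y = CUSL Y

dec-⇒ : ∀ {X Y} → DecCUSL Y → DecCUSL (X ⇒ Y)
dec-⇒ {X} {Y} dec f g =
  map′ (λ all → pointwise λ u → proj₂ (Step.isStep f u) λ { (u₀ , ∈p , u₀≤u) →
          Y.≤-trans (All.lookup all ∈p) (monotone g u₀≤u) })
       (λ f≤g → All.tabulate λ { {(u , v)} ∈p →
          Y.≤-trans (proj₁ (Step.isStep f u) (u , ∈p , X.≤-refl)) (at f≤g u) })
       (All.all? (λ { (u , v) → dec v (g · u) }) (presentation f))
  where
  module X = CUSL X
  module Y = CUSL Y

------------------------------------------------------------------------
-- Embeddings of CUSLs, and rereading a presentation along an embedding

record Emb (X Y : CUSL) : Set where
  no-eta-equality
  constructor mkEmb
  private
    module X = CUSL X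
    module Y = CUSL Y
  field
    to      : ∣ X ∣ → ∣ Y ∣
    mono    : ∀ {x y} → x X.≤ y → to x Y.≤ to y
    reflect : ∀ {x y} → to x Y.≤ to y → x X.≤ y
    bottom  : to X.⊥ Y.≤ Y.⊥
    join    : ∀ {x y z} → to x Y.≤ z → to y Y.≤ z → ∃[ s ] X.IsSup x y s × to s Y.≤ z

  presSup : ∀ {x y s} → X.IsSup x y s → Y.IsSup (to x) (to y) (to s)
  presSup (x≤ , y≤ , least) = mono x≤ , mono y≤ , λ x≤z y≤z →
    let (_ , (x≤′ , y≤′ , _) , ≤z) = join x≤z y≤z in
    Y.≤-trans (mono (least x≤′ y≤′)) ≤z

  joinAll : ∀ {z} (xs : List ∣ X ∣) → All (λ x → to x Y.≤ z) xs →
            ∃[ s ] X.IsLub (_∈ xs) s × to s Y.≤ z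
  joinAll []       []         = X.⊥ , ((λ ()) , λ _ → X.min _) , Y.≤-trans bottom (Y.min _)
  joinAll (x ∷ xs) (≤z ∷ ≤zs) =
    let (_ , (ub , lub) , s≤z)      = joinAll xs ≤zs
        (t , (x≤t , s≤t , least) , t≤z) = join ≤z s≤z
    in t ,
       ((λ { (here refl) → x≤t ; (there ∈xs) → X.≤-trans (ub ∈xs) s≤t }) ,
        λ h → least (h (here refl)) (lub (h ∘ there))) ,
       t≤z

{-# INLINE mkEmb #-}

module _ {X X′ Y Y′ : CUSL} (dec : DecCUSL X′) (e : Emb X X′) (e′ : Emb Y Y′) where
  private
    module X  = CUSL X
    module X′ = CUSL X′
    module Y  = CUSL Y
    module Y′ = CUSL Y′
    module e  = Emb e
    module e′ = Emb e′

  below : (ps : List (∣ X ∣ × ∣ Y ∣)) (u : ∣ X′ ∣) →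
          ∃[ xs ] (∀ {x v} → (x , v) ∈ ps → e.to x X′.≤ u → x ∈ xs) × All (λ x → e.to x X′.≤ u) xs
  below []             u = [] , (λ ()) , []
  below ((x , _) ∷ ps) u with below ps u | dec (e.to x) u
  ... | xs , h , all | yes x≤u =
    x ∷ xs , (λ { (here refl) _ → here refl ; (there ∈p) ≤u → there (h ∈p ≤u) }) , x≤u ∷ all
  ... | xs , h , all | no x≰u =
    xs , (λ { (here refl) x≤u → contradiction x≤u x≰u ; (there ∈p) ≤u → h ∈p ≤u }) , all

  values : ∀ (ps : List (∣ X ∣ × ∣ Y ∣)) (u : ∣ X′ ∣) →
           ∃[ vs ] (∀ {x v} → (x , v) ∈ ps → e.to x X′.≤ u → v ∈ vs) ×
                   All (λ v → ∃[ x ] (x , v) ∈ ps × e.to x X′.≤ u) vs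
  values []             u = [] , (λ ()) , []
  values ((x , v) ∷ ps) u with values ps u | dec (e.to x) u
  ... | vs , h , all | yes x≤u =
    v ∷ vs , (λ { (here refl) _ → here refl ; (there ∈p) ≤u → there (h ∈p ≤u) }) ,
    (x , here refl , x≤u) ∷ All.map (λ { (y , ∈p , y≤u) → y , there ∈p , y≤u }) all
  ... | vs , h , all | no x≰u =
    vs , (λ { (here refl) x≤u → contradiction x≤u x≰u ; (there ∈p) ≤u → h ∈p ≤u }) ,
    All.map (λ { (y , ∈p , y≤u) → y , there ∈p , y≤u }) all

  -- The supremum of those u₀ in the presentation of f with e u₀ ≤ u.
  support : Step X Y → ∣ X′ ∣ → ∣ X ∣
  support f u = let (xs , _ , all) = below (presentation f) u in proj₁ (e.joinAll xs all)

  support-≤ : ∀ f u → e.to (support f u) X′.≤ u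
  support-≤ f u = let (xs , _ , all) = below (presentation f) u in proj₂ (proj₂ (e.joinAll xs all))

  support-≥ : ∀ f u {x v} → (x , v) ∈ presentation f → e.to x X′.≤ u → x X.≤ support f u
  support-≥ f u ∈p x≤u =
    let (xs , h , all) = below (presentation f) u in
    proj₁ (proj₁ (proj₂ (e.joinAll xs all))) (h ∈p x≤u)

  both : ∣ X ∣ × ∣ Y ∣ → ∣ X′ ∣ × ∣ Y′ ∣
  both (x , v) = e.to x , e′.to v

  -- The step function with the same presentation, read along e and e′;
  -- its value at u is  ⋁ { e′ v | (u₀ ↦ v) in the presentation, e u₀ ≤ u }.
  mapStep : Step X Y → Step X′ Y′
  mapStep f = record
    { presentation = List.map both (presentation f)
    ; apply        = λ u → e′.to (f · support f u)
    ; isStep       = λ u → upper u , lower u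
    }
    where
    P : ∣ X′ ∣ → ∣ Y′ ∣ → Set
    P u v = ∃[ u₀ ] (u₀ , v) ∈ List.map both (presentation f) × u₀ X′.≤ u

    upper : ∀ u {v} → P u v → v Y′.≤ e′.to (f · support f u)
    upper u (_ , ∈p , u₀≤u) with ∈-map⁻ both ∈p
    ... | (x , v) , ∈p′ , refl =
      e′.mono (proj₁ (Step.isStep f _) (x , ∈p′ , support-≥ f u ∈p′ u₀≤u))

    lower : ∀ u {z} → (∀ {v} → P u v → v Y′.≤ z) → e′.to (f · support f u) Y′.≤ z
    lower u ub =
      let (vs , h , all)   = values (presentation f) u
          (_ , (above , _) , s≤z) = e′.joinAll vs
            (All.map (λ { (x , ∈p , x≤u) → ub (_ , ∈-map⁺ both ∈p , x≤u) }) all)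
      in Y′.≤-trans
           (e′.mono (proj₂ (Step.isStep f _) λ { (x , ∈p , x≤t) →
              above (h ∈p (X′.≤-trans (e.mono x≤t) (support-≤ f u))) }))
           s≤z

  mapStep-ub : ∀ f u {x v} → (x , v) ∈ presentation f → e.to x X′.≤ u → e′.to v Y′.≤ mapStep f · u
  mapStep-ub f u ∈p x≤u = proj₁ (Step.isStep (mapStep f) u) (_ , ∈-map⁺ both ∈p , x≤u)

  mapStep-lub : ∀ f u {z} → (∀ {x v} → (x , v) ∈ presentation f → e.to x X′.≤ u → e′.to v Y′.≤ z) →
                mapStep f · u Y′.≤ z
  mapStep-lub f u ub = proj₂ (Step.isStep (mapStep f) u) (λ { (_ , ∈p , x≤u) → helper (∈-map⁻ both ∈p) x≤u })
    where
    helper : ∀ {u₀ v} → ∃[ p ] p ∈ presentation f × (u₀ , v) ≡ (e.to (proj₁ p) , e′.to (proj₂ p)) →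
             u₀ X′.≤ u → v Y′.≤ _
    helper (_ , ∈p , refl) x≤u = ub ∈p x≤u

  mapStep-to : ∀ f w → mapStep f · e.to w ≈[ Y′ ] e′.to (f · w)
  mapStep-to f w = Y′.≤-antisym
    (e′.mono (monotone f (e.reflect (support-≤ f (e.to w)))))
    (e′.mono (proj₂ (Step.isStep f w) λ { (x , ∈p , x≤w) →
       proj₁ (Step.isStep f _) (x , ∈p , support-≥ f (e.to w) ∈p (e.mono x≤w)) }))

  mapStep-mono : ∀ {f g} → f ≤[ X ⇒ Y ] g → mapStep f ≤[ X′ ⇒ Y′ ] mapStep g
  mapStep-mono {f} {g} f≤g = pointwise λ u → Y′.≤-trans
    (e′.mono (at f≤g (support f u)))
    (Y′.≤-trans (Y′.≥-reflexive (mapStep-to g (support f u)))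
                (monotone (mapStep g) (support-≤ f u)))

  mapStep-join : ∀ f g h u →
    Y′.IsSup (mapStep f · u) (mapStep g · u) (mapStep (joinₛ f g h) · u)
  mapStep-join f g h u =
    mapStep-lub f u (λ ∈p → mapStep-ub (joinₛ f g h) u (∈-++⁺ˡ ∈p)) ,
    mapStep-lub g u (λ ∈p → mapStep-ub (joinₛ f g h) u (∈-++⁺ʳ (presentation f) ∈p)) ,
    λ f≤z g≤z → mapStep-lub (joinₛ f g h) u λ ∈p x≤u → split f≤z g≤z x≤u (∈-++⁻ (presentation f) ∈p)
    where
    split : ∀ {z x v} → mapStep f · u Y′.≤ z → mapStep g · u Y′.≤ z → e.to x X′.≤ u →
            (x , v) ∈ presentation f ⊎ (x , v) ∈ presentation g → e′.to v Y′.≤ z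
    split f≤z g≤z x≤u (inj₁ ∈p) = Y′.≤-trans (mapStep-ub f u ∈p x≤u) f≤z
    split f≤z g≤z x≤u (inj₂ ∈p) = Y′.≤-trans (mapStep-ub g u ∈p x≤u) g≤z

  emb-⇒ : Emb (X ⇒ Y) (X′ ⇒ Y′)
  emb-⇒ = record
    { to      = mapStep
    ; mono    = λ {f} {g} → mapStep-mono {f} {g}
    ; reflect = λ {f} {g} f≤g → pointwise λ w → e′.reflect
        (Y′.≤-trans (Y′.≥-reflexive (mapStep-to f w)) (Y′.≤-trans (at f≤g (e.to w)) (Y′.≤-reflexive (mapStep-to g w))))
    ; bottom  = pointwise λ u → mapStep-lub ⊥ₛ u λ ()
    ; join    = λ {f} {g} f≤k g≤k →
        let s = λ w → let (t , isSup , _) = e′.join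
                            (Y′.≤-trans (Y′.≥-reflexive (mapStep-to f w)) (at f≤k (e.to w)))
                            (Y′.≤-trans (Y′.≥-reflexive (mapStep-to g w)) (at g≤k (e.to w)))
                      in t , isSup
        in joinₛ f g s ,
           joinₛ-sup f g s ,
           pointwise λ u → proj₂ (proj₂ (mapStep-join f g s u)) (at f≤k u) (at g≤k u)
    }
mapStep-∘ : ∀ {X X′ X″ : CUSL} (dec′ : DecCUSL X′) (dec″ : DecCUSL X″)
  (e₁ : Emb X X′) (e₂ : Emb X′ X″) (e₃ : Emb X X″) →
  (∀ x → Emb.to e₃ x ≈[ X″ ] Emb.to e₂ (Emb.to e₁ x)) →
  ∀ f → mapStep dec″ e₃ e₃ f ≈[ X″ ⇒ X″ ] mapStep dec″ e₂ e₂ (mapStep dec′ e₁ e₁ f)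
mapStep-∘ {X} {X′} {X″} dec′ dec″ e₁ e₂ e₃ comm f = CUSL.≤-antisym (X″ ⇒ X″)
  (pointwise λ u → mapStep-lub dec″ e₃ e₃ f u λ ∈p x≤u →
     X″.≤-trans (X″.≤-reflexive (comm _))
       (mapStep-ub dec″ e₂ e₂ g u (∈-map⁺ (both dec′ e₁ e₁) ∈p) (X″.≤-trans (X″.≥-reflexive (comm _)) x≤u)))
  (pointwise λ u → mapStep-lub dec″ e₂ e₂ g u λ ∈p x≤u → helper u (∈-map⁻ (both dec′ e₁ e₁) ∈p) x≤u)
  where
  module X″ = CUSL X″

  g = mapStep dec′ e₁ e₁ f

  helper : ∀ u {x v} →
    ∃[ p ] p ∈ presentation f × (x , v) ≡ (Emb.to e₁ (proj₁ p) , Emb.to e₁ (proj₂ p)) →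
    Emb.to e₂ x X″.≤ u → Emb.to e₂ v X″.≤ mapStep dec″ e₃ e₃ f · u
  helper u (_ , ∈p , refl) x≤u = X″.≤-trans (X″.≥-reflexive (comm _))
    (mapStep-ub dec″ e₃ e₃ f u ∈p (X″.≤-trans (X″.≤-reflexive (comm _)) x≤u))

------------------------------------------------------------------------
-- The CUSLs 𝒞ₙ

data Elt (X : CUSL) : Set where
  bot : Elt X
  U   : Elt X
  lam : Step X X → Elt X
  Pi  : ∣ X ∣ → Step X X → Elt X

module _ {X : CUSL} where
  private module S = CUSL (X ⇒ X)

  infix 4 _≤ₑ_

  -- lam⊥≤ makes  lam ⊥ₛ  equivalent to  bot.
  data _≤ₑ_ : Elt X → Elt X → Set where
    bot≤    : ∀ {y} → bot ≤ₑ y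
    lam⊥≤   : ∀ {f y} → f S.≤ S.⊥ → lam f ≤ₑ y
    U≤U     : U ≤ₑ U
    lam≤lam : ∀ {f g} → f S.≤ g → lam f ≤ₑ lam g
    Pi≤Pi   : ∀ {a a′ b b′} → a ≤[ X ] a′ → b S.≤ b′ → Pi a b ≤ₑ Pi a′ b′

  ≤ₑ-refl : ∀ {x} → x ≤ₑ x
  ≤ₑ-refl {bot}    = bot≤
  ≤ₑ-refl {U}      = U≤U
  ≤ₑ-refl {lam f}  = lam≤lam S.≤-refl
  ≤ₑ-refl {Pi a b} = Pi≤Pi (CUSL.≤-refl X) S.≤-refl

  ≤ₑ-trans : ∀ {x y z} → x ≤ₑ y → y ≤ₑ z → x ≤ₑ z
  ≤ₑ-trans bot≤ _ = bot≤
  ≤ₑ-trans (lam⊥≤ f≤⊥) _ = lam⊥≤ f≤⊥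
  ≤ₑ-trans U≤U U≤U = U≤U
  ≤ₑ-trans (lam≤lam {f} {g} f≤g) (lam⊥≤ g≤⊥) = lam⊥≤ (S.≤-trans f≤g g≤⊥)
  ≤ₑ-trans (lam≤lam {f} {g} f≤g) (lam≤lam {g = h} g≤h) = lam≤lam (S.≤-trans f≤g g≤h)
  ≤ₑ-trans (Pi≤Pi {b = b} {b′} p q) (Pi≤Pi {b′ = b″} p′ q′) =
    Pi≤Pi (CUSL.≤-trans X p p′) (S.≤-trans q q′)

EltPoset : CUSL → Poset 0ℓ 0ℓ 0ℓ
EltPoset X = Sym.poset {R = _≤ₑ_ {X}} ≤ₑ-refl ≤ₑ-trans

module _ {X : CUSL} where
  private module S = CUSL (X ⇒ X)

  IsSupₑ : Elt X → Elt X → Elt X → Set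
  IsSupₑ x y s = x ≤ₑ s × y ≤ₑ s × (∀ {z} → x ≤ₑ z → y ≤ₑ z → s ≤ₑ z)

  supˡ : ∀ {x y} → (∀ {z} → y ≤ₑ z) → IsSupₑ x y x
  supˡ y≤ = ≤ₑ-refl , y≤ , λ x≤z _ → x≤z

  supʳ : ∀ {x y} → (∀ {z} → x ≤ₑ z) → IsSupₑ x y y
  supʳ x≤ = x≤ , ≤ₑ-refl , λ _ y≤z → y≤z

  sup-U : IsSupₑ U U U
  sup-U = U≤U , U≤U , λ U≤z _ → U≤z

  sup-lam : ∀ {f g h} → S.IsSup f g h → IsSupₑ (lam f) (lam g) (lam h)
  sup-lam {f} {g} {h} (f≤h , g≤h , least) = lam≤lam f≤h , lam≤lam g≤h , least′
    where
    least′ : ∀ {z} → lam f ≤ₑ z → lam g ≤ₑ z → lam h ≤ₑ z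
    least′ (lam⊥≤ p)   (lam⊥≤ q)           = lam⊥≤ (least p q)
    least′ (lam⊥≤ p)   (lam≤lam {g = k} q) = lam≤lam (least (S.≤-trans p (S.min k)) q)
    least′ (lam≤lam {g = k} p) (lam⊥≤ q)   = lam≤lam (least p (S.≤-trans q (S.min k)))
    least′ (lam≤lam {g = k} p) (lam≤lam q) = lam≤lam (least p q)

  sup-Pi : ∀ {a a′ c b b′ d} → CUSL.IsSup X a a′ c → S.IsSup b b′ d →
           IsSupₑ (Pi a b) (Pi a′ b′) (Pi c d)
  sup-Pi {a} {a′} {c} {b} {b′} {d} (a≤ , a′≤ , leastᵃ) (b≤ , b′≤ , leastᵇ) =
    Pi≤Pi a≤ b≤ , Pi≤Pi a′≤ b′≤ , least′
    where
    least′ : ∀ {z} → Pi a b ≤ₑ z → Pi a′ b′ ≤ₑ z → Pi c d ≤ₑ z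
    least′ (Pi≤Pi {b′ = k} p q) (Pi≤Pi p′ q′) = Pi≤Pi (leastᵃ p p′) (leastᵇ q q′)

  supₑ : ∀ {x y z} → x ≤ₑ z → y ≤ₑ z → ∃ (IsSupₑ x y)
  supₑ bot≤          q           = _ , supʳ bot≤
  supₑ (lam⊥≤ f≤⊥)   q           = _ , supʳ (lam⊥≤ f≤⊥)
  supₑ p             bot≤        = _ , supˡ bot≤
  supₑ p             (lam⊥≤ g≤⊥) = _ , supˡ (lam⊥≤ g≤⊥)
  supₑ U≤U           U≤U         = U , sup-U
  supₑ (lam≤lam {f} {h} p) (lam≤lam {g} q) =
    let (s , isSup) = S.sup p q in lam s , sup-lam isSup
  supₑ (Pi≤Pi {b = b} {d} p q) (Pi≤Pi {b = b′} p′ q′) =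
    let (a , isSupᵃ) = CUSL.sup X p p′
        (s , isSup)  = S.sup q q′
    in Pi a s , sup-Pi isSupᵃ isSup

EltCUSL : CUSL → CUSL
EltCUSL X = record
  { poset = EltPoset X
  ; ⊥     = bot
  ; min   = λ _ → bot≤
  ; sup   = supₑ
  }

dec-Elt : ∀ {X} → DecCUSL X → DecCUSL (EltCUSL X)
dec-Elt {X} dec = λ where
    bot      y         → yes bot≤
    U        bot       → no λ ()
    U        U         → yes U≤U
    U        (lam g)   → no λ ()
    U        (Pi a b)  → no λ ()
    (lam f)  bot       → map′ lam⊥≤ (λ { (lam⊥≤ p) → p }) (decₛ f S.⊥)
    (lam f)  U         → map′ lam⊥≤ (λ { (lam⊥≤ p) → p }) (decₛ f S.⊥)
    (lam f)  (Pi a b)  → map′ lam⊥≤ (λ { (lam⊥≤ p) → p }) (decₛ f S.⊥)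
    (lam f)  (lam g)   → map′ lam≤lam
      (λ { (lam⊥≤ p) → S.≤-trans p (S.min g) ; (lam≤lam p) → p }) (decₛ f g)
    (Pi a b) bot       → no λ ()
    (Pi a b) U         → no λ ()
    (Pi a b) (lam g)   → no λ ()
    (Pi a b) (Pi c d)  → map′ (λ { (p , q) → Pi≤Pi p q }) (λ { (Pi≤Pi p q) → p , q })
      (dec a c ×-dec decₛ b d)
  where
  module S = CUSL (X ⇒ X)
  decₛ : DecCUSL (X ⇒ X)
  decₛ = dec-⇒ {X} {X} dec

-- Recursive extension of an embedding to the next level.
module _ {X Y : CUSL} (dec : DecCUSL Y) (e : Emb X Y) where
  private
    module e  = Emb e
    module E  = Emb (emb-⇒ dec e e)
    module S  = CUSL (X ⇒ X)
    module S′ = CUSL (Y ⇒ Y)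

  toₑ : Elt X → Elt Y
  toₑ bot      = bot
  toₑ U        = U
  toₑ (lam f)  = lam (mapStep dec e e f)
  toₑ (Pi a b) = Pi (e.to a) (mapStep dec e e b)

  reflect-⊥ : ∀ {f} → mapStep dec e e f S′.≤ S′.⊥ → f S.≤ S.⊥
  reflect-⊥ {f} p = E.reflect
    (S′.≤-trans p (S′.min (E.to S.⊥)))

  monoₑ : ∀ {x y} → x ≤ₑ y → toₑ x ≤ₑ toₑ y
  monoₑ bot≤ = bot≤
  monoₑ (lam⊥≤ {f} p) = lam⊥≤
    (S′.≤-trans (E.mono p) E.bottom)
  monoₑ U≤U = U≤U
  monoₑ (lam≤lam {f} {g} p) = lam≤lam (E.mono p)
  monoₑ (Pi≤Pi {b = b} {b′} p q) = Pi≤Pi (e.mono p) (E.mono q)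

  reflectₑ : ∀ {x y} → toₑ x ≤ₑ toₑ y → x ≤ₑ y
  reflectₑ {bot} _ = bot≤
  reflectₑ {U}      {U}     _             = U≤U
  reflectₑ {lam f}  {bot}   (lam⊥≤ p)     = lam⊥≤ (reflect-⊥ {f} p)
  reflectₑ {lam f}  {U}     (lam⊥≤ p)     = lam⊥≤ (reflect-⊥ {f} p)
  reflectₑ {lam f}  {Pi _ _} (lam⊥≤ p)    = lam⊥≤ (reflect-⊥ {f} p)
  reflectₑ {lam f}  {lam g} (lam⊥≤ p)     = lam⊥≤ (reflect-⊥ {f} p)
  reflectₑ {lam f}  {lam g} (lam≤lam p)   = lam≤lam (E.reflect p)
  reflectₑ {Pi a b} {Pi c d} (Pi≤Pi p q)  = Pi≤Pi (e.reflect p) (E.reflect q)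

  joinₑ : ∀ {x y z} → toₑ x ≤ₑ z → toₑ y ≤ₑ z → ∃[ s ] IsSupₑ x y s × toₑ s ≤ₑ z
  joinₑ {bot}    {y}      p q = y , supʳ bot≤ , q
  joinₑ {U}      {bot}    p q = U , supˡ bot≤ , p
  joinₑ {lam f}  {bot}    p q = lam f , supˡ bot≤ , p
  joinₑ {Pi a b} {bot}    p q = Pi a b , supˡ bot≤ , p
  joinₑ {lam f}  {y}      (lam⊥≤ p) q = y , supʳ (lam⊥≤ (reflect-⊥ {f} p)) , q
  joinₑ {x}      {lam g}  p (lam⊥≤ q) = x , supˡ (lam⊥≤ (reflect-⊥ {g} q)) , p
  joinₑ {U}      {U}      U≤U U≤U = U , sup-U , U≤U
  joinₑ {U}      {Pi _ _} U≤U ()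
  joinₑ {Pi _ _} {U}      (Pi≤Pi _ _) ()
  joinₑ {lam f}  {lam g}  (lam≤lam {g = k} p) (lam≤lam q) =
    let (s , isSup , s≤) = E.join p q in lam s , sup-lam isSup , lam≤lam s≤
  joinₑ {Pi a b} {Pi a′ b′} (Pi≤Pi {b′ = k} p q) (Pi≤Pi p′ q′) =
    let (c , isSupᵃ , c≤) = e.join p p′
        (s , isSup , s≤)  = E.join q q′
    in Pi c s , sup-Pi isSupᵃ isSup , Pi≤Pi c≤ s≤

  emb-Elt : Emb (EltCUSL X) (EltCUSL Y)
  emb-Elt = record
    { to = toₑ ; mono = monoₑ ; reflect = reflectₑ ; bottom = bot≤ ; join = joinₑ }

One : CUSL
One = record
  { poset = Sym.poset {R = λ (_ _ : ⊤) → ⊤} _ _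
  ; ⊥     = tt
  ; min   = _
  ; sup   = λ _ _ → tt , _
  }

emb-One : ∀ X → Emb One X
emb-One X = record
  { to = λ _ → ⊥ ; mono = λ _ → ≤-refl ; reflect = _ ; bottom = ≤-refl
  ; join = λ _ _ → tt , _ , min _ }
  where open CUSL X

C : ℕ → CUSL
C zero    = One
C (suc n) = EltCUSL (C n)

dec-C : ∀ n → DecCUSL (C n)
dec-C zero    _ _ = yes tt
dec-C (suc n)     = dec-Elt (dec-C n)

-- The inclusion of 𝒞ₙ into 𝒞ₘ for n ≤ m.  The step 𝒞ₙ ⊆ 𝒞ₙ₊₁ is the
-- case m = n + 1; lift-∘ below says that the general case is the
-- composite of these.
lift : ∀ {n m} → n ℕ.≤ m → Emb (C n) (C m)
lift {m = m}     z≤n     = emb-One (C m)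
lift {m = suc m} (s≤s p) = emb-Elt (dec-C m) (lift p)

lift-∘ : ∀ {n m k} (p : n ℕ.≤ m) (q : m ℕ.≤ k) (r : n ℕ.≤ k) (x : ∣ C n ∣) →
         Emb.to (lift r) x ≈[ C k ] Emb.to (lift q) (Emb.to (lift p) x)
lift-∘ {k = k} z≤n q z≤n x = CUSL.≤-antisym (C k) (CUSL.min (C k) _) (bottom′ q)
  where
  bottom′ : ∀ {m k} (q : m ℕ.≤ k) → Emb.to (lift q) (CUSL.⊥ (C m)) ≤[ C k ] CUSL.⊥ (C k)
  bottom′ q = Emb.bottom (lift q)
lift-∘ {suc n} {suc m} {suc k} (s≤s p) (s≤s q) (s≤s r) = λ where
    bot      → CUSL.≤-antisym (C (suc k)) bot≤ bot≤
    U        → CUSL.≤-antisym (C (suc k)) U≤U U≤U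
    (lam f)  → CUSL.≤-antisym (C (suc k)) (lam≤lam (≤-of f)) (lam≤lam (≥-of f))
    (Pi a b) → CUSL.≤-antisym (C (suc k))
      (Pi≤Pi (CUSL.≤-reflexive (C k) (IH a)) (≤-of b))
      (Pi≤Pi (CUSL.≥-reflexive (C k) (IH a)) (≥-of b))
  where
  module S = CUSL (C k ⇒ C k)
  IH = lift-∘ p q r

  direct composite : Step (C n) (C n) → Step (C k) (C k)
  direct    f = mapStep (dec-C k) (lift r) (lift r) f
  composite f = mapStep (dec-C k) (lift q) (lift q) (mapStep (dec-C m) (lift p) (lift p) f)

  fun-≈ : ∀ f → direct f S.≈ composite f
  fun-≈ = mapStep-∘ (dec-C m) (dec-C k) (lift p) (lift q) (lift r) IH

  ≤-of : ∀ f → direct f S.≤ composite f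
  ≤-of f = S.≤-reflexive (fun-≈ f)

  ≥-of : ∀ f → composite f S.≤ direct f
  ≥-of f = S.≥-reflexive (fun-≈ f)

------------------------------------------------------------------------
-- The union 𝒞 of the 𝒞ₙ

infix 4 _⊑_

-- A record rather than a function, so that the stages can be inferred.
record _⊑_ (x y : Σ ℕ λ n → ∣ C n ∣) : Set where
  no-eta-equality
  pattern
  constructor stage
  private
    n = proj₁ x
    m = proj₁ y
  field
    at-⊔ : Emb.to (lift (ℕₚ.m≤m⊔n n m)) (proj₂ x) ≤[ C (n ⊔ m) ]
           Emb.to (lift (ℕₚ.m≤n⊔m n m)) (proj₂ y)

-- Any other common stage gives the same order.
⊑-from : ∀ {n m k} (p : n ℕ.≤ k) (q : m ℕ.≤ k) {u v} →
         Emb.to (lift p) u ≤[ C k ] Emb.to (lift q) v → (n , u) ⊑ (m , v)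
⊑-from {n} {m} {k} p q {u} {v} h = stage (Emb.reflect (lift r)
  (≤-trans (≥-reflexive (lift-∘ (ℕₚ.m≤m⊔n n m) r p u))
    (≤-trans h (≤-reflexive (lift-∘ (ℕₚ.m≤n⊔m n m) r q v)))))
  where
  open CUSL (C k)
  r = ℕₚ.⊔-lub p q

⊑-to : ∀ {n m k} (p : n ℕ.≤ k) (q : m ℕ.≤ k) {u v} →
       (n , u) ⊑ (m , v) → Emb.to (lift p) u ≤[ C k ] Emb.to (lift q) v
⊑-to {n} {m} {k} p q {u} {v} (stage h) =
  ≤-trans (≤-reflexive (lift-∘ (ℕₚ.m≤m⊔n n m) r p u))
    (≤-trans (Emb.mono (lift r) h) (≥-reflexive (lift-∘ (ℕₚ.m≤n⊔m n m) r q v)))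
  where
  open CUSL (C k)
  r = ℕₚ.⊔-lub p q

⊑-refl : ∀ {x} → x ⊑ x
⊑-refl {n , u} = ⊑-from ℕₚ.≤-refl ℕₚ.≤-refl (CUSL.≤-refl (C n))

⊑-trans : ∀ {x y z} → x ⊑ y → y ⊑ z → x ⊑ z
⊑-trans {n , _} {m , _} {k , _} x⊑y y⊑z = ⊑-from p r (CUSL.≤-trans (C (n ⊔ m ⊔ k))
  (⊑-to p q x⊑y) (⊑-to q r y⊑z))
  where
  p = ℕₚ.≤-trans (ℕₚ.m≤m⊔n n m) (ℕₚ.m≤m⊔n (n ⊔ m) k)
  q = ℕₚ.≤-trans (ℕₚ.m≤n⊔m n m) (ℕₚ.m≤m⊔n (n ⊔ m) k)
  r = ℕₚ.m≤n⊔m (n ⊔ m) k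

up : ∀ {n u v} → u ≤[ C n ] v → (n , u) ⊑ (n , v)
up {n} u≤v = ⊑-from ℕₚ.≤-refl ℕₚ.≤-refl (Emb.mono (lift (ℕₚ.≤-refl {n})) u≤v)

lift-⊑ : ∀ {n k} (p : n ℕ.≤ k) u → (n , u) ⊑ (k , Emb.to (lift p) u)
lift-⊑ {k = k} p u = ⊑-from p ℕₚ.≤-refl (CUSL.≤-reflexive (C k) (lift-∘ p ℕₚ.≤-refl p u))

lift-⊒ : ∀ {n k} (p : n ℕ.≤ k) u → (k , Emb.to (lift p) u) ⊑ (n , u)
lift-⊒ {k = k} p u = ⊑-from ℕₚ.≤-refl p (CUSL.≥-reflexive (C k) (lift-∘ p ℕₚ.≤-refl p u))

join𝒞 : ∀ {n x y z} → (n , x) ⊑ z → (n , y) ⊑ z → ∃[ s ] CUSL.IsSup (C n) x y s × (n , s) ⊑ z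
join𝒞 {n} {z = m , z} x⊑z y⊑z =
  let p = ℕₚ.m≤m⊔n n m
      q = ℕₚ.m≤n⊔m n m
      (s , isSup , s≤z) = Emb.join (lift p) (⊑-to p q x⊑z) (⊑-to p q y⊑z)
  in s , isSup , ⊑-from p q s≤z

𝒞 : CUSL
𝒞 = record
  { poset = Sym.poset {R = _⊑_} ⊑-refl ⊑-trans
  ; ⊥     = 0 , tt
  ; min   = λ { (m , y) → ⊑-from z≤n ℕₚ.≤-refl (CUSL.min (C m) _) }
  ; sup   = λ { {n , x} {m , y} x⊑z y⊑z →
      let p = ℕₚ.m≤m⊔n n m
          q = ℕₚ.m≤n⊔m n m
          (s , (x≤s , y≤s , least) , _) =
            join𝒞 (⊑-trans (lift-⊒ p x) x⊑z) (⊑-trans (lift-⊒ q y) y⊑z)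
      in (n ⊔ m , s) ,
         ⊑-trans (lift-⊑ p x) (up x≤s) ,
         ⊑-trans (lift-⊑ q y) (up y≤s) ,
         λ x⊑w y⊑w →
           let (_ , (x≤t , y≤t , _) , t⊑w) =
                 join𝒞 (⊑-trans (lift-⊒ p x) x⊑w) (⊑-trans (lift-⊒ q y) y⊑w)
           in ⊑-trans (up (least x≤t y≤t)) t⊑w }
  }

module 𝒞 = CUSL 𝒞

dec-𝒞 : DecCUSL 𝒞
dec-𝒞 (n , _) (m , _) = map′ stage _⊑_.at-⊔ (dec-C (n ⊔ m) _ _)

inj : ∀ n → Emb (C n) 𝒞
inj n = record
  { to      = n ,_
  ; mono    = up
  ; reflect = λ u⊑v → Emb.reflect (lift (ℕₚ.≤-refl {n})) (⊑-to ℕₚ.≤-refl ℕₚ.≤-refl u⊑v)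
  ; bottom  = ⊑-from ℕₚ.≤-refl z≤n (Emb.bottom (lift (ℕₚ.≤-refl {n})))
  ; join    = join𝒞
  }

-- A step function of 𝒞ₙ ⇒ 𝒞ₙ, read (by its presentation) as a step
-- function on 𝒞.  As presentations are finite, every step function on 𝒞
-- arises in this way from some n.
onC : ∀ n → Step (C n) (C n) → Step 𝒞 𝒞
onC n = mapStep dec-𝒞 (inj n) (inj n)

module _ {n k : ℕ} (p : n ℕ.≤ k) where
  liftₛ : Step (C n) (C n) → Step (C k) (C k)
  liftₛ = mapStep (dec-C k) (lift p) (lift p)

  onC-lift : ∀ f → onC n f ≈[ 𝒞 ⇒ 𝒞 ] onC k (liftₛ f)
  onC-lift = mapStep-∘ (dec-C k) dec-𝒞 (lift p) (inj k) (inj n)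
    (λ x → 𝒞.≤-antisym (lift-⊑ p x) (lift-⊒ p x))

  onC-lift-≤ : ∀ f → onC n f ≤ₛ onC k (liftₛ f)
  onC-lift-≤ f = CUSL.≤-reflexive (𝒞 ⇒ 𝒞) (onC-lift f)

  onC-lift-≥ : ∀ f → onC k (liftₛ f) ≤ₛ onC n f
  onC-lift-≥ f = CUSL.≥-reflexive (𝒞 ⇒ 𝒞) (onC-lift f)

-- app(x,–) as a step function on 𝒞
fn : ∀ n → ∣ C n ∣ → Step 𝒞 𝒞
fn (suc n) (lam f) = onC n f
fn _       _       = ⊥ₛ

app : ∣ 𝒞 ∣ → ∣ 𝒞 ∣ → ∣ 𝒞 ∣
app (n , v) u = fn n v · u

appₙ : ∀ n → ∣ C (suc n) ∣ → ∣ C n ∣ → ∣ C n ∣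
appₙ n (lam f) w = f · w
appₙ n _       _ = CUSL.⊥ (C n)

fn-mono : ∀ n {x y : ∣ C n ∣} → x ≤[ C n ] y → fn n x ≤ₛ fn n y
fn-mono zero    _               = pointwise λ _ → 𝒞.≤-refl
fn-mono (suc n) bot≤            = pointwise λ _ → 𝒞.min _
fn-mono (suc n) (lam⊥≤ p)       = pointwise λ u → 𝒞.≤-trans
  (at (mapStep-mono dec-𝒞 (inj n) (inj n) p) u)
  (𝒞.≤-trans (at (Emb.bottom (emb-⇒ dec-𝒞 (inj n) (inj n))) u) (𝒞.min _))
fn-mono (suc n) U≤U             = pointwise λ _ → 𝒞.≤-refl
fn-mono (suc n) (lam≤lam p)     = mapStep-mono dec-𝒞 (inj n) (inj n) p
fn-mono (suc n) (Pi≤Pi _ _)     = pointwise λ _ → 𝒞.≤-refl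

fn-lift-≤ : ∀ {n k} (p : n ℕ.≤ k) x → fn n x ≤ₛ fn k (Emb.to (lift p) x)
fn-lift-≤ z≤n x            = pointwise λ _ → 𝒞.min _
fn-lift-≤ (s≤s p) bot      = pointwise λ _ → 𝒞.≤-refl
fn-lift-≤ (s≤s p) U        = pointwise λ _ → 𝒞.≤-refl
fn-lift-≤ (s≤s p) (lam f)  = onC-lift-≤ p f
fn-lift-≤ (s≤s p) (Pi _ _) = pointwise λ _ → 𝒞.≤-refl

fn-lift-≥ : ∀ {n k} (p : n ℕ.≤ k) x → fn k (Emb.to (lift p) x) ≤ₛ fn n x
fn-lift-≥ {k = zero}  z≤n x = pointwise λ _ → 𝒞.≤-refl
fn-lift-≥ {k = suc k} z≤n x = pointwise λ _ → 𝒞.≤-refl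
fn-lift-≥ (s≤s p) bot       = pointwise λ _ → 𝒞.≤-refl
fn-lift-≥ (s≤s p) U         = pointwise λ _ → 𝒞.≤-refl
fn-lift-≥ (s≤s p) (lam f)   = onC-lift-≥ p f
fn-lift-≥ (s≤s p) (Pi _ _)  = pointwise λ _ → 𝒞.≤-refl

app-mono : ∀ {v v′ u u′} → v ⊑ v′ → u ⊑ u′ → app v u ⊑ app v′ u′
app-mono {n , x} {m , y} {u} {u′} x⊑y u⊑u′ =
  𝒞.≤-trans (monotone (fn n x) u⊑u′)
  (𝒞.≤-trans (at (fn-lift-≤ p x) u′)
  (𝒞.≤-trans (at (fn-mono (n ⊔ m) (⊑-to p q x⊑y)) u′)
             (at (fn-lift-≥ q y) u′)))
  where
  p = ℕₚ.m≤m⊔n n m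
  q = ℕₚ.m≤n⊔m n m

lam⊑lam : ∀ {n m} {f : Step (C n) (C n)} {g : Step (C m) (C m)} →
          onC n f ≤ₛ onC m g → (suc n , lam f) ⊑ (suc m , lam g)
lam⊑lam {n} {m} {f} {g} f≤g = ⊑-from (s≤s p) (s≤s q) (lam≤lam
  (Emb.reflect (emb-⇒ dec-𝒞 (inj (n ⊔ m)) (inj (n ⊔ m)))
    (S.≤-trans (onC-lift-≥ p f) (S.≤-trans f≤g (onC-lift-≤ q g)))))
  where
  module S = CUSL (𝒞 ⇒ 𝒞)
  p = ℕₚ.m≤m⊔n n m
  q = ℕₚ.m≤n⊔m n m

-- Inversion at a stage k + 1 containing both elements.
module _ {m n k : ℕ} (p : m ℕ.≤ suc k) (q : n ℕ.≤ k) {x : ∣ C m ∣} where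
  private
    module S  = CUSL (𝒞 ⇒ 𝒞)
    module Sₖ = CUSL (C k ⇒ C k)

    below-⊥ : ∀ {y} → (m , x) ⊑ (suc k , y) → y ≤ₑ bot → (m , x) 𝒞.≈ 𝒞.⊥
    below-⊥ x⊑ y≤ = 𝒞.≤-antisym
      (𝒞.≤-trans x⊑ (𝒞.≤-trans (up {suc k} y≤) (Emb.bottom (inj (suc k))))) (𝒞.min _)

  lam-invₖ : ∀ {f : Step (C n) (C n)} y → y ≤ₑ lam (liftₛ q f) →
             (m , x) ⊑ (suc k , y) → (suc k , y) ⊑ (m , x) →
             ∃[ m′ ] Σ (Step (C m′) (C m′)) λ g → (m , x) 𝒞.≈ (suc m′ , lam g) × onC m′ g ≤ₛ onC n f
  lam-invₖ {f} bot _ x⊑ _ = k , ⊥ₛ ,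
    𝒞.≤-antisym (𝒞.≤-trans x⊑ (up {suc k} bot≤))
                (𝒞.≤-trans (up {suc k} (lam⊥≤ Sₖ.≤-refl)) (𝒞.≤-trans (Emb.bottom (inj (suc k))) (𝒞.min _))) ,
    S.≤-trans (fn-mono (suc k) {lam ⊥ₛ} {lam (liftₛ q f)} (lam⊥≤ Sₖ.≤-refl)) (onC-lift-≥ q f)
  lam-invₖ {f} (lam g) g≤f x⊑ ⊑x = k , g , 𝒞.≤-antisym x⊑ ⊑x ,
    S.≤-trans (fn-mono (suc k) {lam g} {lam (liftₛ q f)} g≤f) (onC-lift-≥ q f)

  Pi-invₖ : ∀ {a} {b : Step (C n) (C n)} y → y ≤ₑ Pi (Emb.to (lift q) a) (liftₛ q b) →
            (m , x) ⊑ (suc k , y) → (suc k , y) ⊑ (m , x) →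
            (m , x) 𝒞.≈ 𝒞.⊥ ⊎
            ∃[ m′ ] ∃[ a′ ] Σ (Step (C m′) (C m′)) λ b′ →
              (m , x) 𝒞.≈ (suc m′ , Pi a′ b′) × (m′ , a′) ⊑ (n , a) × onC m′ b′ ≤ₛ onC n b
  Pi-invₖ bot      bot≤        x⊑ _  = inj₁ (below-⊥ x⊑ bot≤)
  Pi-invₖ (lam f)  (lam⊥≤ f≤⊥) x⊑ _  = inj₁ (below-⊥ x⊑ (lam⊥≤ f≤⊥))
  Pi-invₖ {a} {b} (Pi c d) (Pi≤Pi s t) x⊑ ⊑x = inj₂ (k , c , d , 𝒞.≤-antisym x⊑ ⊑x ,
    𝒞.≤-trans (up s) (lift-⊒ q a) ,
    S.≤-trans (mapStep-mono dec-𝒞 (inj k) (inj k) t) (onC-lift-≥ q b))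

  U-invₖ : ∀ y → y ≤ₑ U → (m , x) ⊑ (suc k , y) → (suc k , y) ⊑ (m , x) →
           (m , x) 𝒞.≈ 𝒞.⊥ ⊎ (m , x) 𝒞.≈ (suc k , U)
  U-invₖ bot     bot≤        x⊑ _  = inj₁ (below-⊥ x⊑ bot≤)
  U-invₖ (lam f) (lam⊥≤ f≤⊥) x⊑ _  = inj₁ (below-⊥ x⊑ (lam⊥≤ f≤⊥))
  U-invₖ U       U≤U         x⊑ ⊑x = inj₂ (𝒞.≤-antisym x⊑ ⊑x)

module _ (m n : ℕ) where
  private
    p : m ℕ.≤ suc (m ⊔ n)
    p = ℕₚ.m≤n⇒m≤1+n (ℕₚ.m≤m⊔n m n)
    q : n ℕ.≤ m ⊔ n
    q = ℕₚ.m≤n⊔m m n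

  lam-inv : ∀ {x} {f : Step (C n) (C n)} → (m , x) ⊑ (suc n , lam f) →
            ∃[ m′ ] Σ (Step (C m′) (C m′)) λ g → (m , x) 𝒞.≈ (suc m′ , lam g) × onC m′ g ≤ₛ onC n f
  lam-inv {x} x⊑ = lam-invₖ p q (Emb.to (lift p) x) (⊑-to p (s≤s q) x⊑) (lift-⊑ p x) (lift-⊒ p x)

  Pi-inv : ∀ {x a} {b : Step (C n) (C n)} → (m , x) ⊑ (suc n , Pi a b) →
           (m , x) 𝒞.≈ 𝒞.⊥ ⊎
           ∃[ m′ ] ∃[ a′ ] Σ (Step (C m′) (C m′)) λ b′ →
             (m , x) 𝒞.≈ (suc m′ , Pi a′ b′) × (m′ , a′) ⊑ (n , a) × onC m′ b′ ≤ₛ onC n b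
  Pi-inv {x} x⊑ = Pi-invₖ p q (Emb.to (lift p) x) (⊑-to p (s≤s q) x⊑) (lift-⊑ p x) (lift-⊒ p x)

U𝒞 : ∣ 𝒞 ∣
U𝒞 = 1 , U

U-inv : ∀ {x} → x ⊑ U𝒞 → x 𝒞.≈ 𝒞.⊥ ⊎ x 𝒞.≈ U𝒞
U-inv {m , x} x⊑ = convert (U-invₖ p z≤n (Emb.to (lift p) x) (⊑-to p q x⊑) (lift-⊑ p x) (lift-⊒ p x))
  where
  p : m ℕ.≤ suc m
  p = ℕₚ.n≤1+n m
  q : 1 ℕ.≤ suc m
  q = s≤s z≤n
  convert : (m , x) 𝒞.≈ 𝒞.⊥ ⊎ (m , x) 𝒞.≈ (suc m , U) → (m , x) 𝒞.≈ 𝒞.⊥ ⊎ (m , x) 𝒞.≈ U𝒞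
  convert (inj₁ x≈⊥) = inj₁ x≈⊥
  convert (inj₂ x≈U) = inj₂ (𝒞.≤-antisym
    (𝒞.≤-trans (𝒞.≤-reflexive x≈U) (lift-⊒ q U))
    (𝒞.≤-trans (lift-⊑ q U) (𝒞.≥-reflexive x≈U)))

------------------------------------------------------------------------
-- Semantic typing

-- Elements are considered up to ≈, so the rules are closed under ≈.

module _ {X : CUSL} (_∶_ : ∣ X ∣ → ∣ X ∣ → Set) where
  dom : Step X X → ∣ X ∣ → Set
  dom f a = ∀ u → ∃[ v ] v ≤[ X ] u × v ∶ a × f · u ≈[ X ] f · v

module _ {X : CUSL} (_∶_ : ∣ X ∣ → ∣ X ∣ → Set) (_∶U : ∣ X ∣ → Set) where
  private module E = CUSL (EltCUSL X)

  data Rules : Elt X → Elt X → Set where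
    rule-Bot  : ∀ {u a} → u E.≈ bot → Rules a U → Rules u a
    rule-Univ : ∀ {u a} → u E.≈ U → a E.≈ U → Rules u a
    rule-Lam  : ∀ {u c f a g} → u E.≈ lam f → c E.≈ Pi a g →
                a ∶U → dom _∶_ f a → (∀ w → (f · w) ∶ (g · w)) → Rules u c
    rule-Pi   : ∀ {u c a g} → u E.≈ Pi a g → c E.≈ U →
                a ∶U → dom _∶_ g a → (∀ w → (g · w) ∶U) → Rules u c

-- HasType n u a  is  u :ₙ a,  and  IsType n a  is  a :ₙ U;  the latter is
-- impossible for n = 0, as U is not in 𝒞₀.
mutual
  HasType : ∀ n → ∣ C n ∣ → ∣ C n ∣ → Set
  HasType zero    _ _ = Empty
  HasType (suc n)     = Rules (HasType n) (IsType n)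

  IsType : ∀ n → ∣ C n ∣ → Set
  IsType zero    _ = Empty
  IsType (suc n) a = HasType (suc n) a U

infix 4 _∶𝒞_
_∶𝒞_ : ∣ 𝒞 ∣ → ∣ 𝒞 ∣ → Set
u ∶𝒞 a = ∃[ n ] ∃[ uₙ ] ∃[ aₙ ] (n , uₙ) 𝒞.≈ u × (n , aₙ) 𝒞.≈ a × HasType n uₙ aₙ

------------------------------------------------------------------------
-- The domain 𝒟 of ideals

record 𝒟 : Set₁ where
  no-eta-equality
  constructor mk𝒟
  field
    mem       : ∣ 𝒞 ∣ → Set
    inhabited : ∃ mem
    down      : ∀ {u v} → u ⊑ v → mem v → mem u
    closed    : ∀ {u v} → mem u → mem v → ∃[ s ] 𝒞.IsSup u v s × mem s

  mem-⊥ : mem 𝒞.⊥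
  mem-⊥ = down (𝒞.min _) (proj₂ inhabited)

  mem-sup : ∀ {u v s} → 𝒞.IsSup u v s → mem u → mem v → mem s
  mem-sup (_ , _ , least) ∈u ∈v =
    let (_ , (u≤ , v≤ , _) , ∈t) = closed ∈u ∈v in down (least u≤ v≤) ∈t

  mem-lub : ∀ us → All mem us → ∃[ s ] 𝒞.IsLub (_∈ us) s × mem s
  mem-lub []       []         = 𝒞.⊥ , ((λ ()) , λ _ → 𝒞.min _) , mem-⊥
  mem-lub (u ∷ us) (∈u ∷ ∈us) =
    let (_ , (ub , lub) , ∈s)        = mem-lub us ∈us
        (t , (u≤t , s≤t , least) , ∈t) = closed ∈u ∈s
    in t ,
       ((λ { (here refl) → u≤t ; (there ∈us′) → 𝒞.≤-trans (ub ∈us′) s≤t }) ,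
        λ h → least (h (here refl)) (lub (h ∘ there))) ,
       ∈t

{-# INLINE mk𝒟 #-}

infix 4 _∈ᴰ_ _∶ᴰ_

_∈ᴰ_ : ∣ 𝒞 ∣ → 𝒟 → Set
u ∈ᴰ α = 𝒟.mem α u

_∶ᴰ_ : 𝒟 → 𝒟 → Set
α ∶ᴰ β = ∀ u → u ∈ᴰ α → ∃[ v ] ∃[ a ] v ∈ᴰ α × a ∈ᴰ β × u ⊑ v × v ∶𝒞 a

↓ : ∣ 𝒞 ∣ → 𝒟
↓ u = record
  { mem       = _⊑ u
  ; inhabited = u , 𝒞.≤-refl
  ; down      = 𝒞.≤-trans
  ; closed    = λ v⊑u w⊑u →
      let (s , v≤ , w≤ , least) = 𝒞.sup v⊑u w⊑u in s , (v≤ , w≤ , least) , least v⊑u w⊑u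
  }

isSup-resp : ∀ {x x′ y y′ s} → x 𝒞.≈ x′ → y 𝒞.≈ y′ → 𝒞.IsSup x′ y′ s → 𝒞.IsSup x y s
isSup-resp x≈ y≈ (x≤ , y≤ , least) =
  𝒞.≤-trans (𝒞.≤-reflexive x≈) x≤ , 𝒞.≤-trans (𝒞.≤-reflexive y≈) y≤ ,
  λ x≤z y≤z → least (𝒞.≤-trans (𝒞.≥-reflexive x≈) x≤z) (𝒞.≤-trans (𝒞.≥-reflexive y≈) y≤z)

⊥-supˡ : ∀ {x y} → x 𝒞.≈ 𝒞.⊥ → 𝒞.IsSup x y y
⊥-supˡ x≈⊥ = 𝒞.≤-trans (𝒞.≤-reflexive x≈⊥) (𝒞.min _) , 𝒞.≤-refl , λ _ y≤z → y≤z

⊥-supʳ : ∀ {x y} → y 𝒞.≈ 𝒞.⊥ → 𝒞.IsSup x y x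
⊥-supʳ y≈⊥ = 𝒞.≤-refl , 𝒞.≤-trans (𝒞.≤-reflexive y≈⊥) (𝒞.min _) , λ x≤z _ → x≤z

via : ∀ {x n k y} → x 𝒞.≈ (n , y) → (p : n ℕ.≤ k) → x 𝒞.≈ (k , Emb.to (lift p) y)
via x≈ p = 𝒞.≤-antisym (𝒞.≤-trans (𝒞.≤-reflexive x≈) (lift-⊑ p _))
                       (𝒞.≤-trans (lift-⊒ p _) (𝒞.≥-reflexive x≈))

joinG : (G : ∣ 𝒞 ∣ → 𝒟) → ∀ {k} (s t : Step (C k) (C k)) →
        (∀ u → onC k s · u ∈ᴰ G u) → (∀ u → onC k t · u ∈ᴰ G u) →
        Σ (Step (C k) (C k)) λ r → CUSL.IsSup (C k ⇒ C k) s t r × (∀ u → onC k r · u ∈ᴰ G u)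
joinG G {k} s t ∈s ∈t =
  joinₛ s t h , joinₛ-sup s t h ,
  λ u → 𝒟.mem-sup (G u) (mapStep-join dec-𝒞 (inj k) (inj k) s t h u) (∈s u) (∈t u)
  where
  at-k : ∀ f → (∀ u → onC k f · u ∈ᴰ G u) → ∀ w → (k , f · w) ∈ᴰ G (k , w)
  at-k f ∈f w = 𝒟.down (G _)
    (𝒞.≥-reflexive (mapStep-to dec-𝒞 (inj k) (inj k) f w)) (∈f _)
  h : ∀ w → ∃ (CUSL.IsSup (C k) (s · w) (t · w))
  h w = let (_ , (s≤ , t≤ , _) , _) = 𝒟.closed (G _) (at-k s ∈s w) (at-k t ∈t w)
            (r , isSup , _)         = join𝒞 s≤ t≤
        in r , isSup

liftG : (G : ∣ 𝒞 ∣ → 𝒟) → ∀ {n k} (p : n ℕ.≤ k) s →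
        (∀ u → onC n s · u ∈ᴰ G u) → ∀ u → onC k (liftₛ p s) · u ∈ᴰ G u
liftG G p s ∈s u = 𝒟.down (G u) (at (onC-lift-≥ p s) u) (∈s u)

-- Suprema of λ(s) and λ(t), and of Π(a,s) and Π(b,t), taken at stage k + 1.
module _ {n m k : ℕ} (p : n ℕ.≤ k) (q : m ℕ.≤ k) where
  lam-sup : ∀ s t {r x y} → x 𝒞.≈ (suc n , lam s) → y 𝒞.≈ (suc m , lam t) →
            CUSL.IsSup (C k ⇒ C k) (liftₛ p s) (liftₛ q t) r → 𝒞.IsSup x y (suc k , lam r)
  lam-sup s t {r} x≈ y≈ isSup = isSup-resp
    (via {y = lam s} x≈ (s≤s p)) (via {y = lam t} y≈ (s≤s q))
    (Emb.presSup (inj (suc k)) {lam (liftₛ p s)} {lam (liftₛ q t)} {lam r} (sup-lam isSup))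

  Pi-sup : ∀ a b s t {c r x y} → x 𝒞.≈ (suc n , Pi a s) → y 𝒞.≈ (suc m , Pi b t) →
           CUSL.IsSup (C k) (Emb.to (lift p) a) (Emb.to (lift q) b) c →
           CUSL.IsSup (C k ⇒ C k) (liftₛ p s) (liftₛ q t) r → 𝒞.IsSup x y (suc k , Pi c r)
  Pi-sup a b s t {c} {r} x≈ y≈ isSupᵃ isSup = isSup-resp
    (via {y = Pi a s} x≈ (s≤s p)) (via {y = Pi b t} y≈ (s≤s q))
    (Emb.presSup (inj (suc k)) {Pi _ (liftₛ p s)} {Pi _ (liftₛ q t)} {Pi c r} (sup-Pi isSupᵃ isSup))

𝐔 : 𝒟
𝐔 = record
  { mem       = λ x → x 𝒞.≈ 𝒞.⊥ ⊎ x 𝒞.≈ U𝒞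
  ; inhabited = U𝒞 , inj₂ 𝒞-refl
  ; down      = λ u⊑v ∈v → U-inv (𝒞.≤-trans u⊑v (below-U ∈v))
  ; closed    = λ ∈u ∈v →
      let (s , u≤ , v≤ , least) = 𝒞.sup (below-U ∈u) (below-U ∈v)
      in s , (u≤ , v≤ , least) , U-inv (least (below-U ∈u) (below-U ∈v))
  }
  where
  𝒞-refl : U𝒞 𝒞.≈ U𝒞
  𝒞-refl = 𝒞.≤-antisym 𝒞.≤-refl 𝒞.≤-refl
  below-U : ∀ {x} → x 𝒞.≈ 𝒞.⊥ ⊎ x 𝒞.≈ U𝒞 → x ⊑ U𝒞
  below-U (inj₁ x≈⊥) = 𝒞.≤-trans (𝒞.≤-reflexive x≈⊥) (𝒞.min _)
  below-U (inj₂ x≈U) = 𝒞.≤-reflexive x≈U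

-- 𝛌 and 𝚷 give an ideal for every map g; continuity of g is not needed.

𝛌 : (𝒟 → 𝒟) → 𝒟
𝛌 g = record
  { mem       = mem
  ; inhabited = (1 , lam ⊥ₛ) , 0 , ⊥ₛ , 𝒞.≤-antisym 𝒞.≤-refl 𝒞.≤-refl , λ u → ⊥∈ u
  ; down      = down
  ; closed    = closed
  }
  where
  G : ∣ 𝒞 ∣ → 𝒟
  G u = g (↓ u)

  mem : ∣ 𝒞 ∣ → Set
  mem x = ∃[ n ] Σ (Step (C n) (C n)) λ s → x 𝒞.≈ (suc n , lam s) × (∀ u → onC n s · u ∈ᴰ G u)

  ⊥∈ : ∀ u → onC 0 ⊥ₛ · u ∈ᴰ G u
  ⊥∈ u = 𝒟.down (G u) {v = 𝒞.⊥} (mapStep-lub dec-𝒞 (inj 0) (inj 0) ⊥ₛ u (λ ())) (𝒟.mem-⊥ (G u))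

  down : ∀ {x y} → x ⊑ y → mem y → mem x
  down {x} {y} x⊑y (n , s , y≈ , ∈s) =
    let (m , t , x≈ , t≤s) = lam-inv (proj₁ x) n {proj₂ x} {s} (𝒞.≤-trans x⊑y (𝒞.≤-reflexive y≈))
    in m , t , x≈ , λ w → 𝒟.down (G w) (at t≤s w) (∈s w)

  closed : ∀ {x y} → mem x → mem y → ∃[ s ] 𝒞.IsSup x y s × mem s
  closed {x} {y} (n , s , x≈ , ∈s) (m , t , y≈ , ∈t) =
    build (joinG G (liftₛ p s) (liftₛ q t) (liftG G p s ∈s) (liftG G q t ∈t))
    where
    k = n ⊔ m
    p = ℕₚ.m≤m⊔n n m
    q = ℕₚ.m≤n⊔m n m
    build : (Σ (Step (C k) (C k)) λ r →
               CUSL.IsSup (C k ⇒ C k) (liftₛ p s) (liftₛ q t) r × (∀ u → onC k r · u ∈ᴰ G u)) →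
            ∃[ z ] 𝒞.IsSup x y z × mem z
    build (r , isSup , ∈r) = (suc k , lam r) , lam-sup p q s t x≈ y≈ isSup ,
      k , r , 𝒞.≤-antisym 𝒞.≤-refl 𝒞.≤-refl , ∈r

𝚷 : 𝒟 → (𝒟 → 𝒟) → 𝒟
𝚷 α g = record
  { mem       = mem
  ; inhabited = 𝒞.⊥ , inj₁ (𝒞.≤-antisym 𝒞.≤-refl 𝒞.≤-refl)
  ; down      = down
  ; closed    = closed
  }
  where
  G : ∣ 𝒞 ∣ → 𝒟
  G u = g (↓ u)

  mem : ∣ 𝒞 ∣ → Set
  mem x = x 𝒞.≈ 𝒞.⊥ ⊎
          ∃[ n ] ∃[ a ] Σ (Step (C n) (C n)) λ s →
            x 𝒞.≈ (suc n , Pi a s) × (n , a) ∈ᴰ α × (∀ u → onC n s · u ∈ᴰ G u)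

  down : ∀ {x y} → x ⊑ y → mem y → mem x
  down x⊑y (inj₁ y≈⊥) = inj₁ (𝒞.≤-antisym (𝒞.≤-trans x⊑y (𝒞.≤-reflexive y≈⊥)) (𝒞.min _))
  down x⊑y (inj₂ (n , a , s , y≈ , ∈a , ∈s)) with Pi-inv _ n {b = s} (𝒞.≤-trans x⊑y (𝒞.≤-reflexive y≈))
  ... | inj₁ x≈⊥ = inj₁ x≈⊥
  ... | inj₂ (m , b , t , x≈ , b⊑a , t≤s) =
    inj₂ (m , b , t , x≈ , 𝒟.down α b⊑a ∈a , λ w → 𝒟.down (G w) (at t≤s w) (∈s w))

  closed : ∀ {x y} → mem x → mem y → ∃[ s ] 𝒞.IsSup x y s × mem s
  closed (inj₁ x≈⊥) ∈y         = _ , ⊥-supˡ x≈⊥ , ∈y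
  closed ∈x@(inj₂ _) (inj₁ y≈⊥) = _ , ⊥-supʳ y≈⊥ , ∈x
  closed {x} {y} (inj₂ (n , a , s , x≈ , ∈a , ∈s)) (inj₂ (m , b , t , y≈ , ∈b , ∈t)) =
    build (𝒟.closed α (𝒟.down α (lift-⊒ p a) ∈a) (𝒟.down α (lift-⊒ q b) ∈b))
          (joinG G (liftₛ p s) (liftₛ q t) (liftG G p s ∈s) (liftG G q t ∈t))
    where
    k = n ⊔ m
    p = ℕₚ.m≤m⊔n n m
    q = ℕₚ.m≤n⊔m n m
    a′ = Emb.to (lift p) a
    b′ = Emb.to (lift q) b
    build : ∃[ c ] 𝒞.IsSup (k , a′) (k , b′) c × c ∈ᴰ α →
            (Σ (Step (C k) (C k)) λ r →
               CUSL.IsSup (C k ⇒ C k) (liftₛ p s) (liftₛ q t) r × (∀ u → onC k r · u ∈ᴰ G u)) →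
            ∃[ z ] 𝒞.IsSup x y z × mem z
    build (c , (a≤c , b≤c , _) , ∈c) (r , isSup , ∈r) with join𝒞 a≤c b≤c
    ... | d , isSupᵃ , d≤c = (suc k , Pi d r) , Pi-sup p q a b s t x≈ y≈ isSupᵃ isSup ,
      inj₂ (k , d , r , 𝒞.≤-antisym 𝒞.≤-refl 𝒞.≤-refl , 𝒟.down α d≤c ∈c , ∈r)

𝐚𝐩𝐩 : 𝒟 → 𝒟 → 𝒟
𝐚𝐩𝐩 α β = record
  { mem       = mem
  ; inhabited = _ , 𝒞.⊥ , 𝒞.⊥ , 𝒟.mem-⊥ α , 𝒟.mem-⊥ β , 𝒞.≤-antisym 𝒞.≤-refl 𝒞.≤-refl
  ; down      = down
  ; closed    = closed
  }
  where
  mem : ∣ 𝒞 ∣ → Set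
  mem w = ∃[ v ] ∃[ u ] v ∈ᴰ α × u ∈ᴰ β × w 𝒞.≈ app v u

  below-app : ∀ {w} n x u → w ⊑ app (n , x) u → (n , x) ∈ᴰ α → u ∈ᴰ β → mem w
  below-app zero x u w⊑ ∈v ∈u = (0 , x) , u , ∈v , ∈u , 𝒞.≤-antisym w⊑ (𝒞.min _)
  below-app (suc n) bot u w⊑ ∈v ∈u = (suc n , bot) , u , ∈v , ∈u , 𝒞.≤-antisym w⊑ (𝒞.min _)
  below-app (suc n) U u w⊑ ∈v ∈u = (suc n , U) , u , ∈v , ∈u , 𝒞.≤-antisym w⊑ (𝒞.min _)
  below-app (suc n) (Pi a b) u w⊑ ∈v ∈u = (suc n , Pi a b) , u , ∈v , ∈u , 𝒞.≤-antisym w⊑ (𝒞.min _)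
  below-app {l , w} (suc n) (lam f) (m , u) w⊑ ∈v ∈u =
    (suc k , lam s) , (m , u) , 𝒟.down α (lam⊑lam s≤f) ∈v , ∈u ,
    𝒞.≤-antisym
      (𝒞.≤-trans (lift-⊑ q w) (mapStep-ub dec-𝒞 (inj k) (inj k) s (m , u) (here refl) (lift-⊒ p u)))
      (mapStep-lub dec-𝒞 (inj k) (inj k) s (m , u) λ { (here refl) _ → lift-⊒ q w })
    where
    k = m ⊔ l
    p = ℕₚ.m≤m⊔n m l
    q = ℕₚ.m≤n⊔m m l
    s : Step (C k) (C k)
    s = singleₛ (dec-C k) (Emb.to (lift p) u) (Emb.to (lift q) w)
    s≤f : onC k s ≤ₛ onC n f
    s≤f = pointwise λ z → mapStep-lub dec-𝒞 (inj k) (inj k) s z λ { (here refl) u⊑z →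
      𝒞.≤-trans (lift-⊒ q w) (𝒞.≤-trans w⊑ (monotone (onC n f) (𝒞.≤-trans (lift-⊑ p u) u⊑z))) }

  down : ∀ {w w′} → w ⊑ w′ → mem w′ → mem w
  down w⊑w′ ((n , x) , u , ∈v , ∈u , w′≈) =
    below-app n x u (𝒞.≤-trans w⊑w′ (𝒞.≤-reflexive w′≈)) ∈v ∈u

  closed : ∀ {w w′} → mem w → mem w′ → ∃[ s ] 𝒞.IsSup w w′ s × mem s
  closed (v , u , ∈v , ∈u , w≈) (v′ , u′ , ∈v′ , ∈u′ , w′≈) =
    let (v″ , (v≤ , v′≤ , _) , ∈v″) = 𝒟.closed α ∈v ∈v′
        (u″ , (u≤ , u′≤ , _) , ∈u″) = 𝒟.closed β ∈u ∈u′
        w⊑  = 𝒞.≤-trans (𝒞.≤-reflexive w≈)  (app-mono v≤ u≤)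
        w′⊑ = 𝒞.≤-trans (𝒞.≤-reflexive w′≈) (app-mono v′≤ u′≤)
        (s , w≤ , w′≤ , least) = 𝒞.sup w⊑ w′⊑
    in s , (w≤ , w′≤ , least) , below-app (proj₁ v″) (proj₂ v″) u″ (least w⊑ w′⊑) ∈v″ ∈u″

-- The supremum, in 𝒟, of the elements of ω having a type in α: the ideal of
-- all elements below the supremum of finitely many of them.
𝐩 : 𝒟 → 𝒟 → 𝒟
𝐩 α ω = record
  { mem       = mem
  ; inhabited = 𝒞.⊥ , [] , [] , 𝒞.⊥ , ((λ ()) , λ _ → 𝒞.min _) , 𝒞.≤-refl
  ; down      = λ { u⊑v (us , all , s , lub , v⊑s) → us , all , s , lub , 𝒞.≤-trans u⊑v v⊑s }
  ; closed    = λ { (us , all , s , (_ , least) , u⊑s) (us′ , all′ , s′ , (_ , least′) , v⊑s′) →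
      let all″ = ++⁺ all all′
          (t , (ub , lub) , _) = 𝒟.mem-lub ω (us ++ us′) (All.map proj₁ all″)
          u⊑t = 𝒞.≤-trans u⊑s  (least (λ ∈us → ub (∈-++⁺ˡ ∈us)))
          v⊑t = 𝒞.≤-trans v⊑s′ (least′ (λ ∈us′ → ub (∈-++⁺ʳ us ∈us′)))
          (r , u≤ , v≤ , leastʳ) = 𝒞.sup u⊑t v⊑t
      in r , (u≤ , v≤ , leastʳ) , us ++ us′ , all″ , t , (ub , lub) , leastʳ u⊑t v⊑t }
  }
  where
  mem : ∣ 𝒞 ∣ → Set
  mem w = ∃[ us ] All (λ u → u ∈ᴰ ω × ∃[ a ] a ∈ᴰ α × u ∶𝒞 a) us ×
          ∃[ s ] 𝒞.IsLub (_∈ us) s × w ⊑ s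

------------------------------------------------------------------------
-- Syntax of MLTT° (well-scoped de Bruijn terms)

infixl 9 _∙_

data Tm (n : ℕ) : Set where
  var : Fin n → Tm n
  𝒰   : Tm n
  Π   : Tm n → Tm (suc n) → Tm n
  ƛ   : Tm n → Tm (suc n) → Tm n
  _∙_ : Tm n → Tm n → Tm n

module TmApp {T : ℕ → Set} (l : Lift T Tm) where
  open Lift l hiding (var) renaming (lift to liftᵗ)

  infixl 8 _/_
  _/_ : ∀ {m n} → Tm m → Sub T m n → Tm n
  var x   / σ = liftᵗ (lookup σ x)
  𝒰       / σ = 𝒰
  Π A B   / σ = Π (A / σ) (B / σ ↑)
  ƛ A M   / σ = ƛ (A / σ) (M / σ ↑)
  (M ∙ N) / σ = (M / σ) ∙ (N / σ)

tmSubst : TermSubst Tm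
tmSubst = record { var = var; app = TmApp._/_ }

open TermSubst tmSubst public using (_/_; _↑; sub; weaken)

infix 9 _[_]
_[_] : ∀ {n} → Tm (suc n) → Tm n → Tm n
M [ N ] = M / sub N

infixl 5 _▹_
data Ctx : ℕ → Set where
  ∅   : Ctx 0
  _▹_ : ∀ {n} → Ctx n → Tm n → Ctx (suc n)

-- The type of a variable, weakened to the whole context.
type : ∀ {n} → Ctx n → Fin n → Tm n
type (Γ ▹ A) zero    = weaken A
type (Γ ▹ A) (suc x) = weaken (type Γ x)

infix 4 ⊢_ _⊢_∶_ _⊢_≐_∶_

mutual
  data ⊢_ : ∀ {n} → Ctx n → Set where
    ⊢∅ : ⊢ ∅
    ⊢▹ : ∀ {n} {Γ : Ctx n} {A} → ⊢ Γ → Γ ⊢ A ∶ 𝒰 → ⊢ (Γ ▹ A)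

  data _⊢_∶_ {n} (Γ : Ctx n) : Tm n → Tm n → Set where
    ty-var  : ∀ x → ⊢ Γ → Γ ⊢ var x ∶ type Γ x
    ty-univ : ⊢ Γ → Γ ⊢ 𝒰 ∶ 𝒰
    ty-Π    : ∀ {A B} → Γ ⊢ A ∶ 𝒰 → (Γ ▹ A) ⊢ B ∶ 𝒰 → Γ ⊢ Π A B ∶ 𝒰
    ty-ƛ    : ∀ {A B M} → Γ ⊢ A ∶ 𝒰 → (Γ ▹ A) ⊢ M ∶ B → Γ ⊢ ƛ A M ∶ Π A B
    ty-app  : ∀ {A B M N} → Γ ⊢ M ∶ Π A B → Γ ⊢ N ∶ A → Γ ⊢ M ∙ N ∶ B [ N ]
    ty-conv : ∀ {A B M} → Γ ⊢ M ∶ A → Γ ⊢ A ≐ B ∶ 𝒰 → Γ ⊢ M ∶ B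

  data _⊢_≐_∶_ {n} (Γ : Ctx n) : Tm n → Tm n → Tm n → Set where
    eq-refl  : ∀ {A M} → Γ ⊢ M ∶ A → Γ ⊢ M ≐ M ∶ A
    eq-sym   : ∀ {A M N} → Γ ⊢ M ≐ N ∶ A → Γ ⊢ N ≐ M ∶ A
    eq-trans : ∀ {A M N P} → Γ ⊢ M ≐ N ∶ A → Γ ⊢ N ≐ P ∶ A → Γ ⊢ M ≐ P ∶ A
    eq-conv  : ∀ {A B M N} → Γ ⊢ M ≐ N ∶ A → Γ ⊢ A ≐ B ∶ 𝒰 → Γ ⊢ M ≐ N ∶ B
    eq-Π     : ∀ {A A′ B B′} → Γ ⊢ A ≐ A′ ∶ 𝒰 → (Γ ▹ A) ⊢ B ≐ B′ ∶ 𝒰 →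
               Γ ⊢ Π A B ≐ Π A′ B′ ∶ 𝒰
    eq-ƛ     : ∀ {A A′ B M M′} → Γ ⊢ A ≐ A′ ∶ 𝒰 → (Γ ▹ A) ⊢ M ≐ M′ ∶ B →
               Γ ⊢ ƛ A M ≐ ƛ A′ M′ ∶ Π A B
    eq-app   : ∀ {A B M M′ N N′} → Γ ⊢ M ≐ M′ ∶ Π A B → Γ ⊢ N ≐ N′ ∶ A →
               Γ ⊢ M ∙ N ≐ M′ ∙ N′ ∶ B [ N ]
    eq-β     : ∀ {A B M N} → Γ ⊢ A ∶ 𝒰 → (Γ ▹ A) ⊢ M ∶ B → Γ ⊢ N ∶ A →
               Γ ⊢ ƛ A M ∙ N ≐ M [ N ] ∶ B [ N ]
    eq-η     : ∀ {A B M N} → Γ ⊢ M ∶ Π A B → Γ ⊢ N ∶ Π A B →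
               (Γ ▹ A) ⊢ weaken M ∙ var zero ≐ weaken N ∙ var zero ∶ B →
               Γ ⊢ M ≐ N ∶ Π A B

infix 4 _↝_ _↝*_ _⊢_⇝*_∶_

data _↝_ {n} : Tm n → Tm n → Set where
  β    : ∀ {A M N} → ƛ A M ∙ N ↝ M [ N ]
  head : ∀ {M M′ N} → M ↝ M′ → M ∙ N ↝ M′ ∙ N

_↝*_ : ∀ {n} → Tm n → Tm n → Set
_↝*_ = Star _↝_

_⊢_⇝*_∶_ : ∀ {n} → Ctx n → Tm n → Tm n → Tm n → Set
Γ ⊢ M ⇝* M′ ∶ A = M ↝* M′ × Γ ⊢ M ≐ M′ ∶ A

------------------------------------------------------------------------
-- Semantics of terms

Env : ℕ → Set₁
Env n = Fin n → 𝒟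

_▸_ : ∀ {n} → Env n → 𝒟 → Env (suc n)
(ρ ▸ α) zero    = α
(ρ ▸ α) (suc x) = ρ x

⟦_⟧ : ∀ {n} → Tm n → Env n → 𝒟
⟦ var x ⟧ ρ = ρ x
⟦ 𝒰 ⟧     ρ = 𝐔
⟦ Π A B ⟧ ρ = 𝚷 (⟦ A ⟧ ρ) (λ u → ⟦ B ⟧ (ρ ▸ 𝐩 (⟦ A ⟧ ρ) u))
⟦ ƛ A M ⟧ ρ = 𝛌 (λ u → ⟦ M ⟧ (ρ ▸ 𝐩 (⟦ A ⟧ ρ) u))
⟦ M ∙ N ⟧ ρ = 𝐚𝐩𝐩 (⟦ M ⟧ ρ) (⟦ N ⟧ ρ)

Fits : ∀ {n} → Env n → Ctx n → Set
Fits ρ Γ = ∀ x → ⟦ type Γ x ⟧ ρ ∶ᴰ 𝐔 × ρ x ∶ᴰ ⟦ type Γ x ⟧ ρ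

------------------------------------------------------------------------
-- The logical relation

-- EqTy n Γ A A′ a  is  Γ ⊩ₙ A ≐ A′ ▷ a,  and  EqTm n Γ M M′ A u a  is
-- Γ ⊩ₙ M ≐ M′ : A ▷ u : a.  The presuppositions are not part of these two
-- relations; they are part of the relations ⊩ below.  An a of the form
-- lam f has type U only if it is ⊥; in that case both relations hold.

mutual
  EqTy : ∀ n {m} → Ctx m → Tm m → Tm m → ∣ C n ∣ → Set
  EqTy zero    Γ T T′ _        = ⊤
  EqTy (suc n) Γ T T′ bot      = ⊤
  EqTy (suc n) Γ T T′ (lam f)  = f ≤ₛ ⊥ₛ
  EqTy (suc n) Γ T T′ U        = Γ ⊢ T ⇝* 𝒰 ∶ 𝒰 × Γ ⊢ T′ ⇝* 𝒰 ∶ 𝒰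
  EqTy (suc n) Γ T T′ (Pi a b) =
    ∃[ A ] ∃[ B ] ∃[ A′ ] ∃[ B′ ]
      Γ ⊢ T ⇝* Π A B ∶ 𝒰 × Γ ⊢ T′ ⇝* Π A′ B′ ∶ 𝒰 ×
      Γ ⊢ A ≐ A′ ∶ 𝒰 × (Γ ▹ A) ⊢ B ≐ B′ ∶ 𝒰 ×
      EqTy n Γ A A′ a ×
      (∀ M M′ v → HasType n v a → Γ ⊢ M ≐ M′ ∶ A → EqTm n Γ M M′ A v a →
         EqTy n Γ (B  [ M ]) (B  [ M′ ]) (b · v) ×
         EqTy n Γ (B′ [ M ]) (B′ [ M′ ]) (b · v) ×
         EqTy n Γ (B  [ M ]) (B′ [ M′ ]) (b · v))

  EqTm : ∀ n {m} → Ctx m → Tm m → Tm m → Tm m → ∣ C n ∣ → ∣ C n ∣ → Set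
  EqTm zero    Γ M M′ T u _        = ⊤
  EqTm (suc n) Γ M M′ T u bot      = ⊤
  EqTm (suc n) Γ M M′ T u (lam f)  = f ≤ₛ ⊥ₛ
  EqTm (suc n) Γ M M′ T u U        = Γ ⊢ T ⇝* 𝒰 ∶ 𝒰 × EqTy (suc n) Γ M M′ u
  EqTm (suc n) Γ M M′ T u (Pi a b) =
    EqTy (suc n) Γ T T (Pi a b) ×
    ∃[ A ] ∃[ B ]
      Γ ⊢ T ⇝* Π A B ∶ 𝒰 ×
      (∀ N N′ w → HasType n w a → Γ ⊢ N ≐ N′ ∶ A → EqTm n Γ N N′ A w a →
         EqTm n Γ (M  ∙ N) (M  ∙ N′) (B [ N ]) (appₙ n u w) (b · w) ×
         EqTm n Γ (M′ ∙ N) (M′ ∙ N′) (B [ N ]) (appₙ n u w) (b · w) ×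
         EqTm n Γ (M  ∙ N) (M′ ∙ N′) (B [ N ]) (appₙ n u w) (b · w))

infix 4 _⊩_≐_▷_ _⊩_≐_∶_▷_∶_

_⊩_≐_▷_ : ∀ {m} → Ctx m → Tm m → Tm m → ∣ 𝒞 ∣ → Set
Γ ⊩ A ≐ A′ ▷ a =
  ∃[ n ] ∃[ aₙ ] (n , aₙ) 𝒞.≈ a × IsType n aₙ × EqTy n Γ A A′ aₙ

_⊩_≐_∶_▷_∶_ : ∀ {m} → Ctx m → Tm m → Tm m → Tm m → ∣ 𝒞 ∣ → ∣ 𝒞 ∣ → Set
Γ ⊩ M ≐ M′ ∶ A ▷ u ∶ a =
  Γ ⊢ M ≐ M′ ∶ A ×
  ∃[ n ] ∃[ uₙ ] ∃[ aₙ ]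
    (n , uₙ) 𝒞.≈ u × (n , aₙ) 𝒞.≈ a × IsType n aₙ × HasType n uₙ aₙ × EqTm n Γ M M′ A uₙ aₙ

-- Sub Tm m n  assigns to each of m variables a term in n variables.
Related : ∀ {m n} → Ctx m → Ctx n → Env m → Sub Tm m n → Sub Tm m n → Set
Related Γ Δ ρ σ σ′ = ∀ x →
  Δ ⊢ lookup σ x ≐ lookup σ′ x ∶ type Γ x / σ ×
  (∀ u a → u ∈ᴰ ρ x → a ∈ᴰ ⟦ type Γ x ⟧ ρ → a ∶𝒞 U𝒞 → u ∶𝒞 a →
     Δ ⊩ lookup σ x ≐ lookup σ′ x ∶ type Γ x / σ ▷ u ∶ a)

{-# OPTIONS --safe #-}
-- The interpretation is sound: by continuity every element of ⟦M⟧ρ lies below one that has a type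
-- in ⟦A⟧ρ, because the finitely many arguments at which a step function takes its values can be
-- lowered to typed ones.  The logical relation at a stage is a partial equivalence relation that
-- is closed under conversion, under head expansion, and under raising and lowering of the compact
-- type and lowering of the compact element; the domain conditions make it independent of the stage.
-- Related substitutions then send derivable equations to related terms, by induction on
-- derivations.  For an application, the given elements are enlarged to some λ(f) : Π(a,g) and t : a
-- whose values f(t) : g(t) dominate the required ones, and the result is lowered again.

module Submission where

open import Defs
open import Data.Empty using (⊥-elim)
open import Data.Unit using (tt)
open import Data.Nat using (ℕ; zero; suc; z≤n; s≤s; _⊔_)
import Data.Nat as ℕ
import Data.Nat.Properties as ℕₚ
open import Data.Fin using (Fin; zero; suc)
import Data.Fin as Fin
open import Data.Fin.Substitution using (Lift; Sub; Subs; TermSubst)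
open import Data.Fin.Substitution.Lemmas using (TermLemmas)
open import Data.Vec using ([]; _∷_; lookup)
open import Data.Vec.Properties using (lookup-map)
open import Data.List as List using (List; []; _∷_)
open import Data.List.Relation.Unary.Any using (here; there)
open import Data.List.Relation.Unary.All as All using (All; []; _∷_)
open import Data.List.Relation.Unary.All.Properties using (map⁺)
open import Data.List.Membership.Propositional using (_∈_)
open import Data.List.Membership.Propositional.Properties using (∈-map⁺)
open import Data.Product using (Σ; ∃; ∃-syntax; _×_; _,_; proj₁; proj₂)
open import Data.Sum using (_⊎_; inj₁; inj₂)
open import Relation.Nullary using (Dec; yes; no; ¬_)
open import Relation.Binary.PropositionalEquality
  using (_≡_; refl; sym; trans; cong; cong₂; subst)
open import Relation.Binary.Construct.Closure.ReflexiveTransitive using (ε; _◅_; _◅◅_; gmap)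
import Relation.Binary.Construct.Interior.Symmetric as Sym
open Sym using (lhs≤rhs; rhs≤lhs)

open Step using (monotone; presentation)
open _≤ₛ_ using (at)

-- Substitution and the metatheory of MLTT°

-- The obstacle is that membership and typing must be brought together. An element of `⟦ M ⟧ ρ` need
-- not be typed, and an element of the interpretation of an application only records some function
-- and argument, found independently of the type `c` at which the result is tested. Hence soundness
-- comes before the logical relation: it finds typed elements above given ones inside the same
-- ideals, with one argument that serves function, codomain and `c` simultaneously. The domain of a
-- Π is contravariant, so every transport lemma needs its opposite at the domain; the domain
-- conditions turn an arbitrary argument into a typed one below it with the same value. The
-- projection `𝐩` in the semantics of binders ties this to substitutions: every element of
-- `𝐩 (⟦ A ⟧ ρ) (↓ w)` lies below `w`, so a pair of arguments related at `w` is related at all of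
-- them, by raising the type and lowering the element. On the syntactic side, two Π-types reached
-- from the same type are identified by determinism of head reduction.

private
  module TS = TermSubst tmSubst

module _ {T : ℕ → Set} {l : Lift T Tm} where
  open TS.Lifted l

  -- `/✶` applies a chain of substitutions one after the other. Pushing it through each constructor
  -- lets `tmLemmas` reduce agreement on terms to agreement on variables.
  Π-/✶-↑✶ : ∀ k {m n A B} (ρs : Subs T m n) → Π A B /✶ ρs ↑✶ k ≡ Π (A /✶ ρs ↑✶ k) (B /✶ ρs ↑✶ suc k)
  Π-/✶-↑✶ k ε        = refl
  Π-/✶-↑✶ k (ρ ◅ ρs) = cong (λ t → TS.app l t _) (Π-/✶-↑✶ k ρs)

  ƛ-/✶-↑✶ : ∀ k {m n A M} (ρs : Subs T m n) → ƛ A M /✶ ρs ↑✶ k ≡ ƛ (A /✶ ρs ↑✶ k) (M /✶ ρs ↑✶ suc k)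
  ƛ-/✶-↑✶ k ε        = refl
  ƛ-/✶-↑✶ k (ρ ◅ ρs) = cong (λ t → TS.app l t _) (ƛ-/✶-↑✶ k ρs)

  ∙-/✶-↑✶ : ∀ k {m n M N} (ρs : Subs T m n) → (M ∙ N) /✶ ρs ↑✶ k ≡ (M /✶ ρs ↑✶ k) ∙ (N /✶ ρs ↑✶ k)
  ∙-/✶-↑✶ k ε        = refl
  ∙-/✶-↑✶ k (ρ ◅ ρs) = cong (λ t → TS.app l t _) (∙-/✶-↑✶ k ρs)

  𝒰-/✶-↑✶ : ∀ k {m n} (ρs : Subs T m n) → 𝒰 /✶ ρs ↑✶ k ≡ 𝒰
  𝒰-/✶-↑✶ k ε        = refl
  𝒰-/✶-↑✶ k (ρ ◅ ρs) = cong (λ t → TS.app l t _) (𝒰-/✶-↑✶ k ρs)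

tmLemmas : TermLemmas Tm
tmLemmas = record { termSubst = tmSubst ; app-var = refl ; /✶-↑✶ = go }
  where
  go : ∀ {T₁ T₂} {lift₁ : Lift T₁ Tm} {lift₂ : Lift T₂ Tm} →
       let open TS.Lifted lift₁ using () renaming (_↑✶_ to _↑✶₁_; _/✶_ to _/✶₁_)
           open TS.Lifted lift₂ using () renaming (_↑✶_ to _↑✶₂_; _/✶_ to _/✶₂_)
       in ∀ {m n} (ρs₁ : Subs T₁ m n) (ρs₂ : Subs T₂ m n) →
          (∀ k x → var x /✶₁ ρs₁ ↑✶₁ k ≡ var x /✶₂ ρs₂ ↑✶₂ k) →
          ∀ k t → t /✶₁ ρs₁ ↑✶₁ k ≡ t /✶₂ ρs₂ ↑✶₂ k
  go ρs₁ ρs₂ hyp k (var x) = hyp k x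
  go ρs₁ ρs₂ hyp k 𝒰       = trans (𝒰-/✶-↑✶ k ρs₁) (sym (𝒰-/✶-↑✶ k ρs₂))
  go ρs₁ ρs₂ hyp k (Π A B) = trans (Π-/✶-↑✶ k ρs₁) (trans
    (cong₂ Π (go ρs₁ ρs₂ hyp k A) (go ρs₁ ρs₂ hyp (suc k) B)) (sym (Π-/✶-↑✶ k ρs₂)))
  go ρs₁ ρs₂ hyp k (ƛ A M) = trans (ƛ-/✶-↑✶ k ρs₁) (trans
    (cong₂ ƛ (go ρs₁ ρs₂ hyp k A) (go ρs₁ ρs₂ hyp (suc k) M)) (sym (ƛ-/✶-↑✶ k ρs₂)))
  go ρs₁ ρs₂ hyp k (M ∙ N) = trans (∙-/✶-↑✶ k ρs₁) (trans
    (cong₂ _∙_ (go ρs₁ ρs₂ hyp k M) (go ρs₁ ρs₂ hyp k N)) (sym (∙-/✶-↑✶ k ρs₂)))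

module TL = TermLemmas tmLemmas

wk : ∀ {n} → Sub Tm n (suc n)
wk = TL.wk

idₛ : ∀ {n} → Sub Tm n n
idₛ = TL.id

/-wk : ∀ {n} (M : Tm n) → M / wk ≡ weaken M
/-wk M = TL./-wk {t = M}

/-id : ∀ {n} (M : Tm n) → M / idₛ ≡ M
/-id = TL.id-vanishes

weaken-↑ : ∀ {m n} (M : Tm m) (σ : Sub Tm m n) → weaken M / σ ↑ ≡ weaken (M / σ)
weaken-↑ M σ = TL.weaken-↑ M {σ}

weaken-∷ : ∀ {m n} (M : Tm m) (N : Tm n) (σ : Sub Tm m n) → weaken M / (N ∷ σ) ≡ M / σ
weaken-∷ M N σ = TL.weaken-∷ M {N} {σ}

weaken-lookup : ∀ {m n} (σ : Sub Tm m n) x → lookup (σ ↑) (suc x) ≡ weaken (lookup σ x)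
weaken-lookup σ x = lookup-map x weaken σ

-- The logical relation instantiates codomains `B / σ ↑`, whereas validity speaks of extended
-- substitutions `N ∷ σ`; this identifies the two.
/-∷ : ∀ {m n} (M : Tm (suc m)) (N : Tm n) (σ : Sub Tm m n) → M / σ ↑ / sub N ≡ M / (N ∷ σ)
/-∷ M N σ = trans (sym (TL./-⊙ M)) (cong (M /_) (cong (N ∷_) TL.map-weaken-⊙-sub))

/-[] : ∀ {m n} (M : Tm (suc m)) (N : Tm m) (σ : Sub Tm m n) → M [ N ] / σ ≡ (M / σ ↑) [ N / σ ]
/-[] M N σ = TL.sub-commutes M

/-[]∷ : ∀ {m n} (M : Tm (suc m)) (N : Tm m) (σ : Sub Tm m n) → M [ N ] / σ ≡ M / (N / σ ∷ σ)
/-[]∷ M N σ = trans (/-[] M N σ) (/-∷ M (N / σ) σ)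

cast-ty : ∀ {n} {Γ : Ctx n} {M M′ A A′} → M ≡ M′ → A ≡ A′ → Γ ⊢ M ∶ A → Γ ⊢ M′ ∶ A′
cast-ty refl refl p = p

cast-eq : ∀ {n} {Γ : Ctx n} {M M′ N N′ A A′} → M ≡ M′ → N ≡ N′ → A ≡ A′ → Γ ⊢ M ≐ N ∶ A → Γ ⊢ M′ ≐ N′ ∶ A′
cast-eq refl refl refl e = e

Wt : ∀ {m n} → Ctx m → Ctx n → Sub Tm m n → Set
Wt Γ Δ σ = ∀ x → Δ ⊢ lookup σ x ∶ type Γ x / σ

data Lifted (S : ∀ {m n} → Ctx m → Ctx n → Sub Tm m n → Set) :
            ∀ {m n} → Ctx m → Ctx n → Sub Tm m n → Set where
  base : ∀ {m n} {Γ : Ctx m} {Δ : Ctx n} {σ} → S Γ Δ σ → ⊢ Δ → Lifted S Γ Δ σ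
  bind : ∀ {m n} {Γ : Ctx m} {Δ : Ctx n} {σ A} → Lifted S Γ Δ σ → Lifted S (Γ ▹ A) (Δ ▹ A / σ) (σ ↑)

-- The well-formedness of the target context is recomputed at the leaves, since a congruence
-- rule for binders has no premise saying that the domain is a type.
module Substitution
  (S : ∀ {m n} → Ctx m → Ctx n → Sub Tm m n → Set)
  (S-Wt : ∀ {m n} {Γ : Ctx m} {Δ : Ctx n} {σ} → Lifted S Γ Δ σ → ⊢ Δ → Wt Γ Δ σ)
  where
  mutual
    ctx-sub : ∀ {m n} {Γ : Ctx m} {Δ : Ctx n} {σ} → ⊢ Γ → Lifted S Γ Δ σ → ⊢ Δ
    ctx-sub _ (base _ ⊢Δ) = ⊢Δ
    ctx-sub (⊢▹ ⊢Γ a) (bind s) = ⊢▹ (ctx-sub ⊢Γ s) (ty-sub a s)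

    ty-sub : ∀ {m n} {Γ : Ctx m} {Δ : Ctx n} {σ M A} → Γ ⊢ M ∶ A → Lifted S Γ Δ σ → Δ ⊢ M / σ ∶ A / σ
    ty-sub (ty-var x ⊢Γ) s = S-Wt s (ctx-sub ⊢Γ s) x
    ty-sub (ty-univ ⊢Γ) s = ty-univ (ctx-sub ⊢Γ s)
    ty-sub (ty-Π a b) s = ty-Π (ty-sub a s) (ty-sub b (bind s))
    ty-sub (ty-ƛ a b) s = ty-ƛ (ty-sub a s) (ty-sub b (bind s))
    ty-sub {σ = σ} (ty-app {B = B} {N = N} p q) s =
      cast-ty refl (sym (/-[] B N σ)) (ty-app (ty-sub p s) (ty-sub q s))
    ty-sub (ty-conv p e) s = ty-conv (ty-sub p s) (eq-sub e s)

    eq-sub : ∀ {m n} {Γ : Ctx m} {Δ : Ctx n} {σ M N A} → Γ ⊢ M ≐ N ∶ A → Lifted S Γ Δ σ → Δ ⊢ M / σ ≐ N / σ ∶ A / σ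
    eq-sub (eq-refl p) s = eq-refl (ty-sub p s)
    eq-sub (eq-sym e) s = eq-sym (eq-sub e s)
    eq-sub (eq-trans e e′) s = eq-trans (eq-sub e s) (eq-sub e′ s)
    eq-sub (eq-conv e e′) s = eq-conv (eq-sub e s) (eq-sub e′ s)
    eq-sub (eq-Π e e′) s = eq-Π (eq-sub e s) (eq-sub e′ (bind s))
    eq-sub (eq-ƛ e e′) s = eq-ƛ (eq-sub e s) (eq-sub e′ (bind s))
    eq-sub {σ = σ} (eq-app {B = B} {N = N} p q) s =
      cast-eq refl refl (sym (/-[] B N σ)) (eq-app (eq-sub p s) (eq-sub q s))
    eq-sub {σ = σ} (eq-β {B = B} {M} {N} a p q) s =
      cast-eq refl (sym (/-[] M N σ)) (sym (/-[] B N σ)) (eq-β (ty-sub a s) (ty-sub p (bind s)) (ty-sub q s))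
    eq-sub {σ = σ} (eq-η {M = M} {N} p q e) s = eq-η (ty-sub p s) (ty-sub q s)
      (cast-eq (cong (_∙ var zero) (weaken-↑ M σ)) (cong (_∙ var zero) (weaken-↑ N σ)) refl (eq-sub e (bind s)))

-- Renamings come first: weakening is what moves a typed substitution under a binder, so the
-- instance for `Wt` is built on this one.
Renaming : ∀ {m n} → Ctx m → Ctx n → Sub Tm m n → Set
Renaming Γ Δ σ = ∀ x → ∃[ y ] lookup σ x ≡ var y × type Γ x / σ ≡ type Δ y

Renaming-lifted : ∀ {m n} {Γ : Ctx m} {Δ : Ctx n} {σ} → Lifted Renaming Γ Δ σ → Renaming Γ Δ σ
Renaming-lifted (base r _) x = r x
Renaming-lifted {Γ = Γ ▹ A} (bind {σ = σ} r) zero = zero , refl , weaken-↑ A σ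
Renaming-lifted {Γ = Γ ▹ A} (bind {σ = σ} r) (suc x) = let (y , p , q) = Renaming-lifted r x in
  suc y , trans (weaken-lookup σ x) (trans (cong weaken p) TL.weaken-var) ,
  trans (weaken-↑ (type Γ x) σ) (cong weaken q)

Renaming-Wt : ∀ {m n} {Γ : Ctx m} {Δ : Ctx n} {σ} → Lifted Renaming Γ Δ σ → ⊢ Δ → Wt Γ Δ σ
Renaming-Wt r ⊢Δ x = let (y , p , q) = Renaming-lifted r x in cast-ty (sym p) (sym q) (ty-var y ⊢Δ)

private
  module Ren = Substitution Renaming Renaming-Wt

wk-renaming : ∀ {n} {Γ : Ctx n} {A} → ⊢ (Γ ▹ A) → Lifted Renaming Γ (Γ ▹ A) wk
wk-renaming {Γ = Γ} = base λ x → suc x , TL.lookup-wk x , /-wk (type Γ x)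

weaken-ty : ∀ {n} {Γ : Ctx n} {A M T} → Γ ⊢ M ∶ T → ⊢ (Γ ▹ A) → (Γ ▹ A) ⊢ weaken M ∶ weaken T
weaken-ty {M = M} {T} p ⊢Γ = cast-ty (/-wk M) (/-wk T) (Ren.ty-sub p (wk-renaming ⊢Γ))

weaken-eq : ∀ {n} {Γ : Ctx n} {A M N T} → Γ ⊢ M ≐ N ∶ T → ⊢ (Γ ▹ A) → (Γ ▹ A) ⊢ weaken M ≐ weaken N ∶ weaken T
weaken-eq {M = M} {N} {T} e ⊢Γ = cast-eq (/-wk M) (/-wk N) (/-wk T) (Ren.eq-sub e (wk-renaming ⊢Γ))

Wt-↑ : ∀ {m n} {Γ : Ctx m} {Δ : Ctx n} {σ A} → Wt Γ Δ σ → ⊢ (Δ ▹ A / σ) → Wt (Γ ▹ A) (Δ ▹ A / σ) (σ ↑)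
Wt-↑ {σ = σ} {A} w ⊢Δ zero = cast-ty refl (sym (weaken-↑ A σ)) (ty-var zero ⊢Δ)
Wt-↑ {Γ = Γ} {σ = σ} w ⊢Δ (suc x) = cast-ty (sym (weaken-lookup σ x)) (sym (weaken-↑ (type Γ x) σ))
  (weaken-ty (w x) ⊢Δ)

Wt-lifted : ∀ {m n} {Γ : Ctx m} {Δ : Ctx n} {σ} → Lifted Wt Γ Δ σ → ⊢ Δ → Wt Γ Δ σ
Wt-lifted (base w _) _ = w
Wt-lifted (bind {A = A} s) ⊢Δ@(⊢▹ ⊢Δ′ _) = Wt-↑ {A = A} (Wt-lifted s ⊢Δ′) ⊢Δ

private
  module Sb = Substitution Wt Wt-lifted

module _ {m n} {Γ : Ctx m} {Δ : Ctx n} {σ : Sub Tm m n} (w : Wt Γ Δ σ) (⊢Δ : ⊢ Δ) where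
  sub-ty : ∀ {M A} → Γ ⊢ M ∶ A → Δ ⊢ M / σ ∶ A / σ
  sub-ty p = Sb.ty-sub p (base w ⊢Δ)

  sub-eq : ∀ {M N A} → Γ ⊢ M ≐ N ∶ A → Δ ⊢ M / σ ≐ N / σ ∶ A / σ
  sub-eq e = Sb.eq-sub e (base w ⊢Δ)

wf : ∀ {n} {Γ : Ctx n} {M A} → Γ ⊢ M ∶ A → ⊢ Γ
wf (ty-var _ ⊢Γ) = ⊢Γ
wf (ty-univ ⊢Γ)  = ⊢Γ
wf (ty-Π a _)    = wf a
wf (ty-ƛ a _)    = wf a
wf (ty-app p _)  = wf p
wf (ty-conv p _) = wf p

-- `right` is typed at the `σ′`-instances of the types. Deriving it from `equal` would take
-- functionality of the types, which has this record as its hypothesis.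
record Wt≐ {m n} (Γ : Ctx m) (Δ : Ctx n) (σ σ′ : Sub Tm m n) : Set where
  field
    left  : Wt Γ Δ σ
    right : Wt Γ Δ σ′
    equal : ∀ x → Δ ⊢ lookup σ x ≐ lookup σ′ x ∶ type Γ x / σ

Wt≐-↑ : ∀ {m n} {Γ : Ctx m} {Δ : Ctx n} {σ σ′ A} → Wt≐ Γ Δ σ σ′ → ⊢ (Δ ▹ A / σ) →
        Δ ⊢ A / σ ≐ A / σ′ ∶ 𝒰 → Wt≐ (Γ ▹ A) (Δ ▹ A / σ) (σ ↑) (σ′ ↑)
Wt≐-↑ {Γ = Γ} {Δ} {σ} {σ′} {A} w ⊢Δ e = record
  { left = Wt-↑ {A = A} W.left ⊢Δ
  ; right = λ where
      zero → cast-ty refl (sym (weaken-↑ A σ′)) (ty-conv (ty-var zero ⊢Δ) (weaken-eq e ⊢Δ))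
      (suc x) → cast-ty (sym (weaken-lookup σ′ x)) (sym (weaken-↑ (type Γ x) σ′)) (weaken-ty (W.right x) ⊢Δ)
  ; equal = λ where
      zero → eq-refl (Wt-↑ {Γ = Γ} {A = A} W.left ⊢Δ zero)
      (suc x) → cast-eq (sym (weaken-lookup σ x)) (sym (weaken-lookup σ′ x)) (sym (weaken-↑ (type Γ x) σ)) (weaken-eq (W.equal x) ⊢Δ)
  }
  where module W = Wt≐ w

-- At a binder, the equation obtained for the domain makes the lifted substitutions equal again
-- (`Wt≐-↑`); a conversion is substituted along `σ` alone.
functional : ∀ {m n} {Γ : Ctx m} {Δ : Ctx n} {σ σ′ M A} → Γ ⊢ M ∶ A → Wt≐ Γ Δ σ σ′ → ⊢ Δ →
             Δ ⊢ M / σ ≐ M / σ′ ∶ A / σ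
functional (ty-var x _) w ⊢Δ = Wt≐.equal w x
functional (ty-univ _) w ⊢Δ = eq-refl (ty-univ ⊢Δ)
functional (ty-Π a b) w ⊢Δ = let e = functional a w ⊢Δ ; ⊢Δ′ = ⊢▹ ⊢Δ (sub-ty (Wt≐.left w) ⊢Δ a) in
  eq-Π e (functional b (Wt≐-↑ w ⊢Δ′ e) ⊢Δ′)
functional (ty-ƛ a b) w ⊢Δ = let e = functional a w ⊢Δ ; ⊢Δ′ = ⊢▹ ⊢Δ (sub-ty (Wt≐.left w) ⊢Δ a) in
  eq-ƛ e (functional b (Wt≐-↑ w ⊢Δ′ e) ⊢Δ′)
functional {σ = σ} (ty-app {B = B} {N = N} p q) w ⊢Δ = cast-eq refl refl (sym (/-[] B N σ))
  (eq-app (functional p w ⊢Δ) (functional q w ⊢Δ))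
functional (ty-conv p e) w ⊢Δ = eq-conv (functional p w ⊢Δ) (sub-eq (Wt≐.left w) ⊢Δ e)

Wt-id : ∀ {n} {Γ : Ctx n} → ⊢ Γ → Wt Γ Γ idₛ
Wt-id {Γ = Γ} ⊢Γ x = cast-ty (sym (TL.lookup-id x)) (sym (/-id (type Γ x))) (ty-var x ⊢Γ)

Wt-∷ : ∀ {m n} {Γ : Ctx m} {Δ : Ctx n} {σ A N} → Wt Γ Δ σ → Δ ⊢ N ∶ A / σ → Wt (Γ ▹ A) Δ (N ∷ σ)
Wt-∷ {σ = σ} {A} {N} w p zero = cast-ty refl (sym (weaken-∷ A N σ)) p
Wt-∷ {Γ = Γ} {σ = σ} {N = N} w p (suc x) = cast-ty refl (sym (weaken-∷ (type Γ x) N σ)) (w x)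

Wt≐-∷ : ∀ {m n} {Γ : Ctx m} {Δ : Ctx n} {σ σ′ A N N′} → Wt≐ Γ Δ σ σ′ → Δ ⊢ N ∶ A / σ → Δ ⊢ N′ ∶ A / σ′ →
        Δ ⊢ N ≐ N′ ∶ A / σ → Wt≐ (Γ ▹ A) Δ (N ∷ σ) (N′ ∷ σ′)
Wt≐-∷ {Γ = Γ} {σ = σ} {A = A} {N} w p p′ e = record
  { left  = Wt-∷ {A = A} W.left p
  ; right = Wt-∷ {A = A} W.right p′
  ; equal = λ where
      zero    → cast-eq refl refl (sym (weaken-∷ A N σ)) e
      (suc x) → cast-eq refl refl (sym (weaken-∷ (type Γ x) N σ)) (W.equal x)
  }
  where module W = Wt≐ w

Wt≐-refl : ∀ {m n} {Γ : Ctx m} {Δ : Ctx n} {σ} → Wt Γ Δ σ → Wt≐ Γ Δ σ σ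
Wt≐-refl w = record { left = w ; right = w ; equal = λ x → eq-refl (w x) }

Wt-sub : ∀ {n} {Γ : Ctx n} {A N} → ⊢ Γ → Γ ⊢ N ∶ A → Wt (Γ ▹ A) Γ (sub N)
Wt-sub {A = A} ⊢Γ p = Wt-∷ {A = A} (Wt-id ⊢Γ) (cast-ty refl (sym (/-id A)) p)

[]-ty : ∀ {n} {Γ : Ctx n} {A B M N} → (Γ ▹ A) ⊢ M ∶ B → Γ ⊢ N ∶ A → Γ ⊢ M [ N ] ∶ B [ N ]
[]-ty p q = sub-ty (Wt-sub (wf q) q) (wf q) p

[]-eq : ∀ {n} {Γ : Ctx n} {A B N N′} → (Γ ▹ A) ⊢ B ∶ 𝒰 → Γ ⊢ N ∶ A → Γ ⊢ N′ ∶ A → Γ ⊢ N ≐ N′ ∶ A →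
        Γ ⊢ B [ N ] ≐ B [ N′ ] ∶ 𝒰
[]-eq {A = A} b p p′ e = functional b (Wt≐-∷ {A = A} (Wt≐-refl (Wt-id (wf p)))
  (cast-ty refl (sym (/-id A)) p) (cast-ty refl (sym (/-id A)) p′)
  (cast-eq refl refl (sym (/-id A)) e)) (wf p)

module _ {n} {Γ : Ctx n} {A A′} (a : Γ ⊢ A ∶ 𝒰) (a′ : Γ ⊢ A′ ∶ 𝒰) (e : Γ ⊢ A ≐ A′ ∶ 𝒰) where
  private
    ⊢Γ′ : ⊢ (Γ ▹ A′)
    ⊢Γ′ = ⊢▹ (wf a) a′

    w : Wt (Γ ▹ A) (Γ ▹ A′) idₛ
    w zero    = cast-ty refl (sym (/-id (weaken A))) (ty-conv (ty-var zero ⊢Γ′) (weaken-eq (eq-sym e) ⊢Γ′))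
    w (suc x) = Wt-id ⊢Γ′ (suc x)

  -- Context conversion is substitution along the identity, retyped at its last variable.
  ctx-conv-ty : ∀ {M B} → (Γ ▹ A) ⊢ M ∶ B → (Γ ▹ A′) ⊢ M ∶ B
  ctx-conv-ty p = cast-ty (/-id _) (/-id _) (sub-ty w ⊢Γ′ p)

  ctx-conv-eq : ∀ {M N B} → (Γ ▹ A) ⊢ M ≐ N ∶ B → (Γ ▹ A′) ⊢ M ≐ N ∶ B
  ctx-conv-eq {M} {N} {B} p = cast-eq (/-id M) (/-id N) (/-id B) (sub-eq w ⊢Γ′ p)

-- A conversion changes `T` but not the subject, so peeling conversions reaches the formation rule.
Π-inv : ∀ {n} {Γ : Ctx n} {A B T} → Γ ⊢ Π A B ∶ T → Γ ⊢ A ∶ 𝒰 × (Γ ▹ A) ⊢ B ∶ 𝒰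
Π-inv (ty-Π a b)    = a , b
Π-inv (ty-conv p _) = Π-inv p

type-ty : ∀ {n} {Γ : Ctx n} → ⊢ Γ → ∀ x → Γ ⊢ type Γ x ∶ 𝒰
type-ty ⊢Γ@(⊢▹ _ a) zero     = weaken-ty a ⊢Γ
type-ty ⊢Γ@(⊢▹ ⊢Γ′ _) (suc x) = weaken-ty (type-ty ⊢Γ′ x) ⊢Γ

record Presup {n} (Γ : Ctx n) (M N A : Tm n) : Set where
  constructor mkPresup
  field
    lhs : Γ ⊢ M ∶ A
    rhs : Γ ⊢ N ∶ A
    ty  : Γ ⊢ A ∶ 𝒰

mutual
  -- In the congruence rules the right-hand side is obtained over the left-hand context, or at the
  -- wrong instance of the codomain. Context conversion and `[]-eq` repair this. Reflexivity needs
  -- validity and the conversion rule needs presuppositions, hence the mutual recursion.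
  validity : ∀ {n} {Γ : Ctx n} {M A} → Γ ⊢ M ∶ A → Γ ⊢ A ∶ 𝒰
  validity (ty-var x ⊢Γ)   = type-ty ⊢Γ x
  validity (ty-univ ⊢Γ)    = ty-univ ⊢Γ
  validity (ty-Π a _)      = ty-univ (wf a)
  validity (ty-ƛ a p)      = ty-Π a (validity p)
  validity (ty-app p q)    = []-ty (proj₂ (Π-inv (validity p))) q
  validity (ty-conv _ e)   = Presup.rhs (presup e)

  presup : ∀ {n} {Γ : Ctx n} {M N A} → Γ ⊢ M ≐ N ∶ A → Presup Γ M N A
  presup (eq-refl p)     = mkPresup p p (validity p)
  presup (eq-sym e)      = let mkPresup l r t = presup e in mkPresup r l t
  presup (eq-trans e e′) = mkPresup (Presup.lhs (presup e)) (Presup.rhs (presup e′)) (Presup.ty (presup e))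
  presup (eq-conv e e′)  = let mkPresup l r _ = presup e in
    mkPresup (ty-conv l e′) (ty-conv r e′) (Presup.rhs (presup e′))
  presup (eq-Π e e′)     =
    let mkPresup a a′ u = presup e
        mkPresup b b′ _ = presup e′
    in mkPresup (ty-Π a b) (ty-Π a′ (ctx-conv-ty a a′ e b′)) u
  presup (eq-ƛ e e′)     =
    let mkPresup a a′ _ = presup e
        mkPresup p p′ b = presup e′
    in mkPresup (ty-ƛ a p)
         (ty-conv (ty-ƛ a′ (ctx-conv-ty a a′ e p′)) (eq-sym (eq-Π e (eq-refl b)))) (ty-Π a b)
  presup (eq-app e e′)   =
    let mkPresup p p′ t = presup e
        mkPresup q q′ _ = presup e′
        b               = proj₂ (Π-inv t)
    in mkPresup (ty-app p q) (ty-conv (ty-app p′ q′) (eq-sym ([]-eq b q q′ e′))) ([]-ty b q)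
  presup (eq-β a p q)    = mkPresup (ty-app (ty-ƛ a p) q) ([]-ty p q) ([]-ty (validity p) q)
  presup (eq-η p q _)    = mkPresup p q (validity p)

-- Determinism of head reduction

↝-det : ∀ {n} {M P Q : Tm n} → M ↝ P → M ↝ Q → P ≡ Q
↝-det β        β        = refl
↝-det (head p) (head q) = cong (_∙ _) (↝-det p q)
↝-det β (head ())
↝-det (head ()) β

-- A Π-type is head normal, so determinism leaves at most one Π-type to reach. The witnesses `A` and
-- `B` in the clauses for Π are thereby unique.
↝*-Π-det : ∀ {n} {M A A′ : Tm n} {B B′} → M ↝* Π A B → M ↝* Π A′ B′ → Π A B ≡ Π A′ B′
↝*-Π-det ε ε = refl
↝*-Π-det ε (() ◅ _)
↝*-Π-det (() ◅ _) ε
↝*-Π-det (r ◅ rs) (r′ ◅ rs′) with ↝-det r r′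
... | refl = ↝*-Π-det rs rs′

∙-↝* : ∀ {n} {M M′ N : Tm n} → M ↝* M′ → M ∙ N ↝* M′ ∙ N
∙-↝* = gmap (_∙ _) head

-- Semantic typing at a stage

module _ (X : CUSL) where
  private module X = CUSL X

  ≈-refl : ∀ {x} → x X.≈ x
  ≈-refl = X.≤-antisym X.≤-refl X.≤-refl

  ≈-sym : ∀ {x y} → x X.≈ y → y X.≈ x
  ≈-sym p = X.≤-antisym (X.≥-reflexive p) (X.≤-reflexive p)

  ≈-trans : ∀ {x y z} → x X.≈ y → y X.≈ z → x X.≈ z
  ≈-trans p q = X.≤-antisym (X.≤-trans (X.≤-reflexive p) (X.≤-reflexive q))
                            (X.≤-trans (X.≥-reflexive q) (X.≥-reflexive p))

  ≤⊥⇒≈ : ∀ {x} → x X.≤ X.⊥ → x X.≈ X.⊥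
  ≤⊥⇒≈ p = X.≤-antisym p (X.min _)

Emb-≈ : ∀ {X Y} (e : Emb X Y) {x y} → x ≈[ X ] y → Emb.to e x ≈[ Y ] Emb.to e y
Emb-≈ {X} {Y} e p = CUSL.≤-antisym Y (Emb.mono e (CUSL.≤-reflexive X p)) (Emb.mono e (CUSL.≥-reflexive X p))

module _ {X : CUSL} where
  private
    module X = CUSL X
    module S = CUSL (X ⇒ X)
    module E = CUSL (EltCUSL X)

  Pi-injˡ : ∀ {a a′ g g′} → Pi a g E.≈ Pi a′ g′ → a X.≈ a′
  Pi-injˡ (Pi≤Pi p _ Sym., Pi≤Pi q _) = X.≤-antisym p q

  Pi-injʳ : ∀ {a a′ g g′} → Pi a g E.≈ Pi a′ g′ → ∀ w → g · w X.≈ g′ · w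
  Pi-injʳ (Pi≤Pi _ p Sym., Pi≤Pi _ q) w = X.≤-antisym (at p w) (at q w)

  lam≤⊥ : ∀ {f} → lam f ≤ₑ bot → f S.≤ S.⊥
  lam≤⊥ (lam⊥≤ p) = p

HasType-resp : ∀ n {u u′ a a′} → u ≈[ C n ] u′ → a ≈[ C n ] a′ → HasType n u a → HasType n u′ a′
HasType-resp (suc n) u≈ a≈ = go u≈ a≈
  where
  E = C (suc n)
  go : ∀ {u u′ a a′} → u ≈[ E ] u′ → a ≈[ E ] a′ →
       Rules (HasType n) (IsType n) u a → Rules (HasType n) (IsType n) u′ a′
  go u≈ a≈ (rule-Bot p t)        = rule-Bot (≈-trans E (≈-sym E u≈) p) (go a≈ (≈-refl E) t)
  go u≈ a≈ (rule-Univ p q)       = rule-Univ (≈-trans E (≈-sym E u≈) p) (≈-trans E (≈-sym E a≈) q)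
  go u≈ a≈ (rule-Lam p q t d h)  = rule-Lam (≈-trans E (≈-sym E u≈) p) (≈-trans E (≈-sym E a≈) q) t d h
  go u≈ a≈ (rule-Pi p q t d h)   = rule-Pi (≈-trans E (≈-sym E u≈) p) (≈-trans E (≈-sym E a≈) q) t d h

IsType-resp : ∀ n {a a′} → a ≈[ C n ] a′ → IsType n a → IsType n a′
IsType-resp (suc n) a≈ = HasType-resp (suc n) a≈ (≈-refl (C (suc n)))

IsType-⊥ : ∀ n → IsType (suc n) bot
IsType-⊥ n = rule-Bot (≈-refl (C (suc n))) (rule-Univ (≈-refl (C (suc n))) (≈-refl (C (suc n))))

⊥-IsType : ∀ n {a} → IsType n a → IsType n (CUSL.⊥ (C n))
⊥-IsType (suc n) _ = IsType-⊥ n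

⊥-typed : ∀ n {u a} → u ≤[ C n ] CUSL.⊥ (C n) → IsType n a → HasType n u a
⊥-typed (suc n) u≤ t = rule-Bot (≤⊥⇒≈ (C (suc n)) u≤) t

dom-resp : ∀ n {f f′ : Step (C n) (C n)} {a a′} → (∀ w → f · w ≈[ C n ] f′ · w) → a ≈[ C n ] a′ →
           dom (HasType n) f a → dom (HasType n) f′ a′
dom-resp n f≈ a≈ d u = let (v , v≤u , tv , eq) = d u in
  v , v≤u , HasType-resp n (≈-refl (C n)) a≈ tv ,
  ≈-trans (C n) (≈-sym (C n) (f≈ u)) (≈-trans (C n) eq (f≈ v))

record PiType n (a : ∣ C n ∣) (g : Step (C n) (C n)) : Set where
  field
    domain   : IsType n a
    dom-cod  : dom (HasType n) g a
    codomain : ∀ w → IsType n (g · w)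

IsType-Pi : ∀ n {a g} → IsType (suc n) (Pi a g) → PiType n a g
IsType-Pi n (rule-Bot (() Sym., _) _)
IsType-Pi n (rule-Univ (() Sym., _) _)
IsType-Pi n (rule-Lam _ (() Sym., _) _ _ _)
IsType-Pi n {g = g′} (rule-Pi {a = a} {g} p _ t d h) = record
  { domain   = IsType-resp n (≈-sym (C n) (Pi-injˡ p)) t
  ; dom-cod  = dom-resp n {g} {g′} (λ w → ≈-sym (C n) (Pi-injʳ p w)) (≈-sym (C n) (Pi-injˡ p)) d
  ; codomain = λ w → IsType-resp n (≈-sym (C n) (Pi-injʳ p w)) (h w)
  }

Pi-IsType : ∀ n {a g} → PiType n a g → IsType (suc n) (Pi a g)
Pi-IsType n t = rule-Pi (≈-refl (C (suc n))) (≈-refl (C (suc n))) T.domain T.dom-cod T.codomain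
  where module T = PiType t

IsType-lam : ∀ n {f} → IsType (suc n) (lam f) → f ≤ₛ ⊥ₛ
IsType-lam n (rule-Bot p _) = lam≤⊥ (lhs≤rhs p)
IsType-lam n (rule-Univ (lam⊥≤ p Sym., _) _) = p
IsType-lam n (rule-Lam _ (() Sym., _) _ _ _)
IsType-lam n (rule-Pi (lam⊥≤ p Sym., _) _ _ _ _) = p

HasType-⊥ : ∀ n {u} → HasType (suc n) u bot → u ≤ₑ bot
HasType-⊥ n (rule-Bot p _)                 = lhs≤rhs p
HasType-⊥ n (rule-Univ _ (_ Sym., ()))
HasType-⊥ n (rule-Lam _ (_ Sym., ()) _ _ _)
HasType-⊥ n (rule-Pi _ (_ Sym., ()) _ _ _)

⊥-inv : ∀ n {u a} → a ≤[ C n ] CUSL.⊥ (C n) → HasType n u a → u ≤[ C n ] CUSL.⊥ (C n)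
⊥-inv (suc n) a≤ t = HasType-⊥ n (HasType-resp (suc n) (≈-refl (C (suc n))) (≤⊥⇒≈ (C (suc n)) a≤) t)

-- An element of Π(a,g) is given by its application map only: λ(⊥) = ⊥.
record LamType n (f : ∣ C n ∣ → ∣ C n ∣) (a : ∣ C n ∣) (g : Step (C n) (C n)) : Set where
  field
    dom-fun : ∀ u → ∃[ v ] v ≤[ C n ] u × HasType n v a × f u ≈[ C n ] f v
    img-typed : ∀ w → HasType n (f w) (g · w)

appₙ-mono : ∀ n {u u′ w w′} → u ≤ₑ u′ → w ≤[ C n ] w′ → appₙ n u w ≤[ C n ] appₙ n u′ w′
appₙ-mono n bot≤ _                 = CUSL.min (C n) _
appₙ-mono n {w = w} (lam⊥≤ p) _    = CUSL.≤-trans (C n) (at p w) (CUSL.min (C n) _)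
appₙ-mono n U≤U _                  = CUSL.≤-refl (C n)
appₙ-mono n {w = w} (lam≤lam {g = g} p) w≤ = CUSL.≤-trans (C n) (at p w) (monotone g w≤)
appₙ-mono n (Pi≤Pi _ _) _          = CUSL.≤-refl (C n)

appₙ-≈ : ∀ n {u u′} → u ≈[ C (suc n) ] u′ → ∀ w → appₙ n u w ≈[ C n ] appₙ n u′ w
appₙ-≈ n p w = CUSL.≤-antisym (C n) (appₙ-mono n (lhs≤rhs p) (CUSL.≤-refl (C n)))
                                    (appₙ-mono n (rhs≤lhs p) (CUSL.≤-refl (C n)))

LamType-⊥ : ∀ n {u a g} → u ≤ₑ bot → PiType n a g → LamType n (appₙ n u) a g
LamType-⊥ n {u} u≤ t = record
  { dom-fun = λ w → CUSL.⊥ (C n) , CUSL.min (C n) _ , ⊥-typed n (CUSL.≤-refl (C n)) T.domain ,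
      ≈-trans (C n) (≤⊥⇒≈ (C n) (appₙ-mono n u≤ (CUSL.≤-refl (C n))))
        (≈-sym (C n) (≤⊥⇒≈ (C n) (appₙ-mono n u≤ (CUSL.≤-refl (C n)))))
  ; img-typed = λ w → ⊥-typed n (appₙ-mono n u≤ (CUSL.≤-refl (C n))) (T.codomain w)
  }
  where module T = PiType t

HasType-Pi : ∀ n {u a g} → PiType n a g → HasType (suc n) u (Pi a g) → LamType n (appₙ n u) a g
HasType-Pi n t (rule-Bot p _) = LamType-⊥ n (lhs≤rhs p) t
HasType-Pi n t (rule-Univ _ (() Sym., _))
HasType-Pi n {u} t (rule-Lam {f = f} {a} {g} p q _ d h) = record
  { dom-fun = λ w → let (v , v≤ , tv , eq) = d w in
      v , v≤ , HasType-resp n (≈-refl (C n)) (≈-sym (C n) (Pi-injˡ q)) tv ,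
      ≈-trans (C n) (appₙ-≈ n p w) (≈-trans (C n) eq (≈-sym (C n) (appₙ-≈ n p v)))
  ; img-typed = λ w → HasType-resp n (≈-sym (C n) (appₙ-≈ n p w)) (≈-sym (C n) (Pi-injʳ q w)) (h w)
  }
HasType-Pi n t (rule-Pi _ (() Sym., _) _ _ _)

lam-HasType : ∀ n {f a g} → PiType n a g → LamType n (f ·_) a g → HasType (suc n) (lam f) (Pi a g)
lam-HasType n t l = rule-Lam (≈-refl (C (suc n))) (≈-refl (C (suc n))) (PiType.domain t)
  (LamType.dom-fun l) (LamType.img-typed l)

mutual
  HasType-mono : ∀ n {u a b} → HasType n u a → a ≤[ C n ] b → IsType n b → HasType n u b
  HasType-mono (suc n) (rule-Bot p _) a≤b tb = rule-Bot p tb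
  HasType-mono (suc n) (rule-Univ p q) a≤b tb with CUSL.≤-trans (C (suc n)) (rhs≤lhs q) a≤b
  ... | U≤U = rule-Univ p (≈-refl (C (suc n)))
  HasType-mono (suc n) (rule-Lam {f = f} p q t d h) a≤b tb with CUSL.≤-trans (C (suc n)) (rhs≤lhs q) a≤b
  ... | Pi≤Pi a≤ g≤ = rule-Lam p (≈-refl (C (suc n))) T.domain (dom-mono n {f} d a≤ T.domain)
                        (λ w → HasType-mono n (h w) (at g≤ w) (T.codomain w))
    where module T = PiType (IsType-Pi n tb)
  HasType-mono (suc n) (rule-Pi {g = g} p q t d h) a≤b tb with CUSL.≤-trans (C (suc n)) (rhs≤lhs q) a≤b
  ... | U≤U = rule-Pi {g = g} p (≈-refl (C (suc n))) t d h

  dom-mono : ∀ n {f a b} → dom (HasType n) f a → a ≤[ C n ] b → IsType n b → dom (HasType n) f b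
  dom-mono n d a≤b tb u = let (v , v≤u , tv , eq) = d u in v , v≤u , HasType-mono n tv a≤b tb , eq

-- Squeezed by monotonicity. It allows the witness of a domain condition to be enlarged, so that the
-- witnesses for two functions can be replaced by their supremum.
constant-above : ∀ {X Y} (f : Step X Y) {u v w} → v ≤[ X ] w → w ≤[ X ] u → f · u ≈[ Y ] f · v → f · u ≈[ Y ] f · w
constant-above {Y = Y} f v≤w w≤u eq = CUSL.≤-antisym Y
  (CUSL.≤-trans Y (CUSL.≤-reflexive Y eq) (monotone f v≤w)) (monotone f w≤u)

-- Both elements lie below `s`, so one of them is `⊥` or they have the same head. In the latter case
-- values are joined pointwise, and the induction hypothesis at the lower stage types the joined
-- values as well as the joined arguments of the domain condition.
HasType-sup : ∀ n {u v s a} → HasType n u a → HasType n v a → CUSL.IsSup (C n) u v s → HasType n s a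
HasType-sup (suc n) {u} {v} {s} {a} tu tv s∨ = go tu tv
  where
  E = C (suc n)
  module Cₙ = CUSL (C n)
  module S = CUSL (C n ⇒ C n)
  u≤s = proj₁ s∨
  v≤s = proj₁ (proj₂ s∨)

  sup-⊥ˡ : u ≤ₑ bot → s ≈[ E ] v
  sup-⊥ˡ u≤ = CUSL.≤-antisym E (proj₂ (proj₂ s∨) (≤ₑ-trans u≤ bot≤) ≤ₑ-refl) v≤s

  sup-⊥ʳ : v ≤ₑ bot → s ≈[ E ] u
  sup-⊥ʳ v≤ = CUSL.≤-antisym E (proj₂ (proj₂ s∨) ≤ₑ-refl (≤ₑ-trans v≤ bot≤)) u≤s

  joined : ∀ {x y t} → u ≈[ E ] x → v ≈[ E ] y → IsSupₑ x y t → s ≈[ E ] t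
  joined u≈ v≈ (x≤t , y≤t , least) = CUSL.≤-antisym E
    (proj₂ (proj₂ s∨) (≤ₑ-trans (lhs≤rhs u≈) x≤t) (≤ₑ-trans (lhs≤rhs v≈) y≤t))
    (least (≤ₑ-trans (rhs≤lhs u≈) u≤s) (≤ₑ-trans (rhs≤lhs v≈) v≤s))

  go-lam : ∀ {f f′ b b′ g g′ z} → lam f ≤ₑ z → lam f′ ≤ₑ z → u ≈[ E ] lam f → v ≈[ E ] lam f′ →
           a ≈[ E ] Pi b g → a ≈[ E ] Pi b′ g′ → IsType n b →
           dom (HasType n) f b → dom (HasType n) f′ b′ →
           (∀ w → HasType n (f · w) (g · w)) → (∀ w → HasType n (f′ · w) (g′ · w)) → HasType (suc n) s a
  go-lam (lam⊥≤ p) _ u≈ v≈ a≈ a≈′ t d d′ h h′ = HasType-resp (suc n) (≈-sym E (sup-⊥ˡ (≤ₑ-trans (lhs≤rhs u≈) (lam⊥≤ p)))) (≈-refl E) tv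
  go-lam (lam≤lam _) (lam⊥≤ p) u≈ v≈ a≈ a≈′ t d d′ h h′ = HasType-resp (suc n) (≈-sym E (sup-⊥ʳ (≤ₑ-trans (lhs≤rhs v≈) (lam⊥≤ p)))) (≈-refl E) tu
  go-lam {f} {f′} {b} {b′} {g} {g′} (lam≤lam {g = k} p) (lam≤lam p′) u≈ v≈ a≈ a≈′ t d d′ h h′ =
    rule-Lam (joined u≈ v≈ (sup-lam (joinₛ-sup f f′ j))) a≈ t dj
      (λ w → HasType-sup n (h w) (HasType-resp n (≈-refl (C n)) (≈-sym (C n) (Pi-injʳ Pi≈ w)) (h′ w)) (proj₂ (j w)))
    where
    Pi≈ = ≈-trans E (≈-sym E a≈) a≈′
    j : ∀ w → ∃ (Cₙ.IsSup (f · w) (f′ · w))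
    j w = Cₙ.sup (at p w) (at p′ w)
    dj : dom (HasType n) (joinₛ f f′ j) b
    -- The supremum `x` of the two typed witnesses is typed and below `w`, and each function has the
    -- same value at `x` as at `w`.
    dj w = let (v₁ , v₁≤ , t₁ , e₁) = d w
               (v₂ , v₂≤ , t₂ , e₂) = d′ w
               (x , x∨)             = Cₙ.sup v₁≤ v₂≤
               (v₁≤x , v₂≤x , least) = x∨
               x≤w = least v₁≤ v₂≤
               e₁′ = constant-above f v₁≤x x≤w e₁
               e₂′ = constant-above f′ v₂≤x x≤w e₂
               (fw≤ , f′w≤ , lw) = proj₂ (j w)
               (fx≤ , f′x≤ , lx) = proj₂ (j x)
           in x , x≤w , HasType-sup n t₁ (HasType-resp n (≈-refl (C n)) (≈-sym (C n) (Pi-injˡ Pi≈)) t₂) x∨ ,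
              Cₙ.≤-antisym (lw (Cₙ.≤-trans (Cₙ.≤-reflexive e₁′) fx≤) (Cₙ.≤-trans (Cₙ.≤-reflexive e₂′) f′x≤))
                           (monotone (joinₛ f f′ j) x≤w)

  go-Pi : ∀ {b b′ g g′ z} → Pi b g ≤ₑ z → Pi b′ g′ ≤ₑ z → u ≈[ E ] Pi b g → v ≈[ E ] Pi b′ g′ →
          a ≈[ E ] U → PiType n b g → PiType n b′ g′ → HasType (suc n) s a
  go-Pi {b} {b′} {g} {g′} (Pi≤Pi {b′ = k} q p) (Pi≤Pi q′ p′) u≈ v≈ a≈ t t′ =
    rule-Pi (joined u≈ v≈ (sup-Pi c∨ (joinₛ-sup g g′ j))) a≈ tc dj (λ w → IsType-sup n (T.codomain w) (T′.codomain w) (proj₂ (j w)))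
    where
    module T = PiType t
    module T′ = PiType t′
    c = proj₁ (Cₙ.sup q q′)
    c∨ = proj₂ (Cₙ.sup q q′)
    IsType-sup : ∀ n {b b′ c} → IsType n b → IsType n b′ → CUSL.IsSup (C n) b b′ c → IsType n c
    IsType-sup (suc n) = HasType-sup (suc n)
    tc : IsType n c
    tc = IsType-sup n T.domain T′.domain c∨
    j : ∀ w → ∃ (Cₙ.IsSup (g · w) (g′ · w))
    j w = Cₙ.sup (at p w) (at p′ w)
    dj : dom (HasType n) (joinₛ g g′ j) c
    dj w = let (v₁ , v₁≤ , t₁ , e₁) = T.dom-cod w
               (v₂ , v₂≤ , t₂ , e₂) = T′.dom-cod w
               (x , x∨)             = Cₙ.sup v₁≤ v₂≤
               (v₁≤x , v₂≤x , least) = x∨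
               x≤w = least v₁≤ v₂≤
               e₁′ = constant-above g v₁≤x x≤w e₁
               e₂′ = constant-above g′ v₂≤x x≤w e₂
               (fw≤ , f′w≤ , lw) = proj₂ (j w)
               (fx≤ , f′x≤ , lx) = proj₂ (j x)
           -- The witnesses are typed in `b` and in `b′`; both are first moved to the joined domain
           -- `c`.
           in x , x≤w , HasType-sup n (HasType-mono n t₁ (proj₁ c∨) tc) (HasType-mono n t₂ (proj₁ (proj₂ c∨)) tc) x∨ ,
              Cₙ.≤-antisym (lw (Cₙ.≤-trans (Cₙ.≤-reflexive e₁′) fx≤) (Cₙ.≤-trans (Cₙ.≤-reflexive e₂′) f′x≤))
                           (monotone (joinₛ g g′ j) x≤w)

  go : Rules (HasType n) (IsType n) u a → Rules (HasType n) (IsType n) v a → HasType (suc n) s a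
  go (rule-Bot p _) _ = HasType-resp (suc n) (≈-sym E (sup-⊥ˡ (lhs≤rhs p))) (≈-refl E) tv
  go (rule-Univ _ _) (rule-Bot p _) = HasType-resp (suc n) (≈-sym E (sup-⊥ʳ (lhs≤rhs p))) (≈-refl E) tu
  go (rule-Lam _ _ _ _ _) (rule-Bot p _) = HasType-resp (suc n) (≈-sym E (sup-⊥ʳ (lhs≤rhs p))) (≈-refl E) tu
  go (rule-Pi _ _ _ _ _) (rule-Bot p _) = HasType-resp (suc n) (≈-sym E (sup-⊥ʳ (lhs≤rhs p))) (≈-refl E) tu
  go (rule-Univ p q) (rule-Univ p′ _) = rule-Univ (joined p p′ sup-U) q
  go (rule-Univ p q) (rule-Lam _ q′ _ _ _) with ≈-trans E (≈-sym E q) q′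
  ... | () Sym., _
  go (rule-Univ p q) (rule-Pi p′ _ _ _ _) with ≤ₑ-trans (rhs≤lhs p) u≤s | ≤ₑ-trans (rhs≤lhs p′) v≤s
  ... | U≤U | ()
  go (rule-Lam _ q _ _ _) (rule-Univ _ q′) with ≈-trans E (≈-sym E q) q′
  ... | () Sym., _
  go (rule-Lam {f = f} p q t d h) (rule-Lam {f = f′} p′ q′ t′ d′ h′) =
    go-lam (≤ₑ-trans (rhs≤lhs p) u≤s) (≤ₑ-trans (rhs≤lhs p′) v≤s) p p′ q q′ t d d′ h h′
  go (rule-Lam _ q _ _ _) (rule-Pi _ q′ _ _ _) with ≈-trans E (≈-sym E q) q′
  ... | () Sym., _
  go (rule-Pi p q t d h) (rule-Univ p′ _) with ≤ₑ-trans (rhs≤lhs p) u≤s | ≤ₑ-trans (rhs≤lhs p′) v≤s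
  ... | () | U≤U
  go (rule-Pi p q _ _ _) (rule-Lam _ q′ _ _ _) with ≈-trans E (≈-sym E q) q′
  ... | () Sym., _
  go (rule-Pi {g = g} p q t d h) (rule-Pi {g = g′} p′ q′ t′ d′ h′) =
    go-Pi (≤ₑ-trans (rhs≤lhs p) u≤s) (≤ₑ-trans (rhs≤lhs p′) v≤s) p p′ q
      (record { domain = t ; dom-cod = d ; codomain = h }) (record { domain = t′ ; dom-cod = d′ ; codomain = h′ })

IsType-sup : ∀ n {a b c} → IsType n a → IsType n b → CUSL.IsSup (C n) a b c → IsType n c
IsType-sup (suc n) = HasType-sup (suc n)

module _ {n k} (p : n ℕ.≤ k) where
  private
    module Cₙ = CUSL (C n)
    module Cₖ = CUSL (C k)
    module L = Emb (lift p)

  liftₛ-lift : ∀ f w → liftₛ p f · L.to w Cₖ.≈ L.to (f · w)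
  liftₛ-lift = mapStep-to (dec-C k) (lift p) (lift p)

  -- The value at `w` is assembled from the pairs of the presentation whose arguments lie below `w`,
  -- and `f` attains it at the supremum of these arguments.
  restrict : ∀ f w → ∃[ s ] L.to s Cₖ.≤ w × liftₛ p f · w Cₖ.≈ L.to (f · s)
  restrict f w = support (dec-C k) (lift p) (lift p) f w , support-≤ (dec-C k) (lift p) (lift p) f w , ≈-refl (C k)

  restrict-up : ∀ f {w s t} → L.to t Cₖ.≤ w → s Cₙ.≤ t → liftₛ p f · w Cₖ.≈ L.to (f · s) → liftₛ p f · w Cₖ.≈ L.to (f · t)
  restrict-up f t≤w s≤t eq = Cₖ.≤-antisym (Cₖ.≤-trans (Cₖ.≤-reflexive eq) (L.mono (monotone f s≤t)))
    (Cₖ.≤-trans (Cₖ.≥-reflexive (liftₛ-lift f _)) (monotone (liftₛ p f) t≤w))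

  -- The two supports are joined below `w`. A common argument is required because typing relates
  -- `f · s` to `g · s` at the same `s`.
  restrict₂ : ∀ f g w → ∃[ s ] L.to s Cₖ.≤ w × liftₛ p f · w Cₖ.≈ L.to (f · s) × liftₛ p g · w Cₖ.≈ L.to (g · s)
  restrict₂ f g w =
    let (s₁ , s₁≤ , e₁) = restrict f w
        (s₂ , s₂≤ , e₂) = restrict g w
        (s , (≤₁ , ≤₂ , _) , s≤) = L.join s₁≤ s₂≤
    in s , s≤ , restrict-up f s≤ ≤₁ e₁ , restrict-up g s≤ ≤₂ e₂

  dom-restrict : ∀ {a f} → dom (HasType n) f a → ∀ w →
                 ∃[ v ] L.to v Cₖ.≤ w × HasType n v a × liftₛ p f · w Cₖ.≈ L.to (f · v)
  dom-restrict {f = f} d w =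
    let (s , s≤ , e) = restrict f w
        (v , v≤ , tv , eq) = d s
    in v , Cₖ.≤-trans (L.mono v≤) s≤ , tv , ≈-trans (C k) e (Emb-≈ (lift p) eq)

HasType-lift : ∀ {n k} (p : n ℕ.≤ k) {u a} → HasType n u a → HasType k (Emb.to (lift p) u) (Emb.to (lift p) a)
IsType-lift : ∀ {n k} (p : n ℕ.≤ k) {a} → IsType n a → IsType k (Emb.to (lift p) a)
IsType-lift {suc n} {suc k} (s≤s p) t = HasType-lift (s≤s p) t

HasType-lift {suc n} {suc k} (s≤s p) t = go t
  where
  L = Emb-≈ (lift (s≤s p))
  dom-lift : ∀ {f a} → dom (HasType n) f a → dom (HasType k) (liftₛ p f) (Emb.to (lift p) a)
  dom-lift {f} d w = let (v , v≤ , tv , e) = dom-restrict p {f = f} d w in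
    Emb.to (lift p) v , v≤ , HasType-lift p tv , ≈-trans (C k) e (≈-sym (C k) (liftₛ-lift p f v))
  go : ∀ {u a} → HasType (suc n) u a → HasType (suc k) (Emb.to (lift (s≤s p)) u) (Emb.to (lift (s≤s p)) a)
  go (rule-Bot q t) = rule-Bot (L q) (go t)
  go (rule-Univ q r) = rule-Univ (L q) (L r)
  go (rule-Lam {f = f} {g = g} q r t d h) = rule-Lam (L q) (L r) (IsType-lift p t) (dom-lift {f} d)
    (λ w → let (s , _ , e , e′) = restrict₂ p f g w in
      HasType-resp k (≈-sym (C k) e) (≈-sym (C k) e′) (HasType-lift p (h s)))
  go (rule-Pi {g = g} q r t d h) = rule-Pi (L q) (L r) (IsType-lift p t) (dom-lift {g} d)
    (λ w → let (s , _ , e) = restrict p g w in IsType-resp k (≈-sym (C k) e) (IsType-lift p (h s)))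

-- Semantic typing in 𝒞

reflect-stage : ∀ {k x y} → (k , x) ⊑ (k , y) → x ≤[ C k ] y
reflect-stage {k} = Emb.reflect (inj k)

≈-stage : ∀ {k x y} → (k , x) 𝒞.≈ (k , y) → x ≈[ C k ] y
≈-stage {k} p = CUSL.≤-antisym (C k) (reflect-stage (𝒞.≤-reflexive p)) (reflect-stage (𝒞.≥-reflexive p))

raise-≈ : ∀ {n k x y} (p : n ℕ.≤ k) → (n , x) 𝒞.≈ y → (k , Emb.to (lift p) x) 𝒞.≈ y
raise-≈ p x≈ = ≈-sym 𝒞 (via (≈-sym 𝒞 x≈) p)

-- Typing in `𝒞` with the stage exposed, so that several typings can be raised to a common stage.
HasTypeAt : ℕ → ∣ 𝒞 ∣ → ∣ 𝒞 ∣ → Set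
HasTypeAt n u a = ∃[ uₙ ] ∃[ aₙ ] (n , uₙ) 𝒞.≈ u × (n , aₙ) 𝒞.≈ a × HasType n uₙ aₙ

IsTypeAt : ℕ → ∣ 𝒞 ∣ → Set
IsTypeAt n a = ∃[ aₙ ] (n , aₙ) 𝒞.≈ a × IsType n aₙ

raise : ∀ {n k u a} → n ℕ.≤ k → HasTypeAt n u a → HasTypeAt k u a
raise p (_ , _ , u≈ , a≈ , t) = _ , _ , raise-≈ p u≈ , raise-≈ p a≈ , HasType-lift p t

raiseᵀ : ∀ {n k a} → n ℕ.≤ k → IsTypeAt n a → IsTypeAt k a
raiseᵀ p (_ , a≈ , t) = _ , raise-≈ p a≈ , IsType-lift p t

at-rep : ∀ {n u a uₙ aₙ} → HasTypeAt n u a → (n , uₙ) 𝒞.≈ u → (n , aₙ) 𝒞.≈ a → HasType n uₙ aₙ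
at-rep {n} (_ , _ , u≈ , a≈ , t) u≈′ a≈′ =
  HasType-resp n (≈-stage (≈-trans 𝒞 u≈ (≈-sym 𝒞 u≈′))) (≈-stage (≈-trans 𝒞 a≈ (≈-sym 𝒞 a≈′))) t

at-repᵀ : ∀ {n a aₙ} → IsTypeAt n a → (n , aₙ) 𝒞.≈ a → IsType n aₙ
at-repᵀ {n} (_ , a≈ , t) a≈′ = IsType-resp n (≈-stage (≈-trans 𝒞 a≈ (≈-sym 𝒞 a≈′))) t

U-stage : ∀ {m y} → U𝒞 ⊑ (suc m , y) → y ≡ U
U-stage {m} {y} U⊑y with reflect-stage {x = U} (⊑-trans (lift-⊒ (s≤s z≤n) U) U⊑y)
... | U≤U = refl

stage-of : ∀ {a} → a ∶𝒞 U𝒞 → ∃[ n ] IsTypeAt n a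
stage-of (zero , _ , _ , _ , _ , ())
stage-of (suc n , a , y , a≈ , y≈ , t) with U-stage (𝒞.≥-reflexive y≈)
... | refl = suc n , a , a≈ , t

U-of-stage : ∀ {n a} → IsTypeAt n a → a ∶𝒞 U𝒞
U-of-stage {suc n} (aₙ , a≈ , t) = suc n , aₙ , U , a≈ , raise-≈ {x = U} (s≤s z≤n) (≈-refl 𝒞) , t

∶𝒞-resp : ∀ {u u′ a a′} → u 𝒞.≈ u′ → a 𝒞.≈ a′ → u ∶𝒞 a → u′ ∶𝒞 a′
∶𝒞-resp u≈ a≈ (n , _ , _ , p , q , t) = n , _ , _ , ≈-trans 𝒞 p u≈ , ≈-trans 𝒞 q a≈ , t

∶𝒞-mono : ∀ {u a b} → u ∶𝒞 a → a ⊑ b → b ∶𝒞 U𝒞 → u ∶𝒞 b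
∶𝒞-mono (n , t) a⊑b tb = go (stage-of tb)
  where
  go : _ → _
  go (m , tb) =
    let (x , y , x≈ , y≈ , t′) = raise (ℕₚ.m≤m⊔n n m) t
        (z , z≈ , tz)          = raiseᵀ (ℕₚ.m≤n⊔m n m) tb
    in n ⊔ m , x , z , x≈ , z≈ ,
       HasType-mono (n ⊔ m) t′ (reflect-stage (⊑-trans (𝒞.≤-reflexive y≈) (⊑-trans a⊑b (𝒞.≥-reflexive z≈)))) tz

-- The bound `s` may live at a later stage. Joining below it gives an element of stage `k`, which
-- leastness of `s` identifies with `s`.
sup-stage : ∀ {k x y u v s} → (k , x) 𝒞.≈ u → (k , y) 𝒞.≈ v → 𝒞.IsSup u v s →
            ∃[ z ] (k , z) 𝒞.≈ s × CUSL.IsSup (C k) x y z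
sup-stage {k} x≈ y≈ (u⊑s , v⊑s , least) =
  let (z , z∨ , z⊑) = join𝒞 (⊑-trans (𝒞.≤-reflexive x≈) u⊑s) (⊑-trans (𝒞.≤-reflexive y≈) v⊑s)
  in z , 𝒞.≤-antisym z⊑ (least (⊑-trans (𝒞.≥-reflexive x≈) (up (proj₁ z∨)))
                                (⊑-trans (𝒞.≥-reflexive y≈) (up (proj₁ (proj₂ z∨))))) , z∨

∶𝒞-sup : ∀ {u v s a} → u ∶𝒞 a → v ∶𝒞 a → 𝒞.IsSup u v s → s ∶𝒞 a
∶𝒞-sup {u} {v} (n , t) (m , t′) s∨ =
  let k = n ⊔ m
      (x , y , x≈ , y≈ , tx)    = raise (ℕₚ.m≤m⊔n n m) t
      (x′ , y′ , x≈′ , y≈′ , tx′) = raise (ℕₚ.m≤n⊔m n m) t′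
      (z , z≈ , z∨)             = sup-stage {u = u} {v} x≈ x≈′ s∨
  in k , z , y , z≈ , y≈ ,
     HasType-sup k tx (HasType-resp k (≈-refl (C k)) (≈-stage (≈-trans 𝒞 y≈′ (≈-sym 𝒞 y≈))) tx′) z∨

⊥∶𝒞 : ∀ {a} → a ∶𝒞 U𝒞 → 𝒞.⊥ ∶𝒞 a
⊥∶𝒞 t = let (n , a , a≈ , ta) = stage-of t in
  n , CUSL.⊥ (C n) , a , 𝒞.≤-antisym (Emb.bottom (inj n)) (𝒞.min _) , a≈ , ⊥-typed n (CUSL.≤-refl (C n)) ta

⊥∶U : 𝒞.⊥ ∶𝒞 U𝒞
⊥∶U = 1 , bot , U , 𝒞.≤-antisym (Emb.bottom (inj 1)) (𝒞.min _) , ≈-refl 𝒞 , IsType-⊥ 0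

U∶U : U𝒞 ∶𝒞 U𝒞
U∶U = 1 , U , U , ≈-refl 𝒞 , ≈-refl 𝒞 , rule-Univ (≈-refl (C 1)) (≈-refl (C 1))

∶⊥-inv : ∀ {u a} → a ⊑ 𝒞.⊥ → u ∶𝒞 a → u ⊑ 𝒞.⊥
∶⊥-inv a⊑ (n , x , y , x≈ , y≈ , t) =
  ⊑-trans (𝒞.≥-reflexive x≈) (⊑-trans (up (⊥-inv n (reflect-stage (⊑-trans (𝒞.≤-reflexive y≈) (⊑-trans a⊑ (𝒞.min _)))) t))
    (Emb.bottom (inj n)))

-- Single-step functions, and comparison across stages

infix 5 step
step : ∀ n → ∣ C n ∣ → ∣ C n ∣ → Step (C n) (C n)
step n = singleₛ (dec-C n)

syntax step n t v = t ↦[ n ] v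

module _ n {t v : ∣ C n ∣} where
  private module Cₙ = CUSL (C n)

  ↦-≥ : ∀ {w} → t Cₙ.≤ w → v Cₙ.≤ (t ↦[ n ] v) · w
  ↦-≥ t≤w = proj₁ (Step.isStep (t ↦[ n ] v) _) (_ , here refl , t≤w)

  ↦-≤ : ∀ {w z} → (t Cₙ.≤ w → v Cₙ.≤ z) → (t ↦[ n ] v) · w Cₙ.≤ z
  ↦-≤ h = proj₂ (Step.isStep (t ↦[ n ] v) _) λ { (_ , here refl , t≤w) → h t≤w }

  ↦-yes : ∀ {w} → t Cₙ.≤ w → (t ↦[ n ] v) · w Cₙ.≈ v
  ↦-yes t≤w = Cₙ.≤-antisym (↦-≤ λ _ → Cₙ.≤-refl) (↦-≥ t≤w)

  ↦-no : ∀ {w} → ¬ (t Cₙ.≤ w) → (t ↦[ n ] v) · w Cₙ.≈ Cₙ.⊥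
  ↦-no t≰w = Cₙ.≤-antisym (↦-≤ λ t≤w → ⊥-elim (t≰w t≤w)) (Cₙ.min _)

  -- Every argument is lowered to `t` or to `⊥`, according to whether it lies above `t`; both are
  -- typed in `a`.
  dom-↦ : ∀ {a} → IsType n a → HasType n t a → dom (HasType n) (t ↦[ n ] v) a
  dom-↦ {a} ta th w = go (dec-C n t w)
    where
    go : Dec (t Cₙ.≤ w) → ∃[ v′ ] v′ Cₙ.≤ w × HasType n v′ a × (t ↦[ n ] v) · w Cₙ.≈ (t ↦[ n ] v) · v′
    go (yes t≤w) = t , t≤w , th , ≈-trans (C n) (↦-yes t≤w) (≈-sym (C n) (↦-yes Cₙ.≤-refl))
    go (no t≰w) = Cₙ.⊥ , Cₙ.min _ , ⊥-typed n Cₙ.≤-refl ta ,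
      ≈-trans (C n) (↦-no t≰w) (≈-sym (C n) (↦-no λ t≤⊥ → t≰w (Cₙ.≤-trans t≤⊥ (Cₙ.min _))))

Pi-↦ : ∀ n {t a b} → IsType n a → HasType n t a → IsType n b → PiType n a (t ↦[ n ] b)
Pi-↦ n {t} {b = b} ta th tb = record
  { domain = ta ; dom-cod = dom-↦ n {v = b} ta th ; codomain = cod }
  where
  cod : ∀ w → IsType n ((t ↦[ n ] b) · w)
  cod w = go (dec-C n t w)
    where
    go : Dec (t ≤[ C n ] w) → IsType n ((t ↦[ n ] b) · w)
    go (yes t≤w) = IsType-resp n (≈-sym (C n) (↦-yes n t≤w)) tb
    go (no t≰w) = IsType-resp n (≈-sym (C n) (↦-no n t≰w)) (⊥-IsType n tb)

lam-↦ : ∀ n {t a v b} → IsType n a → HasType n t a → HasType n v b → IsType n b →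
        HasType (suc n) (lam (t ↦[ n ] v)) (Pi a (t ↦[ n ] b))
lam-↦ n {t} {v = v} {b} ta th tv tb = lam-HasType n P record { dom-fun = dom-↦ n {v = v} ta th ; img-typed = img }
  where
  P = Pi-↦ n {t} {b = b} ta th tb
  img : ∀ w → HasType n ((t ↦[ n ] v) · w) ((t ↦[ n ] b) · w)
  img w = go (dec-C n t w)
    where
    go : Dec (t ≤[ C n ] w) → HasType n ((t ↦[ n ] v) · w) ((t ↦[ n ] b) · w)
    go (yes t≤w) = HasType-resp n (≈-sym (C n) (↦-yes n t≤w)) (≈-sym (C n) (↦-yes n t≤w)) tv
    go (no t≰w) = ⊥-typed n (CUSL.≤-reflexive (C n) (↦-no n t≰w)) (PiType.codomain P w)

fn-bottom : ∀ n {s : Step (C n) (C n)} → (∀ {u v} → (u , v) ∈ presentation s → (n , v) ⊑ 𝒞.⊥) → (suc n , lam s) ⊑ 𝒞.⊥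
fn-bottom n {s} h = ⊑-trans (up {suc n} (lam⊥≤ (pointwise λ w → proj₂ (Step.isStep s w) λ { (_ , ∈p , _) →
  reflect-stage (⊑-trans (h ∈p) (𝒞.min _)) }))) (Emb.bottom (inj (suc n)))

-- Extensionality for compact elements. If `z` is not a λ, its application map is `⊥`; then all
-- values of `s` are `⊥`, and so is `lam s`.
lam-below : ∀ n (s : Step (C n) (C n)) z →
            (∀ {u v} → (u , v) ∈ presentation s → (n , v) ⊑ app z (n , u)) → (suc n , lam s) ⊑ z
lam-below n s (zero , _)         h = ⊑-trans (fn-bottom n {s} h) (𝒞.min _)
lam-below n s (suc m , bot)      h = ⊑-trans (fn-bottom n {s} h) (𝒞.min _)
lam-below n s (suc m , U)        h = ⊑-trans (fn-bottom n {s} h) (𝒞.min _)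
lam-below n s (suc m , Pi _ _)   h = ⊑-trans (fn-bottom n {s} h) (𝒞.min _)
lam-below n s (suc m , lam g)    h = lam⊑lam {f = s} {g} (pointwise λ w →
  mapStep-lub dec-𝒞 (inj n) (inj n) s w λ ∈p x⊑w → ⊑-trans (h ∈p) (monotone (onC m g) x⊑w))

onC-to : ∀ n f w → onC n f · (n , w) 𝒞.≈ (n , f · w)
onC-to n = mapStep-to dec-𝒞 (inj n) (inj n)

Pi⊑Pi : ∀ {n m a b} {f : Step (C n) (C n)} {g : Step (C m) (C m)} → (n , a) ⊑ (m , b) → onC n f ≤ₛ onC m g →
        (suc n , Pi a f) ⊑ (suc m , Pi b g)
Pi⊑Pi {n} {m} {f = f} {g} a⊑b f≤g = ⊑-from (s≤s p) (s≤s q) (Pi≤Pi (⊑-to p q a⊑b)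
  (Emb.reflect (emb-⇒ dec-𝒞 (inj (n ⊔ m)) (inj (n ⊔ m)))
    (S.≤-trans (onC-lift-≥ p f) (S.≤-trans f≤g (onC-lift-≤ q g)))))
  where
  module S = CUSL (𝒞 ⇒ 𝒞)
  p = ℕₚ.m≤m⊔n n m
  q = ℕₚ.m≤n⊔m n m

Pi⊑-inv : ∀ {n m a b} {f : Step (C n) (C n)} {g : Step (C m) (C m)} → (suc n , Pi a f) ⊑ (suc m , Pi b g) →
          (n , a) ⊑ (m , b) × onC n f ≤ₛ onC m g
Pi⊑-inv {n} {m} {a} {b} {f} {g} h with ⊑-to (s≤s p) (s≤s q) {Pi a f} {Pi b g} h
  where
  p = ℕₚ.m≤m⊔n n m
  q = ℕₚ.m≤n⊔m n m
... | Pi≤Pi a≤ f≤ = ⊑-from p q a≤ , S.≤-trans (onC-lift-≤ p f) (S.≤-trans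
    (mapStep-mono dec-𝒞 (inj (n ⊔ m)) (inj (n ⊔ m)) f≤) (onC-lift-≥ q g))
  where
  module S = CUSL (𝒞 ⇒ 𝒞)
  p = ℕₚ.m≤m⊔n n m
  q = ℕₚ.m≤n⊔m n m

Pi⋢⊥ : ∀ {n a} {f : Step (C n) (C n)} → ¬ ((suc n , Pi a f) ⊑ 𝒞.⊥)
Pi⋢⊥ {n} {a} {f} h with ⊑-to (ℕₚ.≤-refl {suc n}) z≤n {Pi a f} {tt} h
... | ()

Pi⋢U : ∀ {n m a} {f : Step (C n) (C n)} → ¬ ((suc n , Pi a f) ⊑ (suc m , U))
Pi⋢U {n} {m} {a} {f} h with ⊑-to (s≤s (ℕₚ.m≤m⊔n n m)) (s≤s (ℕₚ.m≤n⊔m n m)) {Pi a f} {U} h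
... | ()

-- Turns an equation in `𝒞` into a propositional one about the head constructor, so that stage data
-- can be matched on.
Pi-stage : ∀ {n m a y} {s : Step (C n) (C n)} → (m , y) 𝒞.≈ (suc n , Pi a s) →
           ∃[ k ] ∃[ b ] Σ (Step (C k) (C k)) λ g → _≡_ {A = ∣ 𝒞 ∣} (m , y) (suc k , Pi b g)
Pi-stage {n} {zero}  {y = y} {s} e = ⊥-elim (Pi⋢⊥ {f = s} (⊑-trans (𝒞.≥-reflexive e) (𝒞.≤-refl)))
Pi-stage {n} {suc m} {y = Pi b g} e = m , b , g , refl
Pi-stage {n} {suc m} {y = bot} {s} e = ⊥-elim (Pi⋢⊥ {f = s} (⊑-trans (𝒞.≥-reflexive e) (Emb.bottom (inj (suc m)))))
Pi-stage {n} {suc m} {y = U} {s} e = ⊥-elim (Pi⋢U {f = s} (𝒞.≥-reflexive e))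
Pi-stage {n} {suc m} {a} {y = lam f} {s} e
  with ⊑-to (s≤s (ℕₚ.m≤m⊔n n m)) (s≤s (ℕₚ.m≤n⊔m n m)) {Pi a s} {lam f} (𝒞.≥-reflexive e)
... | ()

app-resp : ∀ {v v′ u u′} → v 𝒞.≈ v′ → u 𝒞.≈ u′ → app v u 𝒞.≈ app v′ u′
app-resp v≈ u≈ = 𝒞.≤-antisym (app-mono (𝒞.≤-reflexive v≈) (𝒞.≤-reflexive u≈))
                              (app-mono (𝒞.≥-reflexive v≈) (𝒞.≥-reflexive u≈))

app-appₙ : ∀ n v w → app (suc n , v) (n , w) 𝒞.≈ (n , appₙ n v w)
app-appₙ n bot w      = 𝒞.≤-antisym (𝒞.min _) (Emb.bottom (inj n))
app-appₙ n U w        = 𝒞.≤-antisym (𝒞.min _) (Emb.bottom (inj n))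
app-appₙ n (lam f) w  = onC-to n f w
app-appₙ n (Pi _ _) w = 𝒞.≤-antisym (𝒞.min _) (Emb.bottom (inj n))

-- Monotonicity and continuity of the semantics

infix 4 _⊆_ _≐ᴰ_

record _⊆_ (α δ : 𝒟) : Set where
  constructor incl
  field at⊆ : ∀ u → u ∈ᴰ α → u ∈ᴰ δ
open _⊆_

⊆-refl : ∀ {α} → α ⊆ α
⊆-refl = incl λ _ ∈α → ∈α

⊆-trans : ∀ {α δ γ} → α ⊆ δ → δ ⊆ γ → α ⊆ γ
⊆-trans p q = incl λ u ∈α → at⊆ q u (at⊆ p u ∈α)

_≐ᴰ_ : 𝒟 → 𝒟 → Set
α ≐ᴰ δ = (α ⊆ δ) × (δ ⊆ α)

≐ᴰ-refl : ∀ {α} → α ≐ᴰ α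
≐ᴰ-refl = ⊆-refl , ⊆-refl

≐ᴰ-sym : ∀ {α δ} → α ≐ᴰ δ → δ ≐ᴰ α
≐ᴰ-sym (p , q) = q , p

≐ᴰ-trans : ∀ {α δ γ} → α ≐ᴰ δ → δ ≐ᴰ γ → α ≐ᴰ γ
≐ᴰ-trans (p , q) (p′ , q′) = ⊆-trans p p′ , ⊆-trans q′ q

∈-resp : ∀ α {u v} → u 𝒞.≈ v → u ∈ᴰ α → v ∈ᴰ α
∈-resp α u≈v = 𝒟.down α (𝒞.≥-reflexive u≈v)

↓-⊆ : ∀ {u} α → u ∈ᴰ α → ↓ u ⊆ α
↓-⊆ α ∈α = incl λ _ v⊑u → 𝒟.down α v⊑u ∈α

𝐩-mono : ∀ {α α′ ω ω′} → α ⊆ α′ → ω ⊆ ω′ → 𝐩 α ω ⊆ 𝐩 α′ ω′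
𝐩-mono p q = incl λ { u (us , all , s , lub , u⊑s) →
  us , All.map (λ { {v} (∈ω , a , ∈α , t) → at⊆ q v ∈ω , a , at⊆ p a ∈α , t }) all , s , lub , u⊑s }

𝚷-mono : ∀ {α α′ g g′} → α ⊆ α′ → (∀ u → g (↓ u) ⊆ g′ (↓ u)) → 𝚷 α g ⊆ 𝚷 α′ g′
𝚷-mono p q = incl λ where
  u (inj₁ u≈⊥) → inj₁ u≈⊥
  u (inj₂ (n , a , s , u≈ , ∈a , ∈s)) → inj₂ (n , a , s , u≈ , at⊆ p _ ∈a , λ w → at⊆ (q w) _ (∈s w))

𝛌-mono : ∀ {g g′} → (∀ u → g (↓ u) ⊆ g′ (↓ u)) → 𝛌 g ⊆ 𝛌 g′
𝛌-mono q = incl λ { u (n , s , u≈ , ∈s) → n , s , u≈ , λ w → at⊆ (q w) _ (∈s w) }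

𝐚𝐩𝐩-mono : ∀ {α α′ δ δ′} → α ⊆ α′ → δ ⊆ δ′ → 𝐚𝐩𝐩 α δ ⊆ 𝐚𝐩𝐩 α′ δ′
𝐚𝐩𝐩-mono p q = incl λ { w (v , u , ∈α , ∈δ , w≈) → v , u , at⊆ p v ∈α , at⊆ q u ∈δ , w≈ }

▸-mono : ∀ {n} {ρ ρ′ : Env n} {α α′} → (∀ x → ρ x ⊆ ρ′ x) → α ⊆ α′ → ∀ x → (ρ ▸ α) x ⊆ (ρ′ ▸ α′) x
▸-mono p q zero    = q
▸-mono p q (suc x) = p x

body : ∀ {n} → Tm n → Tm (suc n) → Env n → 𝒟 → 𝒟
body A B ρ ω = ⟦ B ⟧ (ρ ▸ 𝐩 (⟦ A ⟧ ρ) ω)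

⟦⟧-mono : ∀ {n} (M : Tm n) {ρ ρ′ : Env n} → (∀ x → ρ x ⊆ ρ′ x) → ⟦ M ⟧ ρ ⊆ ⟦ M ⟧ ρ′
⟦⟧-mono (var x) p = p x
⟦⟧-mono 𝒰       p = ⊆-refl
⟦⟧-mono (Π A B) {ρ} {ρ′} p = 𝚷-mono {g = body A B ρ} {body A B ρ′} (⟦⟧-mono A p) λ u →
  ⟦⟧-mono B (▸-mono p (𝐩-mono (⟦⟧-mono A p) ⊆-refl))
⟦⟧-mono (ƛ A M) {ρ} {ρ′} p = 𝛌-mono {body A M ρ} {body A M ρ′} λ u →
  ⟦⟧-mono M (▸-mono p (𝐩-mono (⟦⟧-mono A p) ⊆-refl))
⟦⟧-mono (M ∙ N) {ρ} {ρ′} p = 𝐚𝐩𝐩-mono (⟦⟧-mono M p) (⟦⟧-mono N p)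

⟦⟧-cong : ∀ {n} (M : Tm n) {ρ ρ′ : Env n} → (∀ x → ρ x ≐ᴰ ρ′ x) → ⟦ M ⟧ ρ ≐ᴰ ⟦ M ⟧ ρ′
⟦⟧-cong M p = ⟦⟧-mono M (λ x → proj₁ (p x)) , ⟦⟧-mono M (λ x → proj₂ (p x))

▸-cong : ∀ {n} {ρ ρ′ : Env n} {α α′} → (∀ x → ρ x ≐ᴰ ρ′ x) → α ≐ᴰ α′ → ∀ x → (ρ ▸ α) x ≐ᴰ (ρ′ ▸ α′) x
▸-cong p q zero    = q
▸-cong p q (suc x) = p x

𝐩-congˡ : ∀ {α α′} ω → α ≐ᴰ α′ → 𝐩 α ω ≐ᴰ 𝐩 α′ ω
𝐩-congˡ ω (p , q) = 𝐩-mono p ⊆-refl , 𝐩-mono q ⊆-refl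

pres-∈ : ∀ n (s : Step (C n) (C n)) (G : ∣ 𝒞 ∣ → 𝒟) → (∀ w → onC n s · w ∈ᴰ G w) →
         ∀ {u v} → (u , v) ∈ presentation s → (n , v) ∈ᴰ G (n , u)
pres-∈ n s G ∈s {u} ∈p = 𝒟.down (G (n , u)) (mapStep-ub dec-𝒞 (inj n) (inj n) s (n , u) ∈p ⊑-refl) (∈s (n , u))

-- The value at `w` is a supremum of finitely many `v` with `u ⊑ w`, each in `G w` by monotonicity.
-- Membership of a step function in `𝛌` or `𝚷` is thus a condition on finitely many pairs, which
-- yields continuity at binders.
∈-pres : ∀ n (s : Step (C n) (C n)) (G : ∣ 𝒞 ∣ → 𝒟) → (∀ {u u′} → u ⊑ u′ → G u ⊆ G u′) →
         (∀ {u v} → (u , v) ∈ presentation s → (n , v) ∈ᴰ G (n , u)) → ∀ w → onC n s · w ∈ᴰ G w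
∈-pres n s G G-mono h w =
  let (vs , complete , all) = values dec-𝒞 (inj n) (inj n) (presentation s) w
      (t , (ub , _) , ∈t)   = 𝒟.mem-lub (G w) (List.map (n ,_) vs)
        (map⁺ (All.map (λ { (x , ∈p , x⊑w) → at⊆ (G-mono x⊑w) _ (h ∈p) }) all))
  in 𝒟.down (G w) (mapStep-lub dec-𝒞 (inj n) (inj n) s w λ ∈p x⊑w → ub (∈-map⁺ (n ,_) (complete ∈p x⊑w))) ∈t

Approx : ℕ → Set
Approx n = Fin n → ∣ 𝒞 ∣

⌊_⌋ : ∀ {n} → Approx n → Env n
⌊ r ⌋ x = ↓ (r x)

infix 4 _∈ᴱ_ _⊑ᴱ_
_∈ᴱ_ : ∀ {n} → Approx n → Env n → Set
r ∈ᴱ ρ = ∀ x → r x ∈ᴰ ρ x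

_⊑ᴱ_ : ∀ {n} → Approx n → Approx n → Set
r ⊑ᴱ r′ = ∀ x → r x ⊑ r′ x

⌊⌋-mono : ∀ {n} {r r′ : Approx n} → r ⊑ᴱ r′ → ∀ x → ⌊ r ⌋ x ⊆ ⌊ r′ ⌋ x
⌊⌋-mono r⊑ x = incl λ u u⊑ → ⊑-trans u⊑ (r⊑ x)

joinᴱ : ∀ {n} {ρ : Env n} {r r′} → r ∈ᴱ ρ → r′ ∈ᴱ ρ → ∃[ s ] s ∈ᴱ ρ × r ⊑ᴱ s × r′ ⊑ᴱ s
joinᴱ {ρ = ρ} ∈r ∈r′ =
  (λ x → proj₁ (j x)) , (λ x → proj₂ (proj₂ (j x))) ,
  (λ x → proj₁ (proj₁ (proj₂ (j x)))) , (λ x → proj₁ (proj₂ (proj₁ (proj₂ (j x)))))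
  where
  j : ∀ x → _
  j x = 𝒟.closed (ρ x) (∈r x) (∈r′ x)

-- Directedness: finitely many requirements, each met by some approximation and preserved by larger
-- ones, are met jointly.
collect : ∀ {n} {X : Set} {ρ : Env n} (P : Approx n → X → Set) →
          (∀ {r r′} x → r ⊑ᴱ r′ → P r x → P r′ x) → (xs : List X) →
          All (λ x → ∃[ r ] r ∈ᴱ ρ × P r x) xs → ∃[ r ] r ∈ᴱ ρ × All (P r) xs
collect {ρ = ρ} P P-mono [] [] = (λ _ → 𝒞.⊥) , (λ x → 𝒟.mem-⊥ (ρ x)) , []
collect {ρ = ρ} P P-mono (x ∷ xs) ((r , ∈r , p) ∷ all) =
  let (r′ , ∈r′ , ps)      = collect {ρ = ρ} P P-mono xs all
      (s , ∈s , r⊑s , r′⊑s) = joinᴱ {ρ = ρ} ∈r ∈r′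
  in s , ∈s , P-mono x r⊑s p ∷ All.map (λ {y} → P-mono y r′⊑s) ps

-- Continuity in all variables at once: each compact element of the value is already produced by
-- compact approximations of the environment.
Continuous : ∀ {n} → Tm n → Set₁
Continuous {n} M = ∀ {ρ : Env n} w → w ∈ᴰ ⟦ M ⟧ ρ → ∃[ r ] r ∈ᴱ ρ × w ∈ᴰ ⟦ M ⟧ ⌊ r ⌋

𝐩-continuous : ∀ {n} (A : Tm n) → Continuous A → ∀ {ρ} ω w → w ∈ᴰ 𝐩 (⟦ A ⟧ ρ) ω →
               ∃[ r ] r ∈ᴱ ρ × w ∈ᴰ 𝐩 (⟦ A ⟧ ⌊ r ⌋) ω
𝐩-continuous A cA {ρ} ω w (us , all , s , lub , w⊑s) =
  let (r , ∈r , all′) = collect {ρ = ρ} (λ r u → u ∈ᴰ ω × ∃[ a ] a ∈ᴰ ⟦ A ⟧ ⌊ r ⌋ × u ∶𝒞 a)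
        (λ { _ r⊑ (∈ω , a , ∈a , t) → ∈ω , a , at⊆ (⟦⟧-mono A (⌊⌋-mono r⊑)) a ∈a , t }) us
        (All.map (λ { (∈ω , a , ∈a , t) → let (r , ∈r , ∈a′) = cA a ∈a in r , ∈r , ∈ω , a , ∈a′ , t }) all)
  in r , ∈r , us , all′ , s , lub , w⊑s

binder-continuous : ∀ {n} (A : Tm n) (B : Tm (suc n)) → Continuous A → Continuous B → ∀ {ρ} ω w →
                    w ∈ᴰ ⟦ B ⟧ (ρ ▸ 𝐩 (⟦ A ⟧ ρ) ω) → ∃[ r ] r ∈ᴱ ρ × w ∈ᴰ ⟦ B ⟧ (⌊ r ⌋ ▸ 𝐩 (⟦ A ⟧ ⌊ r ⌋) ω)
binder-continuous A B cA cB {ρ} ω w ∈w =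
  let (r , ∈r , ∈w′)        = cB w ∈w
      -- The element chosen for the bound variable lies in `𝐩 (⟦ A ⟧ ρ) ω`, which depends on `ρ` as
      -- well; it is approximated a second time, and the result is joined with the rest of `r`.
      (r₀ , ∈r₀ , ∈p)       = 𝐩-continuous A cA {ρ} ω (r zero) (∈r zero)
      (s , ∈s , r₀⊑s , r⊑s) = joinᴱ {ρ = ρ} ∈r₀ (λ x → ∈r (suc x))
      p⊆ = 𝐩-mono {ω = ω} (⟦⟧-mono A (⌊⌋-mono r₀⊑s)) ⊆-refl
  in s , ∈s , at⊆ (⟦⟧-mono B (λ where
       zero    → ↓-⊆ (𝐩 (⟦ A ⟧ ⌊ s ⌋) ω) (at⊆ p⊆ _ ∈p)
       (suc x) → ⌊⌋-mono r⊑s x)) w ∈w′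

binder-mono : ∀ {n} (A : Tm n) (B : Tm (suc n)) (ρ : Env n) {u u′} → u ⊑ u′ →
              ⟦ B ⟧ (ρ ▸ 𝐩 (⟦ A ⟧ ρ) (↓ u)) ⊆ ⟦ B ⟧ (ρ ▸ 𝐩 (⟦ A ⟧ ρ) (↓ u′))
binder-mono A B ρ {u} {u′} u⊑u′ = ⟦⟧-mono B (▸-mono (λ _ → ⊆-refl)
  (𝐩-mono ⊆-refl (incl λ _ v⊑u → ⊑-trans v⊑u u⊑u′)))

step-continuous : ∀ {n} (A : Tm n) (B : Tm (suc n)) → Continuous A → Continuous B → ∀ {ρ} k (s : Step (C k) (C k)) →
  (∀ u → onC k s · u ∈ᴰ ⟦ B ⟧ (ρ ▸ 𝐩 (⟦ A ⟧ ρ) (↓ u))) →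
  ∃[ r ] r ∈ᴱ ρ × (∀ u → onC k s · u ∈ᴰ ⟦ B ⟧ (⌊ r ⌋ ▸ 𝐩 (⟦ A ⟧ ⌊ r ⌋) (↓ u)))
step-continuous A B cA cB {ρ} k s ∈s =
  let (r , ∈r , all) = collect {ρ = ρ}
        (λ { r (u , v) → (k , v) ∈ᴰ ⟦ B ⟧ (⌊ r ⌋ ▸ 𝐩 (⟦ A ⟧ ⌊ r ⌋) (↓ (k , u))) })
        (λ { {r} {r′} (u , v) r⊑ → at⊆ (⟦⟧-mono B (▸-mono (⌊⌋-mono r⊑)
           (𝐩-mono (⟦⟧-mono A (⌊⌋-mono r⊑)) ⊆-refl))) _ })
        (presentation s)
        (All.tabulate λ { {u , v} ∈p → binder-continuous A B cA cB {ρ} (↓ (k , u)) (k , v)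
           (pres-∈ k s (λ u → ⟦ B ⟧ (ρ ▸ 𝐩 (⟦ A ⟧ ρ) (↓ u))) ∈s ∈p) })
  in r , ∈r , ∈-pres k s (λ u → ⟦ B ⟧ (⌊ r ⌋ ▸ 𝐩 (⟦ A ⟧ ⌊ r ⌋) (↓ u))) (binder-mono A B ⌊ r ⌋) (All.lookup all)

⟦⟧-continuous : ∀ {n} (M : Tm n) → Continuous M
⟦⟧-continuous (var x) {ρ} w ∈w = r , ∈r , w⊑
  where
  pick : ∀ {y} → Dec (x ≡ y) → ∣ 𝒞 ∣
  pick (yes _) = w
  pick (no _)  = 𝒞.⊥
  r : Approx _
  r y = pick (x Fin.≟ y)
  ∈r : r ∈ᴱ ρ
  ∈r y with x Fin.≟ y
  ... | yes refl = ∈w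
  ... | no _     = 𝒟.mem-⊥ (ρ y)
  w⊑ : w ⊑ r x
  w⊑ with x Fin.≟ x
  ... | yes refl = ⊑-refl
  ... | no x≢x   = ⊥-elim (x≢x refl)
⟦⟧-continuous 𝒰 {ρ} w ∈w = (λ _ → 𝒞.⊥) , (λ x → 𝒟.mem-⊥ (ρ x)) , ∈w
⟦⟧-continuous (Π A B) {ρ} w (inj₁ w≈⊥) = (λ _ → 𝒞.⊥) , (λ x → 𝒟.mem-⊥ (ρ x)) , inj₁ w≈⊥
⟦⟧-continuous (Π A B) {ρ} w (inj₂ (n , a , s , w≈ , ∈a , ∈s)) =
  let (r₁ , ∈r₁ , ∈a′) = ⟦⟧-continuous A (n , a) ∈a
      (r₂ , ∈r₂ , ∈s′) = step-continuous A B (⟦⟧-continuous A) (⟦⟧-continuous B) {ρ} n s ∈s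
      (r , ∈r , r₁⊑ , r₂⊑) = joinᴱ {ρ = ρ} ∈r₁ ∈r₂
  in r , ∈r , 𝒟.down (⟦ Π A B ⟧ ⌊ r ⌋) (𝒞.≤-reflexive w≈)
    (inj₂ (n , a , s , ≈-refl 𝒞 , at⊆ (⟦⟧-mono A (⌊⌋-mono r₁⊑)) (n , a) ∈a′ ,
      λ u → at⊆ (⟦⟧-mono B (▸-mono (⌊⌋-mono r₂⊑) (𝐩-mono (⟦⟧-mono A (⌊⌋-mono r₂⊑)) ⊆-refl)))
        _ (∈s′ u)))
⟦⟧-continuous (ƛ A M) {ρ} w (n , s , w≈ , ∈s) =
  let (r , ∈r , ∈s′) = step-continuous A M (⟦⟧-continuous A) (⟦⟧-continuous M) {ρ} n s ∈s
  in r , ∈r , n , s , w≈ , ∈s′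
⟦⟧-continuous (M ∙ N) {ρ} w (v , u , ∈v , ∈u , w≈) =
  let (r₁ , ∈r₁ , ∈v′) = ⟦⟧-continuous M v ∈v
      (r₂ , ∈r₂ , ∈u′) = ⟦⟧-continuous N u ∈u
      (r , ∈r , r₁⊑ , r₂⊑) = joinᴱ {ρ = ρ} ∈r₁ ∈r₂
  in r , ∈r , v , u , at⊆ (⟦⟧-mono M (⌊⌋-mono r₁⊑)) v ∈v′ , at⊆ (⟦⟧-mono N (⌊⌋-mono r₂⊑)) u ∈u′ , w≈

-- Interpretation of substituted terms

module SemanticSubstitution
  (S : ∀ {m n} → Sub Tm m n → Env n → Env m → Set)
  (S-var : ∀ {m n} (σ : Sub Tm m n) ρ′ ρ → S σ ρ′ ρ → ∀ x → ⟦ lookup σ x ⟧ ρ′ ≐ᴰ ρ x)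
  (S-↑ : ∀ {m n} (σ : Sub Tm m n) ρ′ ρ α′ α → S σ ρ′ ρ → α′ ≐ᴰ α → S (σ ↑) (ρ′ ▸ α′) (ρ ▸ α))
  where
  -- Under a binder both sides project onto equal domains, so the new variable gets equal values.
  -- The class `S` is abstract because the result is used first for renamings: `⟦weaken⟧` is what
  -- lets a substitution pass under a binder.
  ⟦/⟧ : ∀ {m n} (M : Tm m) {σ : Sub Tm m n} {ρ′ ρ} → S σ ρ′ ρ → ⟦ M / σ ⟧ ρ′ ≐ᴰ ⟦ M ⟧ ρ
  ⟦/⟧ (var x) {σ} {ρ′} {ρ} s = S-var σ ρ′ ρ s x
  ⟦/⟧ 𝒰       s = ≐ᴰ-refl
  ⟦/⟧ (Π A B) {σ} {ρ′} {ρ} s =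
    𝚷-mono {⟦ A / σ ⟧ ρ′} {⟦ A ⟧ ρ} {body (A / σ) (B / σ ↑) ρ′} {body A B ρ} (proj₁ A≐) (λ u → proj₁ (B≐ u)) ,
    𝚷-mono {⟦ A ⟧ ρ} {⟦ A / σ ⟧ ρ′} {body A B ρ} {body (A / σ) (B / σ ↑) ρ′} (proj₂ A≐) (λ u → proj₂ (B≐ u))
    where
    A≐ = ⟦/⟧ A {σ} s
    B≐ : ∀ u → ⟦ B / σ ↑ ⟧ (ρ′ ▸ 𝐩 (⟦ A / σ ⟧ ρ′) (↓ u)) ≐ᴰ ⟦ B ⟧ (ρ ▸ 𝐩 (⟦ A ⟧ ρ) (↓ u))
    B≐ u = ⟦/⟧ B (S-↑ σ ρ′ ρ _ _ s (𝐩-congˡ (↓ u) A≐))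
  ⟦/⟧ (ƛ A M) {σ} {ρ′} {ρ} s = 
    𝛌-mono {body (A / σ) (M / σ ↑) ρ′} {body A M ρ} (λ u → proj₁ (M≐ u)) ,
    𝛌-mono {body A M ρ} {body (A / σ) (M / σ ↑) ρ′} (λ u → proj₂ (M≐ u))
    where
    A≐ = ⟦/⟧ A {σ} s
    M≐ : ∀ u → ⟦ M / σ ↑ ⟧ (ρ′ ▸ 𝐩 (⟦ A / σ ⟧ ρ′) (↓ u)) ≐ᴰ ⟦ M ⟧ (ρ ▸ 𝐩 (⟦ A ⟧ ρ) (↓ u))
    M≐ u = ⟦/⟧ M (S-↑ σ ρ′ ρ _ _ s (𝐩-congˡ (↓ u) A≐))
  ⟦/⟧ (M ∙ N) {σ} {ρ′} {ρ} s =
    let (p , q) = ⟦/⟧ M {σ} s ; (p′ , q′) = ⟦/⟧ N {σ} s in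
    𝐚𝐩𝐩-mono p p′ ,
    𝐚𝐩𝐩-mono q q′

private
  SemRen : ∀ {m n} → Sub Tm m n → Env n → Env m → Set
  SemRen σ ρ′ ρ = ∀ x → ∃[ y ] lookup σ x ≡ var y × ρ′ y ≐ᴰ ρ x

  SemRen-var : ∀ {m n} (σ : Sub Tm m n) ρ′ ρ → SemRen σ ρ′ ρ → ∀ x → ⟦ lookup σ x ⟧ ρ′ ≐ᴰ ρ x
  SemRen-var σ ρ′ ρ s x = let (y , eq , e) = s x in subst (λ t → ⟦ t ⟧ ρ′ ≐ᴰ ρ x) (sym eq) e

  SemRen-↑ : ∀ {m n} (σ : Sub Tm m n) ρ′ ρ α′ α → SemRen σ ρ′ ρ → α′ ≐ᴰ α → SemRen (σ ↑) (ρ′ ▸ α′) (ρ ▸ α)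
  SemRen-↑ σ ρ′ ρ α′ α s e zero = zero , refl , e
  SemRen-↑ σ ρ′ ρ α′ α s e (suc x) = let (y , eq , e′) = s x in
    suc y , trans (weaken-lookup σ x) (trans (cong weaken eq) TL.weaken-var) , e′

  module SR = SemanticSubstitution SemRen SemRen-var SemRen-↑

⟦weaken⟧ : ∀ {n} (M : Tm n) (ρ : Env n) α → ⟦ weaken M ⟧ (ρ ▸ α) ≐ᴰ ⟦ M ⟧ ρ
⟦weaken⟧ M ρ α = subst (λ t → ⟦ t ⟧ (ρ ▸ α) ≐ᴰ ⟦ M ⟧ ρ) (/-wk M)
  (SR.⟦/⟧ M {wk} {ρ ▸ α} {ρ} λ x → suc x , TL.lookup-wk x , ≐ᴰ-refl)

private
  SemSub : ∀ {m n} → Sub Tm m n → Env n → Env m → Set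
  SemSub σ ρ′ ρ = ∀ x → ⟦ lookup σ x ⟧ ρ′ ≐ᴰ ρ x

  SemSub-var : ∀ {m n} (σ : Sub Tm m n) ρ′ ρ → SemSub σ ρ′ ρ → ∀ x → ⟦ lookup σ x ⟧ ρ′ ≐ᴰ ρ x
  SemSub-var σ ρ′ ρ s = s

  SemSub-↑ : ∀ {m n} (σ : Sub Tm m n) ρ′ ρ α′ α → SemSub σ ρ′ ρ → α′ ≐ᴰ α → SemSub (σ ↑) (ρ′ ▸ α′) (ρ ▸ α)
  SemSub-↑ σ ρ′ ρ α′ α s e zero = e
  SemSub-↑ σ ρ′ ρ α′ α s e (suc x) = subst (λ t → ⟦ t ⟧ (ρ′ ▸ α′) ≐ᴰ ρ x) (sym (weaken-lookup σ x))
    (≐ᴰ-trans (⟦weaken⟧ (lookup σ x) ρ′ α′) (s x))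

  module SS = SemanticSubstitution SemSub SemSub-var SemSub-↑

⟦[]⟧ : ∀ {n} (M : Tm (suc n)) (N : Tm n) (ρ : Env n) → ⟦ M [ N ] ⟧ ρ ≐ᴰ ⟦ M ⟧ (ρ ▸ ⟦ N ⟧ ρ)
⟦[]⟧ M N ρ = SS.⟦/⟧ M {sub N} {ρ} {ρ ▸ ⟦ N ⟧ ρ} λ where
  zero    → ≐ᴰ-refl
  (suc x) → subst (λ t → ⟦ t ⟧ ρ ≐ᴰ ρ x) (sym (TL.lookup-id x)) ≐ᴰ-refl

-- Soundness of the semantics

Covered : 𝒟 → 𝒟 → ∣ 𝒞 ∣ → Set
Covered α δ u = ∃[ v ] ∃[ a ] v ∈ᴰ α × a ∈ᴰ δ × u ⊑ v × v ∶𝒞 a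

∶ᴰ-resp : ∀ {α α′ δ δ′} → α ≐ᴰ α′ → δ ≐ᴰ δ′ → α ∶ᴰ δ → α′ ∶ᴰ δ′
∶ᴰ-resp (α⊆α′ , α′⊆α) (δ⊆δ′ , _) t u ∈α′ =
  let (v , a , ∈α , ∈δ , u⊑v , th) = t u (at⊆ α′⊆α u ∈α′)
  in v , a , at⊆ α⊆α′ v ∈α , at⊆ δ⊆δ′ a ∈δ , u⊑v , th

U∈𝐔 : U𝒞 ∈ᴰ 𝐔
U∈𝐔 = inj₂ (≈-refl 𝒞)

𝐔∶𝐔 : 𝐔 ∶ᴰ 𝐔
𝐔∶𝐔 u (inj₁ u≈⊥) = 𝒞.⊥ , U𝒞 , 𝒟.mem-⊥ 𝐔 , U∈𝐔 , 𝒞.≤-reflexive u≈⊥ , ⊥∶U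
𝐔∶𝐔 u (inj₂ u≈U) = U𝒞 , U𝒞 , U∈𝐔 , U∈𝐔 , 𝒞.≤-reflexive u≈U , U∶U

∶𝐔 : ∀ {v a} → a ∈ᴰ 𝐔 → v ∶𝒞 a → v ∶𝒞 U𝒞
∶𝐔 {v} (inj₁ a≈⊥) t = ∶𝒞-resp (≈-sym 𝒞 (≤⊥⇒≈ 𝒞 (∶⊥-inv (𝒞.≤-reflexive a≈⊥) t))) (≈-refl 𝒞) ⊥∶U
∶𝐔 {v} (inj₂ a≈U) t = ∶𝒞-resp (≈-refl 𝒞) a≈U t

type-above : ∀ {α a} → α ∶ᴰ 𝐔 → a ∈ᴰ α → ∃[ b ] b ∈ᴰ α × a ⊑ b × b ∶𝒞 U𝒞
type-above {a = a} tα ∈a = let (b , c , ∈b , ∈c , a⊑b , t) = tα a ∈a in b , ∈b , a⊑b , ∶𝐔 {b} ∈c t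

type-join : ∀ {α a b} → a ∈ᴰ α → b ∈ᴰ α → a ∶𝒞 U𝒞 → b ∶𝒞 U𝒞 → ∃[ c ] c ∈ᴰ α × a ⊑ c × b ⊑ c × c ∶𝒞 U𝒞
type-join {α} ∈a ∈b ta tb = let (c , c∨ , ∈c) = 𝒟.closed α ∈a ∈b in
  c , ∈c , proj₁ c∨ , proj₁ (proj₂ c∨) , ∶𝒞-sup ta tb c∨

-- The types are joined before the elements: each is enlarged inside `δ` to one of type `U`, the
-- join of two such has type `U` again, and in it the supremum of the elements can be typed.
cover : ∀ {α δ} → δ ∶ᴰ 𝐔 → (us : List ∣ 𝒞 ∣) → All (Covered α δ) us →
        ∃[ v ] ∃[ a ] v ∈ᴰ α × a ∈ᴰ δ × a ∶𝒞 U𝒞 × v ∶𝒞 a × (∀ {u} → u ∈ us → u ⊑ v)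
cover {α} {δ} tδ [] [] = let (b , ∈b , _ , tb) = type-above {δ} tδ (𝒟.mem-⊥ δ) in
  𝒞.⊥ , b , 𝒟.mem-⊥ α , ∈b , tb , ⊥∶𝒞 tb , λ ()
cover {α} {δ} tδ (u ∷ us) ((w , c , ∈w , ∈c , u⊑w , th) ∷ all) =
  let (v , a , ∈v , ∈a , ta , tv , us⊑v) = cover {α} {δ} tδ us all
      (c′ , ∈c′ , c⊑c′ , tc′)            = type-above {δ} tδ ∈c
      (b , ∈b , c′⊑b , a⊑b , tb)         = type-join {δ} ∈c′ ∈a tc′ ta
      (x , x∨ , ∈x)                      = 𝒟.closed α ∈w ∈v
  in x , b , ∈x , ∈b , tb ,
     ∶𝒞-sup (∶𝒞-mono th (⊑-trans c⊑c′ c′⊑b) tb) (∶𝒞-mono tv a⊑b tb) x∨ ,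
     λ { (here refl) → ⊑-trans u⊑w (proj₁ x∨) ; (there ∈us) → ⊑-trans (us⊑v ∈us) (proj₁ (proj₂ x∨)) }

𝐩-intro : ∀ {α ω v a} → v ∈ᴰ ω → a ∈ᴰ α → v ∶𝒞 a → v ∈ᴰ 𝐩 α ω
𝐩-intro {v = v} ∈v ∈a t = v ∷ [] , (∈v , _ , ∈a , t) ∷ [] , v ,
  ((λ { (here refl) → ⊑-refl }) , λ h → h (here refl)) , ⊑-refl

𝐩⊆ : ∀ {α ω} → 𝐩 α ω ⊆ ω
𝐩⊆ {α} {ω} = incl λ { w (us , all , s , (_ , least) , w⊑s) →
  let (t , (ub , _) , ∈t) = 𝒟.mem-lub ω us (All.map proj₁ all) in 𝒟.down ω (⊑-trans w⊑s (least ub)) ∈t }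

-- Together with `𝐩⊆` and `⊆𝐩` this makes `𝐩 α`, for a type `α`, a retraction below the identity
-- onto the ideals typed in `α`.
𝐩-∶ : ∀ {α} ω → α ∶ᴰ 𝐔 → 𝐩 α ω ∶ᴰ α
𝐩-∶ {α} ω tα w (us , all , s , (_ , least) , w⊑s) =
  let (v , a , ∈v , ∈a , _ , t , us⊑v) = cover {ω} {α} tα us
        (All.map (λ { {u} (∈ω , a , ∈a , t) → u , a , ∈ω , ∈a , ⊑-refl , t }) all)
  in v , a , 𝐩-intro {α} {ω} ∈v ∈a t , ∈a , ⊑-trans w⊑s (least us⊑v) , t

⊆𝐩 : ∀ {α ω} → ω ∶ᴰ α → ω ⊆ 𝐩 α ω
⊆𝐩 {α} {ω} t = incl λ w ∈w → let (v , a , ∈v , ∈a , w⊑v , tv) = t w ∈w in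
  𝒟.down (𝐩 α ω) w⊑v (𝐩-intro {α} {ω} ∈v ∈a tv)

↓-∶ : ∀ {α t a} → a ∈ᴰ α → t ∶𝒞 a → ↓ t ∶ᴰ α
↓-∶ {t = t} {a} ∈a tu u u⊑t = t , a , ⊑-refl , ∈a , u⊑t , tu

-- Continuity gives approximations of the last variable, and `cover` a typed `t` above them. Two
-- terms are treated together so that a value and its type can be produced by the same argument.
approx₂ : ∀ {n} (M N : Tm (suc n)) {ρ : Env n} {α ω w w′} → α ∶ᴰ 𝐔 → ω ∶ᴰ α →
          w ∈ᴰ ⟦ M ⟧ (ρ ▸ ω) → w′ ∈ᴰ ⟦ N ⟧ (ρ ▸ ω) →
          ∃[ t ] ∃[ a ] t ∈ᴰ ω × a ∈ᴰ α × a ∶𝒞 U𝒞 × t ∶𝒞 a ×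
            w ∈ᴰ ⟦ M ⟧ (ρ ▸ ↓ t) × w′ ∈ᴰ ⟦ N ⟧ (ρ ▸ ↓ t)
approx₂ M N {ρ} {α} {ω} {w} {w′} tα tω ∈w ∈w′ =
  let (r , ∈r , ∈M) = ⟦⟧-continuous M w ∈w
      (s , ∈s , ∈N) = ⟦⟧-continuous N w′ ∈w′
      (t , a , ∈t , ∈a , ta , th , us⊑t) = cover {ω} {α} tα (r zero ∷ s zero ∷ [])
        (tω _ (∈r zero) ∷ tω _ (∈s zero) ∷ [])
  in t , a , ∈t , ∈a , ta , th ,
     at⊆ (⟦⟧-mono M (λ { zero → incl λ _ u⊑ → ⊑-trans u⊑ (us⊑t (here refl))
                       ; (suc x) → ↓-⊆ (ρ x) (∈r (suc x)) })) w ∈M ,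
     at⊆ (⟦⟧-mono N (λ { zero → incl λ _ u⊑ → ⊑-trans u⊑ (us⊑t (there (here refl)))
                       ; (suc x) → ↓-⊆ (ρ x) (∈s (suc x)) })) w′ ∈N

abstract
  common-stage : ∀ b t a → ∃[ k ] ∃[ bₖ ] ∃[ tₖ ] ∃[ aₖ ] (k , bₖ) 𝒞.≈ b × (k , tₖ) 𝒞.≈ t × (k , aₖ) 𝒞.≈ a
  common-stage (p , b) (q , t) (r , a) =
    p ⊔ (q ⊔ r) , _ , _ , _ ,
    raise-≈ (ℕₚ.m≤m⊔n p (q ⊔ r)) (≈-refl 𝒞) ,
    raise-≈ (ℕₚ.≤-trans (ℕₚ.m≤m⊔n q r) (ℕₚ.m≤n⊔m p (q ⊔ r))) (≈-refl 𝒞) ,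
    raise-≈ (ℕₚ.≤-trans (ℕₚ.m≤n⊔m q r) (ℕₚ.m≤n⊔m p (q ⊔ r))) (≈-refl 𝒞)

record Staged (t a v b : ∣ 𝒞 ∣) : Set where
  field
    k : ℕ
    tₖ aₖ vₖ bₖ : ∣ C k ∣
    t≈ : (k , tₖ) 𝒞.≈ t
    a≈ : (k , aₖ) 𝒞.≈ a
    v≈ : (k , vₖ) 𝒞.≈ v
    b≈ : (k , bₖ) 𝒞.≈ b
    taₖ : IsType k aₖ
    tuₖ : HasType k tₖ aₖ
    tbₖ : IsType k bₖ
    tvₖ : HasType k vₖ bₖ

staged-at : ∀ {k t a v b} → HasTypeAt k t a → IsTypeAt k a → HasTypeAt k v b → IsTypeAt k b → Staged t a v b
staged-at {k} (tₖ , aₖ , t≈ , a≈ , th) ta (vₖ , bₖ , v≈ , b≈ , tv) tb = record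
  { k = k ; tₖ = tₖ ; aₖ = aₖ ; vₖ = vₖ ; bₖ = bₖ ; t≈ = t≈ ; a≈ = a≈ ; v≈ = v≈ ; b≈ = b≈
  ; taₖ = at-repᵀ ta a≈ ; tuₖ = th ; tbₖ = at-repᵀ tb b≈ ; tvₖ = tv }

staged-from : ∀ {n₁ n₂ n₃ n₄ t a v b} → HasTypeAt n₁ t a → IsTypeAt n₂ a → HasTypeAt n₃ v b → IsTypeAt n₄ b → Staged t a v b
staged-from {n₁} {n₂} {n₃} {n₄} th ta tv tb = staged-at
  (raise (ℕₚ.≤-trans (ℕₚ.m≤m⊔n n₁ n₂) (ℕₚ.m≤m⊔n (n₁ ⊔ n₂) (n₃ ⊔ n₄))) th)
  (raiseᵀ (ℕₚ.≤-trans (ℕₚ.m≤n⊔m n₁ n₂) (ℕₚ.m≤m⊔n (n₁ ⊔ n₂) (n₃ ⊔ n₄))) ta)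
  (raise (ℕₚ.≤-trans (ℕₚ.m≤m⊔n n₃ n₄) (ℕₚ.m≤n⊔m (n₁ ⊔ n₂) (n₃ ⊔ n₄))) tv)
  (raiseᵀ (ℕₚ.≤-trans (ℕₚ.m≤n⊔m n₃ n₄) (ℕₚ.m≤n⊔m (n₁ ⊔ n₂) (n₃ ⊔ n₄))) tb)

abstract
  staged : ∀ {t a v b} → t ∶𝒞 a → a ∶𝒞 U𝒞 → v ∶𝒞 b → b ∶𝒞 U𝒞 → Staged t a v b
  staged (_ , th) ta (_ , tv) tb = staged-from th (proj₂ (stage-of ta)) tv (proj₂ (stage-of tb))

-- `v` and its type `z`, a Π, at one stage `suc l`. The bound `j` is the stage of an argument, which
-- can then be lifted to where `vₗ` is applied.
record FunStage (v z : ∣ 𝒞 ∣) (j : ℕ) : Set where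
  field
    l   : ℕ
    j≤l : j ℕ.≤ l
    vₗ  : ∣ C (suc l) ∣
    bₗ  : ∣ C l ∣
    gₗ  : Step (C l) (C l)
    v≈  : (suc l , vₗ) 𝒞.≈ v
    z≈  : (suc l , Pi bₗ gₗ) 𝒞.≈ z
    tz  : PiType l bₗ gₗ
    tv  : HasType (suc l) vₗ (Pi bₗ gₗ)

  values-typed : LamType l (appₙ l vₗ) bₗ gₗ
  values-typed = HasType-Pi l tz tv

fun-stage-at : ∀ {v z m a l j} {s : Step (C m) (C m)} → HasTypeAt (suc l) v z → IsTypeAt (suc l) z →
               z 𝒞.≈ (suc m , Pi a s) → j ℕ.≤ l → FunStage v z j
fun-stage-at {l = l} {s = s} (vₗ , zₗ , v≈ , zₗ≈ , t) tz z≈ j≤l with Pi-stage {m = suc l} {y = zₗ} {s} (≈-trans 𝒞 zₗ≈ z≈)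
... | _ , b , g , refl = record
  { l = l ; j≤l = j≤l ; vₗ = vₗ ; bₗ = b ; gₗ = g ; v≈ = v≈ ; z≈ = zₗ≈
  ; tz = IsType-Pi l (at-repᵀ tz zₗ≈) ; tv = t }

fun-stage-from : ∀ {v z m a n p} {s : Step (C m) (C m)} → HasTypeAt n v z → IsTypeAt p z →
                 z 𝒞.≈ (suc m , Pi a s) → ∀ j → FunStage v z j
fun-stage-from {n = n} {p} {s} tv tz z≈ j = fun-stage-at {l = j ⊔ (n ⊔ p)} {s = s}
  (raise (ℕₚ.m≤n⇒m≤1+n (ℕₚ.≤-trans (ℕₚ.m≤m⊔n n p) (ℕₚ.m≤n⊔m j (n ⊔ p)))) tv)
  (raiseᵀ (ℕₚ.m≤n⇒m≤1+n (ℕₚ.≤-trans (ℕₚ.m≤n⊔m n p) (ℕₚ.m≤n⊔m j (n ⊔ p)))) tz) z≈ (ℕₚ.m≤m⊔n j (n ⊔ p))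

abstract
  fun-stage : ∀ {v z m a} {s : Step (C m) (C m)} → v ∶𝒞 z → z ∶𝒞 U𝒞 → z 𝒞.≈ (suc m , Pi a s) → ∀ j → FunStage v z j
  fun-stage {s = s} (_ , tv) tz z≈ j = fun-stage-from {s = s} tv (proj₂ (stage-of tz)) z≈ j

module _ {v z j} (F : FunStage v z j) {m a} {s : Step (C m) (C m)} (z≈ : z 𝒞.≈ (suc m , Pi a s)) where
  open FunStage F renaming (z≈ to zₗ≈)

  stage-Pi≈ : (suc l , Pi bₗ gₗ) 𝒞.≈ (suc m , Pi a s)
  stage-Pi≈ = ≈-trans 𝒞 zₗ≈ z≈

  stage-dom≈ : (l , bₗ) 𝒞.≈ (m , a)
  stage-dom≈ = 𝒞.≤-antisym (proj₁ (Pi⊑-inv {f = gₗ} {s} (𝒞.≤-reflexive stage-Pi≈)))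
                            (proj₁ (Pi⊑-inv {f = s} {gₗ} (𝒞.≥-reflexive stage-Pi≈)))

  stage-cod≈ : ∀ {u} uₗ → (l , uₗ) 𝒞.≈ u → (l , gₗ · uₗ) 𝒞.≈ onC m s · u
  stage-cod≈ {u} uₗ u≈ = ≈-trans 𝒞 (≈-sym 𝒞 (onC-to l gₗ uₗ)) (𝒞.≤-antisym
    (⊑-trans (at (proj₂ (Pi⊑-inv {f = gₗ} {s} (𝒞.≤-reflexive stage-Pi≈))) (l , uₗ)) (monotone (onC m s) (𝒞.≤-reflexive u≈)))
    (⊑-trans (at (proj₂ (Pi⊑-inv {f = s} {gₗ} (𝒞.≥-reflexive stage-Pi≈))) u) (monotone (onC l gₗ) (𝒞.≥-reflexive u≈))))

  stage-app≈ : ∀ {u} uₗ → (l , uₗ) 𝒞.≈ u → (l , appₙ l vₗ uₗ) 𝒞.≈ app v u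
  stage-app≈ uₗ u≈ = ≈-trans 𝒞 (≈-sym 𝒞 (app-appₙ l vₗ uₗ)) (app-resp v≈ u≈)

module _ {v z m a} {s : Step (C m) (C m)} (tv : v ∶𝒞 z) (tz : z ∶𝒞 U𝒞) (z≈ : z 𝒞.≈ (suc m , Pi a s)) where
  private
    module _ (u : ∣ 𝒞 ∣) (F : FunStage v z (proj₁ u)) where
      open FunStage F renaming (tz to tzₗ; z≈ to zₗ≈)
      uₗ : ∣ C l ∣
      uₗ = Emb.to (lift j≤l) (proj₂ u)

      app-∶′ : app v u ∶𝒞 onC m s · u
      app-∶′ = l , appₙ l vₗ uₗ , gₗ · uₗ , stage-app≈ F {s = s} z≈ uₗ (raise-≈ j≤l (≈-refl 𝒞)) ,
        stage-cod≈ F {s = s} z≈ uₗ (raise-≈ j≤l (≈-refl 𝒞)) , LamType.img-typed values-typed uₗ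

      onC-∶U′ : onC m s · u ∶𝒞 U𝒞
      onC-∶U′ = U-of-stage {l} (gₗ · uₗ , stage-cod≈ F {s = s} z≈ uₗ (raise-≈ j≤l (≈-refl 𝒞)) , PiType.codomain tzₗ uₗ)

      domain-∶U′ : (m , a) ∶𝒞 U𝒞
      domain-∶U′ = U-of-stage {l} (bₗ , stage-dom≈ F {s = s} z≈ , PiType.domain tzₗ)

  app-∶ : ∀ u → app v u ∶𝒞 onC m s · u
  app-∶ u = app-∶′ u (fun-stage {s = s} tv tz z≈ (proj₁ u))

  onC-∶U : ∀ u → onC m s · u ∶𝒞 U𝒞
  onC-∶U u = onC-∶U′ u (fun-stage {s = s} tv tz z≈ (proj₁ u))

  domain-∶U : (m , a) ∶𝒞 U𝒞
  domain-∶U = domain-∶U′ 𝒞.⊥ (fun-stage {s = s} tv tz z≈ 0)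

module _ {n} {Γ : Ctx n} where
  Fits-▸ : ∀ {ρ : Env n} {A ω} → Fits ρ Γ → ⟦ A ⟧ ρ ∶ᴰ 𝐔 → ω ∶ᴰ ⟦ A ⟧ ρ → Fits (ρ ▸ ω) (Γ ▹ A)
  Fits-▸ {ρ} {A} {ω} ft tA tω zero =
    ∶ᴰ-resp (≐ᴰ-sym (⟦weaken⟧ A ρ ω)) (≐ᴰ-refl {𝐔}) tA , ∶ᴰ-resp (≐ᴰ-refl {ω}) (≐ᴰ-sym (⟦weaken⟧ A ρ ω)) tω
  Fits-▸ {ρ} {A} {ω} ft tA tω (suc x) =
    let e = ≐ᴰ-sym (⟦weaken⟧ (type Γ x) ρ ω) in
    ∶ᴰ-resp e (≐ᴰ-refl {𝐔}) (proj₁ (ft x)) , ∶ᴰ-resp (≐ᴰ-refl {ρ x}) e (proj₂ (ft x))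

-- A type above `Pi a ⊥ₛ` is again a Π, and its domain is a type above `a`. The rule for η has no
-- premise on `A`; its soundness obtains from here that the new variable ranges over a type.
dom-∶ : ∀ {n} {ρ : Env n} {A B} → ⟦ Π A B ⟧ ρ ∶ᴰ 𝐔 → ⟦ A ⟧ ρ ∶ᴰ 𝐔
dom-∶ {ρ = ρ} {A} {B} tΠ (m , a) ∈a =
  let (z , ∈z , x⊑z , tz) = type-above {⟦ Π A B ⟧ ρ} {suc m , Pi a ⊥ₛ} tΠ
        (inj₂ (m , a , ⊥ₛ , ≈-refl 𝒞 , ∈a , ∈-pres m ⊥ₛ (λ u → body A B ρ (↓ u)) (binder-mono A B ρ) λ ()))
  in go ∈z x⊑z tz
  where
  go : ∀ {z} → z ∈ᴰ ⟦ Π A B ⟧ ρ → (suc m , Pi a ⊥ₛ) ⊑ z → z ∶𝒞 U𝒞 → Covered (⟦ A ⟧ ρ) 𝐔 (m , a)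
  go (inj₁ z≈⊥) x⊑z tz = ⊥-elim (Pi⋢⊥ {f = ⊥ₛ} (⊑-trans x⊑z (𝒞.≤-reflexive z≈⊥)))
  go (inj₂ (k , b , s , z≈ , ∈b , _)) x⊑z tz =
    (l , bₗ) , U𝒞 , 𝒟.down (⟦ A ⟧ ρ) (proj₁ (Pi⊑-inv {f = gₗ} {s} (𝒞.≤-reflexive (≈-trans 𝒞 zₗ≈ z≈)))) ∈b , U∈𝐔 ,
    proj₁ (Pi⊑-inv {f = ⊥ₛ} {gₗ} (⊑-trans x⊑z (𝒞.≥-reflexive zₗ≈))) , U-of-stage {l} (_ , ≈-refl 𝒞 , PiType.domain tzₗ)
    where open FunStage (fun-stage {s = s} (⊥∶𝒞 tz) tz z≈ 0) renaming (z≈ to zₗ≈; tz to tzₗ)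

module _ {n} {ρ : Env n} {A : Tm n} (tA : ⟦ A ⟧ ρ ∶ᴰ 𝐔) where
  private α = ⟦ A ⟧ ρ

  ↓⊆𝐩 : ∀ {t a} → a ∈ᴰ α → t ∶𝒞 a → ↓ t ⊆ 𝐩 α (↓ t)
  ↓⊆𝐩 ∈a t = ⊆𝐩 (↓-∶ {α} ∈a t)

  -- Since `t` is typed in `α`, the projection does not shrink `↓ t`, so a value attained at `↓ t`
  -- is a value of the body.
  ↦-∈ : ∀ {B} {k} {tₖ vₖ : ∣ C k ∣} {t a} → (k , tₖ) 𝒞.≈ t → a ∈ᴰ α → t ∶𝒞 a →
        (k , vₖ) ∈ᴰ ⟦ B ⟧ (ρ ▸ ↓ t) → ∀ w → onC k (tₖ ↦[ k ] vₖ) · w ∈ᴰ body A B ρ (↓ w)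
  ↦-∈ {B} {k} {tₖ} {vₖ} t≈ ∈a th ∈v = ∈-pres k (tₖ ↦[ k ] vₖ) (λ u → body A B ρ (↓ u)) (binder-mono A B ρ)
    λ { (here refl) → at⊆ (binder-mono A B ρ (𝒞.≥-reflexive t≈)) _
          (at⊆ (⟦⟧-mono B (▸-mono (λ _ → ⊆-refl) (↓⊆𝐩 ∈a th))) _ ∈v) }

  ↦-≤ₛ : ∀ {n k} {u v : ∣ C n ∣} {tₖ vₖ : ∣ C k ∣} → (k , tₖ) ⊑ (n , u) → (n , v) ⊑ (k , vₖ) →
         onC n (u ↦[ n ] v) ≤ₛ onC k (tₖ ↦[ k ] vₖ)
  ↦-≤ₛ {n} {k} {u} {v} {tₖ} {vₖ} t⊑u v⊑ = pointwise λ w → mapStep-lub dec-𝒞 (inj n) (inj n) (u ↦[ n ] v) w λ where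
    (here refl) u⊑w → ⊑-trans v⊑ (mapStep-ub dec-𝒞 (inj k) (inj k) (tₖ ↦[ k ] vₖ) w (here refl) (⊑-trans t⊑u u⊑w))

  module _ {B : Tm (suc n)} (tB : ∀ ω → ω ∶ᴰ α → ⟦ B ⟧ (ρ ▸ ω) ∶ᴰ 𝐔) where
    -- Lowering the argument of a single step makes the step function larger. The value `v` is
    -- enlarged to a type `v′` in the same ideal, and the argument `u` lowered to a typed `t` at
    -- which `v′` is still attained.
    Π-cover : ∀ m {a u v : ∣ C m ∣} → (m , a) ∈ᴰ α → (m , v) ∈ᴰ body A B ρ (↓ (m , u)) →
              Covered (⟦ Π A B ⟧ ρ) 𝐔 (suc m , Pi a (u ↦[ m ] v))
    Π-cover m {a} {u} {v} ∈a ∈v =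
      let ω = 𝐩 α (↓ (m , u))
          tω = 𝐩-∶ {α} (↓ (m , u)) tA
          (v′ , ∈v′ , v⊑v′ , tv′) = type-above {⟦ B ⟧ (ρ ▸ ω)} (tB ω tω) ∈v
          (t , b , ∈t , ∈b , tb , th , ∈v″ , _) = approx₂ B B {ρ} {α} {ω} tA tω ∈v′ ∈v′
          (a′ , ∈a′ , a⊑a′ , ta′) = type-above {α} tA ∈a
          (c , ∈c , a′⊑c , b⊑c , tc) = type-join {α} ∈a′ ∈b ta′ tb
          th′ = ∶𝒞-mono th b⊑c tc
      -- `Staged` asks for an element of `v′`; `⊥` stands in, since the single step built here is a
      -- type.
      in build c ∈c t v′ th′ ∈v″ (⊑-trans a⊑a′ a′⊑c) (at⊆ (𝐩⊆ {α} {↓ (m , u)}) t ∈t) v⊑v′ (staged th′ tc (⊥∶𝒞 tv′) tv′)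
      where
      build : ∀ c → c ∈ᴰ α → ∀ t v′ → t ∶𝒞 c → v′ ∈ᴰ ⟦ B ⟧ (ρ ▸ ↓ t) → (m , a) ⊑ c → t ⊑ (m , u) → (m , v) ⊑ v′ →
              Staged t c 𝒞.⊥ v′ → Covered (⟦ Π A B ⟧ ρ) 𝐔 (suc m , Pi a (u ↦[ m ] v))
      build c ∈c t v′ th′ ∈v″ a⊑c t⊑u v⊑v′ st =
         (suc k , Pi aₖ (tₖ ↦[ k ] bₖ)) , U𝒞 ,
         inj₂ (k , aₖ , (tₖ ↦[ k ] bₖ) , ≈-refl 𝒞 , ∈-resp α (≈-sym 𝒞 a≈) ∈c ,
           ↦-∈ {B} t≈ ∈c th′ (∈-resp (⟦ B ⟧ (ρ ▸ ↓ t)) (≈-sym 𝒞 b≈) ∈v″)) ,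
         U∈𝐔 ,
         Pi⊑Pi {f = u ↦[ m ] v} {tₖ ↦[ k ] bₖ} (⊑-trans a⊑c (𝒞.≥-reflexive a≈))
           (↦-≤ₛ (⊑-trans (𝒞.≤-reflexive t≈) t⊑u) (⊑-trans v⊑v′ (𝒞.≥-reflexive b≈))) ,
         U-of-stage {suc k} (Pi aₖ (tₖ ↦[ k ] bₖ) , ≈-refl 𝒞 , Pi-IsType k (Pi-↦ k taₖ tuₖ tbₖ))
         where open Staged st

    Π-∶ : ⟦ Π A B ⟧ ρ ∶ᴰ 𝐔
    Π-∶ x (inj₁ x≈⊥) = 𝒞.⊥ , U𝒞 , 𝒟.mem-⊥ (⟦ Π A B ⟧ ρ) , U∈𝐔 , 𝒞.≤-reflexive x≈⊥ , ⊥∶U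
    Π-∶ x (inj₂ (m , a , s , x≈ , ∈a , ∈s)) = go (cover {⟦ Π A B ⟧ ρ} {𝐔} 𝐔∶𝐔 (List.map single steps) (map⁺ (All.tabulate covered)))
      where
      -- The pair `⊥ ↦ ⊥` keeps the list nonempty: the upper bound is then a Π with domain above `a`
      -- even when the presentation of `s` is empty.
      steps = (CUSL.⊥ (C m) , CUSL.⊥ (C m)) ∷ presentation s
      single : ∣ C m ∣ × ∣ C m ∣ → ∣ 𝒞 ∣
      single (u , v) = suc m , Pi a (u ↦[ m ] v)
      G = λ u → body A B ρ (↓ u)
      covered : ∀ {p} → p ∈ steps → Covered (⟦ Π A B ⟧ ρ) 𝐔 (single p)
      covered (here refl) = Π-cover m ∈a (𝒟.down (G (m , CUSL.⊥ (C m))) (Emb.bottom (inj m)) (𝒟.mem-⊥ (G (m , CUSL.⊥ (C m)))))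
      covered (there ∈p)  = Π-cover m ∈a (pres-∈ m s G ∈s ∈p)
      go : _ → Covered (⟦ Π A B ⟧ ρ) 𝐔 x
      go (z , c , inj₁ z≈⊥ , _ , _ , _ , us⊑z) =
        ⊥-elim (Pi⋢⊥ {f = CUSL.⊥ (C m) ↦[ m ] CUSL.⊥ (C m)} (⊑-trans (us⊑z (here refl)) (𝒞.≤-reflexive z≈⊥)))
      go (z , c , ∈z@(inj₂ (k , b , g , z≈ , _ , _)) , ∈c , _ , tz , us⊑z) = z , c , ∈z , ∈c , x⊑z , tz
        where
        beneath : ∀ {u v} → (u , v) ∈ steps → (m , a) ⊑ (k , b) × onC m (u ↦[ m ] v) ≤ₛ onC k g
        beneath {u} {v} ∈p = Pi⊑-inv {f = u ↦[ m ] v} {g} (⊑-trans (us⊑z (∈-map⁺ single ∈p)) (𝒞.≤-reflexive z≈))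
        x⊑z : x ⊑ z
        x⊑z = ⊑-trans (𝒞.≤-reflexive x≈) (⊑-trans (Pi⊑Pi {f = s} {g} (proj₁ (beneath (here refl)))
          (pointwise λ w → mapStep-lub dec-𝒞 (inj m) (inj m) s w λ {u} {v} ∈p u⊑w → ⊑-trans
            (mapStep-ub dec-𝒞 (inj m) (inj m) (u ↦[ m ] v) w (here refl) u⊑w) (at (proj₂ (beneath (there ∈p))) w)))
          (𝒞.≥-reflexive z≈))

    module _ {M : Tm (suc n)} (tM : ∀ ω → ω ∶ᴰ α → ⟦ M ⟧ (ρ ▸ ω) ∶ᴰ ⟦ B ⟧ (ρ ▸ ω)) where
      -- As for `Π-cover`, but the value and its type have to be attained at the same `t`.
      ƛ-cover : ∀ m {u v : ∣ C m ∣} → (m , v) ∈ᴰ body A M ρ (↓ (m , u)) →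
                Covered (⟦ ƛ A M ⟧ ρ) (⟦ Π A B ⟧ ρ) (suc m , lam (u ↦[ m ] v))
      ƛ-cover m {u} {v} ∈v =
        let ω = 𝐩 α (↓ (m , u))
            tω = 𝐩-∶ {α} (↓ (m , u)) tA
            (v′ , b₀ , ∈v′ , ∈b₀ , v⊑v′ , tv₀) = tM ω tω _ ∈v
            (b , ∈b , b₀⊑b , tb) = type-above {⟦ B ⟧ (ρ ▸ ω)} (tB ω tω) ∈b₀
            (t , c , ∈t , ∈c , tc , th , ∈v″ , ∈b′) = approx₂ M B {ρ} {α} {ω} tA tω ∈v′ ∈b
        in build c ∈c t v′ b th ∈v″ ∈b′ (at⊆ (𝐩⊆ {α} {↓ (m , u)}) t ∈t) v⊑v′ (staged th tc (∶𝒞-mono tv₀ b₀⊑b tb) tb)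
        where
        build : ∀ c → c ∈ᴰ α → ∀ t v′ b → t ∶𝒞 c → v′ ∈ᴰ ⟦ M ⟧ (ρ ▸ ↓ t) → b ∈ᴰ ⟦ B ⟧ (ρ ▸ ↓ t) → t ⊑ (m , u) → (m , v) ⊑ v′ →
                Staged t c v′ b → Covered (⟦ ƛ A M ⟧ ρ) (⟦ Π A B ⟧ ρ) (suc m , lam (u ↦[ m ] v))
        build c ∈c t v′ b th ∈v″ ∈b′ t⊑u v⊑v′ st =
           (suc k , lam (tₖ ↦[ k ] vₖ)) , (suc k , Pi aₖ (tₖ ↦[ k ] bₖ)) ,
           (k , (tₖ ↦[ k ] vₖ) , ≈-refl 𝒞 , ↦-∈ {M} t≈ ∈c th (∈-resp (⟦ M ⟧ (ρ ▸ ↓ t)) (≈-sym 𝒞 v≈) ∈v″)) ,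
           inj₂ (k , aₖ , (tₖ ↦[ k ] bₖ) , ≈-refl 𝒞 , ∈-resp α (≈-sym 𝒞 a≈) ∈c ,
             ↦-∈ {B} t≈ ∈c th (∈-resp (⟦ B ⟧ (ρ ▸ ↓ t)) (≈-sym 𝒞 b≈) ∈b′)) ,
           lam⊑lam {f = u ↦[ m ] v} {tₖ ↦[ k ] vₖ}
             (↦-≤ₛ (⊑-trans (𝒞.≤-reflexive t≈) t⊑u) (⊑-trans v⊑v′ (𝒞.≥-reflexive v≈))) ,
           (suc k , lam (tₖ ↦[ k ] vₖ) , Pi aₖ (tₖ ↦[ k ] bₖ) , ≈-refl 𝒞 , ≈-refl 𝒞 , lam-↦ k taₖ tuₖ tvₖ tbₖ)
           where open Staged st

      ƛ-∶ : ⟦ ƛ A M ⟧ ρ ∶ᴰ ⟦ Π A B ⟧ ρ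
      ƛ-∶ x (m , s , x≈ , ∈s) =
        let (z , c , ∈z , ∈c , _ , tz , us⊑z) = cover {⟦ ƛ A M ⟧ ρ} {⟦ Π A B ⟧ ρ} Π-∶ (List.map single (presentation s))
              (map⁺ (All.tabulate λ ∈p → ƛ-cover m (pres-∈ m s (λ u → body A M ρ (↓ u)) ∈s ∈p)))
        in z , c , ∈z , ∈c , ⊑-trans (𝒞.≤-reflexive x≈) (lam-below m s z λ {u} {v} ∈p → ⊑-trans
             (mapStep-ub dec-𝒞 (inj m) (inj m) (u ↦[ m ] v) (m , u) (here refl) ⊑-refl)
             (app-mono {suc m , lam (u ↦[ m ] v)} {z} (us⊑z (∈-map⁺ single ∈p)) ⊑-refl)) , tz
        where
        single : ∣ C m ∣ × ∣ C m ∣ → ∣ 𝒞 ∣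
        single (u , v) = suc m , lam (u ↦[ m ] v)

  record Π-Above (B : Tm (suc n)) (ω : 𝒟) (b u c : ∣ 𝒞 ∣) : Set where
    field
      {m}  : ℕ
      {a}  : ∣ C m ∣
      {s}  : Step (C m) (C m)
      {z t} : ∣ 𝒞 ∣
      ∈z   : z ∈ᴰ ⟦ Π A B ⟧ ρ
      tz   : z ∶𝒞 U𝒞
      z≈   : z 𝒞.≈ (suc m , Pi a s)
      c⊑z  : c ⊑ z
      ∈a   : (m , a) ∈ᴰ α
      ∈s   : ∀ w → onC m s · w ∈ᴰ body A B ρ (↓ w)
      ∈t   : t ∈ᴰ ω
      u⊑t  : u ⊑ t
      t∶   : t ∶𝒞 (m , a)
      b⊑   : b ⊑ onC m s · t

  -- `b` is attained at some argument, while `u` and `c` come from an unrelated application. A typed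
  -- `t` in `ω` both attains `b` and dominates `u`; the Π with step `t ↦ b` is joined with `c`
  -- inside the ideal `⟦ Π A B ⟧ ρ`, and the join is enlarged to a type.
  Π-above : ∀ {B ω b u c} → ⟦ Π A B ⟧ ρ ∶ᴰ 𝐔 → ω ∶ᴰ α → b ∈ᴰ ⟦ B ⟧ (ρ ▸ ω) → u ∈ᴰ ω → c ∈ᴰ ⟦ Π A B ⟧ ρ →
            Π-Above B ω b u c
  Π-above {B} {ω} {b} {u} {c} tΠ tω ∈b ∈u ∈c =
    let (t₁ , a₁ , ∈t₁ , ∈a₁ , ta₁ , th₁ , ∈b′ , _) = approx₂ B B {ρ} {α} {ω} tA tω ∈b ∈b
        (t , a , ∈t , ∈a , ta , th , us⊑t) = cover {ω} {α} tA (t₁ ∷ u ∷ []) (tω _ ∈t₁ ∷ tω _ ∈u ∷ [])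
        (k , bₖ , tₖ , aₖ , b≈ , t≈ , a≈) = common-stage b t a
    in build k t≈ a≈ b≈ ∈t (us⊑t (there (here refl))) ∈a th
         (at⊆ (⟦⟧-mono B (▸-mono {ρ = ρ} (λ _ → ⊆-refl) (incl λ _ x⊑ → ⊑-trans x⊑ (us⊑t (here refl))))) b ∈b′)
    where
    go : ∀ {t a} k {tₖ aₖ bₖ z} → (k , tₖ) 𝒞.≈ t → (k , aₖ) 𝒞.≈ a → (k , bₖ) 𝒞.≈ b → t ∈ᴰ ω → u ⊑ t → t ∶𝒞 a →
         z ∈ᴰ ⟦ Π A B ⟧ ρ → (suc k , Pi aₖ (tₖ ↦[ k ] bₖ)) ⊑ z → c ⊑ z → z ∶𝒞 U𝒞 → Π-Above B ω b u c
    go k {tₖ} {bₖ = bₖ} _ _ _ _ _ _ (inj₁ z≈⊥) x⊑z _ _ =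
      ⊥-elim (Pi⋢⊥ {f = tₖ ↦[ k ] bₖ} (⊑-trans x⊑z (𝒞.≤-reflexive z≈⊥)))
    go {t} k {tₖ} {bₖ = bₖ} t≈ a≈ b≈ ∈t u⊑t th ∈z@(inj₂ (m , a , s , z≈ , ∈a , ∈s)) x⊑z c⊑z tz = record
      { ∈z = ∈z ; tz = tz ; z≈ = z≈ ; c⊑z = c⊑z ; ∈a = ∈a ; ∈s = ∈s ; ∈t = ∈t ; u⊑t = u⊑t
      ; t∶ = ∶𝒞-mono th (⊑-trans (𝒞.≥-reflexive a≈) (proj₁ Pi⊑)) (domain-∶U {s = s} (⊥∶𝒞 tz) tz z≈)
      ; b⊑ = ⊑-trans (𝒞.≥-reflexive b≈) (⊑-trans
          (mapStep-ub dec-𝒞 (inj k) (inj k) (tₖ ↦[ k ] bₖ) t (here refl) (𝒞.≤-reflexive t≈)) (at (proj₂ Pi⊑) t))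
      }
      where
      Pi⊑ = Pi⊑-inv {f = tₖ ↦[ k ] bₖ} {s} (⊑-trans x⊑z (𝒞.≤-reflexive z≈))
    build : ∀ {t a} k {tₖ aₖ bₖ} → (k , tₖ) 𝒞.≈ t → (k , aₖ) 𝒞.≈ a → (k , bₖ) 𝒞.≈ b → t ∈ᴰ ω → u ⊑ t → a ∈ᴰ α → t ∶𝒞 a →
            b ∈ᴰ ⟦ B ⟧ (ρ ▸ ↓ t) → Π-Above B ω b u c
    build {t} {a} k {tₖ} {aₖ} {bₖ} t≈ a≈ b≈ ∈t u⊑t ∈a th ∈b =
      let f = tₖ ↦[ k ] bₖ
          (z , z∨ , ∈z) = 𝒟.closed (⟦ Π A B ⟧ ρ) {suc k , Pi aₖ f} {c}
            (inj₂ (k , aₖ , f , ≈-refl 𝒞 , ∈-resp α (≈-sym 𝒞 a≈) ∈a ,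
              ↦-∈ {B} t≈ ∈a th (∈-resp (⟦ B ⟧ (ρ ▸ ↓ t)) (≈-sym 𝒞 b≈) ∈b))) ∈c
          (y , ∈y , z⊑y , ty) = type-above {⟦ Π A B ⟧ ρ} {z} tΠ ∈z
      in go {t} {a} k t≈ a≈ b≈ ∈t u⊑t th ∈y (⊑-trans (proj₁ z∨) z⊑y) (⊑-trans (proj₁ (proj₂ z∨)) z⊑y) ty

  cod-∶ : ∀ {B ω} → ⟦ Π A B ⟧ ρ ∶ᴰ 𝐔 → ω ∶ᴰ α → ⟦ B ⟧ (ρ ▸ ω) ∶ᴰ 𝐔
  cod-∶ {B} {ω} tΠ tω b ∈b = covered (Π-above {B} {ω} {b} {𝒞.⊥} {𝒞.⊥} tΠ tω ∈b (𝒟.mem-⊥ ω) (𝒟.mem-⊥ (⟦ Π A B ⟧ ρ)))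
    where
    covered : Π-Above B ω b 𝒞.⊥ 𝒞.⊥ → Covered (⟦ B ⟧ (ρ ▸ ω)) 𝐔 b
    covered P = onC m s · t , U𝒞 ,
      at⊆ (⟦⟧-mono B (▸-mono (λ _ → ⊆-refl) (⊆-trans (𝐩⊆ {α}) (↓-⊆ ω ∈t)))) (onC m s · t) (∈s t) , U∈𝐔 , b⊑ ,
      onC-∶U {s = s} (⊥∶𝒞 tz) tz z≈ t
      where open Π-Above P

  app-sound : ∀ {B M N} → ⟦ Π A B ⟧ ρ ∶ᴰ 𝐔 → ⟦ M ⟧ ρ ∶ᴰ ⟦ Π A B ⟧ ρ → ⟦ N ⟧ ρ ∶ᴰ α → ⟦ M ∙ N ⟧ ρ ∶ᴰ ⟦ B ⟧ (ρ ▸ ⟦ N ⟧ ρ)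
  app-sound {B} {M} {N} tΠ tM tN w (v , u , ∈v , ∈u , w≈) =
    let (v′ , c , ∈v′ , ∈c , v⊑v′ , tv) = tM v ∈v
        (z , ∈z , c⊑z , tz)            = type-above {⟦ Π A B ⟧ ρ} {c} tΠ ∈c
    in go v′ ∈v′ (⊑-trans (𝒞.≤-reflexive w≈) (app-mono v⊑v′ ⊑-refl)) ∈z (∶𝒞-mono tv c⊑z tz) tz
    where
    go : ∀ v′ {z} → v′ ∈ᴰ ⟦ M ⟧ ρ → w ⊑ app v′ u → z ∈ᴰ ⟦ Π A B ⟧ ρ → v′ ∶𝒞 z → z ∶𝒞 U𝒞 →
         Covered (⟦ M ∙ N ⟧ ρ) (⟦ B ⟧ (ρ ▸ ⟦ N ⟧ ρ)) w
    go v′ ∈v′ w⊑ (inj₁ z≈⊥) tv tz =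
      let v⊑⊥ = ∶⊥-inv (𝒞.≤-reflexive z≈⊥) tv in
      𝒞.⊥ , 𝒞.⊥ , 𝒟.mem-⊥ (⟦ M ∙ N ⟧ ρ) , 𝒟.mem-⊥ (⟦ B ⟧ (ρ ▸ ⟦ N ⟧ ρ)) ,
      ⊑-trans w⊑ (app-mono v⊑⊥ ⊑-refl) , ⊥∶𝒞 ⊥∶U
    go v′ ∈v′ w⊑ (inj₂ (m , a , s , z≈ , _ , ∈s)) tv tz =
      app v′ u , onC m s · u , (v′ , u , ∈v′ , ∈u , ≈-refl 𝒞) ,
      at⊆ (⟦⟧-mono B (▸-mono (λ _ → ⊆-refl) (⊆-trans (𝐩⊆ {α}) (↓-⊆ (⟦ N ⟧ ρ) ∈u)))) _ (∈s u) ,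
      w⊑ , app-∶ {s = s} tv tz z≈ u

  -- For the converse inclusion, `w` is attained at a typed compact `t` in `⟦ N ⟧ ρ`, and the λ of
  -- `t ↦ w` applied to `t` gives `w` back. Typedness of `t` lets it survive the projection at the
  -- binder.
  β-sound : ∀ {M N} → ⟦ N ⟧ ρ ∶ᴰ α → ⟦ ƛ A M ∙ N ⟧ ρ ≐ᴰ ⟦ M ⟧ (ρ ▸ ⟦ N ⟧ ρ)
  β-sound {M} {N} tN = incl reduce , incl expand
    where
    reduce : ∀ w → w ∈ᴰ ⟦ ƛ A M ∙ N ⟧ ρ → w ∈ᴰ ⟦ M ⟧ (ρ ▸ ⟦ N ⟧ ρ)
    reduce w (v , u , (n , s , v≈ , ∈s) , ∈u , w≈) = 𝒟.down (⟦ M ⟧ (ρ ▸ ⟦ N ⟧ ρ))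
      (⊑-trans (𝒞.≤-reflexive w≈) (app-mono (𝒞.≤-reflexive v≈) ⊑-refl))
      (at⊆ (⟦⟧-mono M (▸-mono (λ _ → ⊆-refl) (⊆-trans (𝐩⊆ {α}) (↓-⊆ (⟦ N ⟧ ρ) ∈u)))) _ (∈s u))
    expand : ∀ w → w ∈ᴰ ⟦ M ⟧ (ρ ▸ ⟦ N ⟧ ρ) → w ∈ᴰ ⟦ ƛ A M ∙ N ⟧ ρ
    expand w ∈w =
      let (t , a , ∈t , ∈a , ta , th , ∈w′ , _) = approx₂ M M {ρ} {α} {⟦ N ⟧ ρ} tA tN ∈w ∈w
          (k , wₖ , tₖ , _ , w≈ , t≈ , _) = common-stage w t t
          f = tₖ ↦[ k ] wₖ
      in 𝒟.down (⟦ ƛ A M ∙ N ⟧ ρ)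
           (⊑-trans (𝒞.≥-reflexive w≈) (mapStep-ub dec-𝒞 (inj k) (inj k) f t (here refl) (𝒞.≤-reflexive t≈)))
           ((suc k , lam f) , t ,
            (k , f , ≈-refl 𝒞 , ↦-∈ {M} t≈ ∈a th (∈-resp (⟦ M ⟧ (ρ ▸ ↓ t)) (≈-sym 𝒞 w≈) ∈w′)) , ∈t , ≈-refl 𝒞)

  -- The hypothesis reaches only typed arguments. The domain condition lowers each argument in the
  -- presentation of a typed element of `⟦ M ⟧ ρ` to a typed one with the same value; there the
  -- hypothesis yields an element of `⟦ N ⟧ ρ`. These are joined, and `lam-below` compares.
  η-sound : ∀ {B M N} → ⟦ Π A B ⟧ ρ ∶ᴰ 𝐔 → ⟦ M ⟧ ρ ∶ᴰ ⟦ Π A B ⟧ ρ →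
            (∀ ω → ω ∶ᴰ α → 𝐚𝐩𝐩 (⟦ M ⟧ ρ) ω ⊆ 𝐚𝐩𝐩 (⟦ N ⟧ ρ) ω) → ⟦ M ⟧ ρ ⊆ ⟦ N ⟧ ρ
  η-sound {B} {M} {N} tΠ tM h = incl λ v ∈v →
    let (v′ , c , ∈v′ , ∈c , v⊑v′ , tv) = tM v ∈v
        (z , ∈z , c⊑z , tz)            = type-above {⟦ Π A B ⟧ ρ} {c} tΠ ∈c
    in 𝒟.down (⟦ N ⟧ ρ) v⊑v′ (go v′ ∈v′ ∈z (∶𝒞-mono tv c⊑z tz) tz)
    where
    go : ∀ v {z} → v ∈ᴰ ⟦ M ⟧ ρ → z ∈ᴰ ⟦ Π A B ⟧ ρ → v ∶𝒞 z → z ∶𝒞 U𝒞 → v ∈ᴰ ⟦ N ⟧ ρ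
    go v ∈v (inj₁ z≈⊥) tv tz = 𝒟.down (⟦ N ⟧ ρ) (∶⊥-inv (𝒞.≤-reflexive z≈⊥) tv) (𝒟.mem-⊥ (⟦ N ⟧ ρ))
    go v ∈v (inj₂ (m , a , s , z≈ , ∈a , _)) tv tz = finish tvₗ
      where
      open FunStage (fun-stage {s = s} tv tz z≈ 0) renaming (z≈ to zₗ≈; tv to tvₗ; tz to tzₗ)
      module V = LamType values-typed
      b∈ : (l , bₗ) ∈ᴰ α
      b∈ = 𝒟.down α (proj₁ (Pi⊑-inv {f = gₗ} {s} (𝒞.≤-reflexive (≈-trans 𝒞 zₗ≈ z≈)))) ∈a
      beneath : ∀ u → ∃[ y ] y ∈ᴰ ⟦ N ⟧ ρ × (l , appₙ l vₗ u) ⊑ app y (l , u)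
      beneath u =
        let (t , t≤u , th , eq) = V.dom-fun u
            (y , x , ∈y , x⊑t , w≈) = at⊆ (h (↓ (l , t)) (↓-∶ {α} b∈ (l , t , bₗ , ≈-refl 𝒞 , ≈-refl 𝒞 , th)))
              (app v (l , t)) (v , (l , t) , ∈v , ⊑-refl , ≈-refl 𝒞)
        in y , ∈y , ⊑-trans (up (CUSL.≤-reflexive (C l) eq))
             (⊑-trans (𝒞.≥-reflexive (app-appₙ l vₗ t)) (⊑-trans (app-mono (𝒞.≤-reflexive v≈) ⊑-refl)
             (⊑-trans (𝒞.≤-reflexive w≈) (app-mono {y} ⊑-refl (⊑-trans x⊑t (up t≤u))))))
      joint : (ps : List (∣ C l ∣ × ∣ C l ∣)) →
              All (λ { (u , w) → ∃[ y ] y ∈ᴰ ⟦ N ⟧ ρ × (l , w) ⊑ app y (l , u) }) ps →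
              ∃[ y ] y ∈ᴰ ⟦ N ⟧ ρ × (∀ {u w} → (u , w) ∈ ps → (l , w) ⊑ app y (l , u))
      joint [] [] = 𝒞.⊥ , 𝒟.mem-⊥ (⟦ N ⟧ ρ) , λ ()
      joint (_ ∷ ps) ((y , ∈y , ⊑y) ∷ all) =
        let (x , ∈x , ⊑x) = joint ps all
            (r , r∨ , ∈r) = 𝒟.closed (⟦ N ⟧ ρ) ∈y ∈x
        in r , ∈r , λ { (here refl) → ⊑-trans ⊑y (app-mono {y} {r} (proj₁ r∨) ⊑-refl)
                      ; (there ∈p) → ⊑-trans (⊑x ∈p) (app-mono {x} {r} (proj₁ (proj₂ r∨)) ⊑-refl) }
      finish : HasType (suc l) vₗ (Pi bₗ gₗ) → v ∈ᴰ ⟦ N ⟧ ρ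
      finish (rule-Bot p _) = 𝒟.down (⟦ N ⟧ ρ)
        (⊑-trans (𝒞.≥-reflexive v≈) (⊑-trans (up (lhs≤rhs p)) (Emb.bottom (inj (suc l))))) (𝒟.mem-⊥ (⟦ N ⟧ ρ))
      finish (rule-Univ _ (() Sym., _))
      finish (rule-Pi _ (() Sym., _) _ _ _)
      finish (rule-Lam {f = f} p _ _ _ _) =
        let (y , ∈y , ⊑y) = joint (presentation f) (All.tabulate λ { {u , w} ∈p →
              let (y , ∈y , ⊑y) = beneath u in
              y , ∈y , ⊑-trans (up (CUSL.≤-trans (C l) (proj₁ (Step.isStep f u) (u , ∈p , CUSL.≤-refl (C l)))
                (CUSL.≥-reflexive (C l) (appₙ-≈ l p u)))) ⊑y })
        in 𝒟.down (⟦ N ⟧ ρ) (⊑-trans (𝒞.≥-reflexive v≈) (⊑-trans (up (lhs≤rhs p)) (lam-below l f y ⊑y))) ∈y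

mutual
  -- Typing depends on the equations through conversion, and the equations on typing, since equal
  -- bodies are compared only at projected, hence typed, arguments.
  sound-ty : ∀ {n} {Γ : Ctx n} {ρ M A} → Γ ⊢ M ∶ A → Fits ρ Γ → ⟦ A ⟧ ρ ∶ᴰ 𝐔 × ⟦ M ⟧ ρ ∶ᴰ ⟦ A ⟧ ρ
  sound-ty (ty-var x _) ft = ft x
  sound-ty (ty-univ _) ft = 𝐔∶𝐔 , 𝐔∶𝐔
  sound-ty {ρ = ρ} (ty-Π {A = A} {B} a b) ft =
    let tA = proj₂ (sound-ty a ft) in
    𝐔∶𝐔 , Π-∶ {A = A} tA {B} λ ω tω → proj₂ (sound-ty b (Fits-▸ {A = A} ft tA tω))
  sound-ty {ρ = ρ} (ty-ƛ {A = A} {B} {M} a p) ft =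
    let tA = proj₂ (sound-ty a ft)
        IH = λ ω tω → sound-ty p (Fits-▸ {A = A} {ω} ft tA tω)
    in Π-∶ {A = A} tA {B} (λ ω tω → proj₁ (IH ω tω)) ,
       ƛ-∶ {A = A} tA {B} (λ ω tω → proj₁ (IH ω tω)) {M} (λ ω tω → proj₂ (IH ω tω))
  sound-ty {ρ = ρ} (ty-app {A = A} {B} {M} {N} p q) ft =
    let (tΠ , tM) = sound-ty p ft
        (tA , tN) = sound-ty q ft
        e = ≐ᴰ-sym (⟦[]⟧ B N ρ)
    in ∶ᴰ-resp e (≐ᴰ-refl {𝐔}) (cod-∶ {A = A} tA {B} tΠ tN) ,
       ∶ᴰ-resp (≐ᴰ-refl {⟦ M ∙ N ⟧ ρ}) e (app-sound {A = A} tA {B} {M} {N} tΠ tM tN)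
  sound-ty {ρ = ρ} (ty-conv {M = M} p e) ft =
    let (_ , tA , A≐B) = sound-eq e ft in
    ∶ᴰ-resp A≐B (≐ᴰ-refl {𝐔}) tA , ∶ᴰ-resp (≐ᴰ-refl {⟦ M ⟧ ρ}) A≐B (proj₂ (sound-ty p ft))

  sound-eq : ∀ {n} {Γ : Ctx n} {ρ M N A} → Γ ⊢ M ≐ N ∶ A → Fits ρ Γ →
             ⟦ A ⟧ ρ ∶ᴰ 𝐔 × ⟦ M ⟧ ρ ∶ᴰ ⟦ A ⟧ ρ × ⟦ M ⟧ ρ ≐ᴰ ⟦ N ⟧ ρ
  sound-eq (eq-refl p) ft = let (tA , tM) = sound-ty p ft in tA , tM , ≐ᴰ-refl
  sound-eq {ρ = ρ} {A = A} (eq-sym e) ft = let (tA , tM , M≐N) = sound-eq e ft in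
    tA , ∶ᴰ-resp M≐N (≐ᴰ-refl {⟦ A ⟧ ρ}) tM , ≐ᴰ-sym M≐N
  sound-eq (eq-trans e e′) ft = let (tA , tM , M≐N) = sound-eq e ft in
    tA , tM , ≐ᴰ-trans M≐N (proj₂ (proj₂ (sound-eq e′ ft)))
  sound-eq {ρ = ρ} {M = M} (eq-conv e e′) ft =
    let (_ , tM , M≐N) = sound-eq e ft
        (_ , tA , A≐B) = sound-eq e′ ft
    in ∶ᴰ-resp A≐B (≐ᴰ-refl {𝐔}) tA , ∶ᴰ-resp (≐ᴰ-refl {⟦ M ⟧ ρ}) A≐B tM , M≐N
  sound-eq {ρ = ρ} (eq-Π {A = A} {A′} {B} {B′} e e′) ft =
    let (_ , tA , A≐) = sound-eq e ft
        IH = λ ω tω → sound-eq e′ (Fits-▸ {A = A} {ω} ft tA tω)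
        B≐ : ∀ u → body A B ρ (↓ u) ≐ᴰ body A′ B′ ρ (↓ u)
        -- First `B` is exchanged for `B′` at the projected argument, then the projection along `A`
        -- for the one along `A′`.
        B≐ u = ≐ᴰ-trans (proj₂ (proj₂ (IH _ (𝐩-∶ {⟦ A ⟧ ρ} (↓ u) tA)))) (⟦⟧-cong B′ (▸-cong (λ x → ≐ᴰ-refl) (𝐩-congˡ (↓ u) A≐)))
    in 𝐔∶𝐔 , Π-∶ {A = A} tA {B} (λ ω tω → proj₁ (proj₂ (IH ω tω))) ,
       𝚷-mono {g = body A B ρ} {body A′ B′ ρ} (proj₁ A≐) (λ u → proj₁ (B≐ u)) ,
       𝚷-mono {g = body A′ B′ ρ} {body A B ρ} (proj₂ A≐) (λ u → proj₂ (B≐ u))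
  sound-eq {ρ = ρ} (eq-ƛ {A = A} {A′} {B} {M} {M′} e e′) ft =
    let (_ , tA , A≐) = sound-eq e ft
        IH = λ ω tω → sound-eq e′ (Fits-▸ {A = A} {ω} ft tA tω)
        M≐ : ∀ u → body A M ρ (↓ u) ≐ᴰ body A′ M′ ρ (↓ u)
        M≐ u = ≐ᴰ-trans (proj₂ (proj₂ (IH _ (𝐩-∶ {⟦ A ⟧ ρ} (↓ u) tA)))) (⟦⟧-cong M′ (▸-cong (λ x → ≐ᴰ-refl) (𝐩-congˡ (↓ u) A≐)))
    in Π-∶ {A = A} tA {B} (λ ω tω → proj₁ (IH ω tω)) ,
       ƛ-∶ {A = A} tA {B} (λ ω tω → proj₁ (IH ω tω)) {M} (λ ω tω → proj₁ (proj₂ (IH ω tω))) ,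
       𝛌-mono {body A M ρ} {body A′ M′ ρ} (λ u → proj₁ (M≐ u)) , 𝛌-mono {body A′ M′ ρ} {body A M ρ} (λ u → proj₂ (M≐ u))
  sound-eq {ρ = ρ} (eq-app {A = A} {B} {M} {M′} {N} {N′} p q) ft =
    let (tΠ , tM , M≐) = sound-eq p ft
        (tA , tN , N≐) = sound-eq q ft
        e = ≐ᴰ-sym (⟦[]⟧ B N ρ)
    in ∶ᴰ-resp e (≐ᴰ-refl {𝐔}) (cod-∶ {A = A} tA {B} tΠ tN) ,
       ∶ᴰ-resp (≐ᴰ-refl {⟦ M ∙ N ⟧ ρ}) e (app-sound {A = A} tA {B} {M} {N} tΠ tM tN) ,
       𝐚𝐩𝐩-mono (proj₁ M≐) (proj₁ N≐) , 𝐚𝐩𝐩-mono (proj₂ M≐) (proj₂ N≐)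
  sound-eq {ρ = ρ} (eq-β {A = A} {B} {M} {N} a p q) ft =
    let (tA , tN) = sound-ty q ft
        (tB , tM) = sound-ty p (Fits-▸ {A = A} ft tA tN)
        e = ≐ᴰ-sym (⟦[]⟧ B N ρ)
        b = β-sound {A = A} tA {M} {N} tN
    in ∶ᴰ-resp e (≐ᴰ-refl {𝐔}) tB , ∶ᴰ-resp (≐ᴰ-sym b) e tM , ≐ᴰ-trans b (≐ᴰ-sym (⟦[]⟧ M N ρ))
  sound-eq {ρ = ρ} (eq-η {A = A} {B} {M} {N} p q e) ft =
    let (tΠ , tM) = sound-ty p ft
        tN = proj₂ (sound-ty q ft)
        tA = dom-∶ {A = A} {B} tΠ
        wM = λ ω → ⟦weaken⟧ M ρ ω
        wN = λ ω → ⟦weaken⟧ N ρ ω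
        IH = λ ω tω → proj₂ (proj₂ (sound-eq e (Fits-▸ {A = A} {ω} ft tA tω)))
    in tΠ , tM ,
       η-sound {A = A} tA {B} {M} {N} tΠ tM (λ ω tω → ⊆-trans (𝐚𝐩𝐩-mono (proj₂ (wM ω)) ⊆-refl)
         (⊆-trans (proj₁ (IH ω tω)) (𝐚𝐩𝐩-mono (proj₁ (wN ω)) ⊆-refl))) ,
       η-sound {A = A} tA {B} {N} {M} tΠ tN (λ ω tω → ⊆-trans (𝐚𝐩𝐩-mono (proj₂ (wN ω)) ⊆-refl)
         (⊆-trans (proj₂ (IH ω tω)) (𝐚𝐩𝐩-mono (proj₁ (wM ω)) ⊆-refl)))

-- The logical relation at a stage

module _ {m} {Γ : Ctx m} where
  private
    reflexive : ∀ {M N A} → Γ ⊢ M ≐ N ∶ A → Γ ⊢ M ≐ M ∶ A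
    reflexive e = eq-refl (Presup.lhs (presup e))

  EqTy-⊥ : ∀ n {T T′ a} → a ≤[ C n ] CUSL.⊥ (C n) → EqTy n Γ T T′ a
  EqTy-⊥ zero    _          = tt
  EqTy-⊥ (suc n) bot≤       = tt
  EqTy-⊥ (suc n) (lam⊥≤ f≤) = f≤

  EqTm-⊥ᵗ : ∀ n {M M′ T u a} → a ≤[ C n ] CUSL.⊥ (C n) → EqTm n Γ M M′ T u a
  EqTm-⊥ᵗ zero    _          = tt
  EqTm-⊥ᵗ (suc n) bot≤       = tt
  EqTm-⊥ᵗ (suc n) (lam⊥≤ f≤) = f≤

  -- The first of the three relations in the clause for Π gives this at once, so that it is at hand
  -- for conversion, which is proved together with symmetry.
  EqTy-reflˡ : ∀ n {T T′} a → EqTy n Γ T T′ a → EqTy n Γ T T a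
  EqTy-reflˡ zero    _       _ = tt
  EqTy-reflˡ (suc n) bot     _ = tt
  EqTy-reflˡ (suc n) (lam f) h = h
  EqTy-reflˡ (suc n) U (r , _) = r , r
  EqTy-reflˡ (suc n) (Pi a b) (A , B , _ , _ , r , _ , eA , eB , hA , hB) =
    A , B , A , B , r , r , reflexive eA , eq-refl (Presup.lhs (presup eB)) , EqTy-reflˡ n a hA ,
    λ M M′ v tv e h → let (p , _) = hB M M′ v tv e h in p , p , p

  EqTm-reflˡ : ∀ n {M M′ T u} a → EqTm n Γ M M′ T u a → EqTm n Γ M M T u a
  EqTm-reflˡ zero    _       _ = tt
  EqTm-reflˡ (suc n) bot     _ = tt
  EqTm-reflˡ (suc n) (lam f) h = h
  EqTm-reflˡ (suc n) {u = u} U (r , h) = r , EqTy-reflˡ (suc n) u h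
  EqTm-reflˡ (suc n) (Pi a b) (t , A , B , r , h) =
    t , A , B , r , λ N N′ w tw e hN → let (p , _) = h N N′ w tw e hN in p , p , p

  Π-det : ∀ {T A A′ B B′} → Γ ⊢ T ⇝* Π A B ∶ 𝒰 → Γ ⊢ T ⇝* Π A′ B′ ∶ 𝒰 → Π A B ≡ Π A′ B′
  Π-det (r , _) (r′ , _) = ↝*-Π-det r r′

  -- By `Π-det` the Π hidden in the relation is the given one.
  EqTm-fun : ∀ n {M M′ T u a b A B} → Γ ⊢ T ⇝* Π A B ∶ 𝒰 → EqTm (suc n) Γ M M′ T u (Pi a b) →
             ∀ N N′ w → HasType n w a → Γ ⊢ N ≐ N′ ∶ A → EqTm n Γ N N′ A w a →
             EqTm n Γ (M  ∙ N) (M  ∙ N′) (B [ N ]) (appₙ n u w) (b · w) ×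
             EqTm n Γ (M′ ∙ N) (M′ ∙ N′) (B [ N ]) (appₙ n u w) (b · w) ×
             EqTm n Γ (M  ∙ N) (M′ ∙ N′) (B [ N ]) (appₙ n u w) (b · w)
  EqTm-fun n r (_ , _ , _ , r′ , h) with Π-det r r′
  ... | refl = h

  mutual
    -- After reversal the arguments are related at `A′` and have to be converted back to `A`;
    -- reversed applications live at `B [ N′ ]` and have to be converted to `B [ N ]`. Hence the
    -- recursion through conversion.
    EqTy-sym : ∀ n {T T′} a → EqTy n Γ T T′ a → EqTy n Γ T′ T a
    EqTy-sym zero    _       _ = tt
    EqTy-sym (suc n) bot     _ = tt
    EqTy-sym (suc n) (lam f) h = h
    EqTy-sym (suc n) U (r , r′) = r′ , r
    EqTy-sym (suc n) (Pi a b) (A , B , A′ , B′ , r , r′ , eA , eB , hA , hB) =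
      A′ , B′ , A , B , r′ , r , eq-sym eA ,
      ctx-conv-eq (Presup.lhs (presup eA)) (Presup.rhs (presup eA)) eA (eq-sym eB) , EqTy-sym n a hA ,
      λ M M′ v tv e h →
        let e′ = eq-conv e (eq-sym eA)
            h′ = EqTm-conv n a (EqTy-sym n a hA) h
            (p , q , _)  = hB M M′ v tv e′ h′
            (_ , _ , s)  = hB M′ M v tv (eq-sym e′) (EqTm-sym n a h′)
        in q , p , EqTy-sym n (b · v) s

    EqTm-conv : ∀ n {M M′ T T′ u} a → EqTy n Γ T T′ a → EqTm n Γ M M′ T u a → EqTm n Γ M M′ T′ u a
    EqTm-conv zero    _       _ _ = tt
    EqTm-conv (suc n) bot     _ _ = tt
    EqTm-conv (suc n) (lam f) h _ = h
    EqTm-conv (suc n) U (_ , r′) (_ , h) = r′ , h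
    EqTm-conv (suc n) {u = u} (Pi a b) t@(A , B , A′ , B′ , r , r′ , eA , eB , hA , hB) hM =
      EqTy-reflˡ (suc n) (Pi a b) (EqTy-sym (suc n) (Pi a b) t) , A′ , B′ , r′ , λ N N′ w tw e hN →
        let e′  = eq-conv e (eq-sym eA)
            hN′ = EqTm-conv n a (EqTy-sym n a hA) hN
            (p , q , s) = EqTm-fun n {u = u} {a} {b} r hM N N′ w tw e′ hN′
            (_ , _ , c) = hB N N w tw (reflexive e′) (EqTm-reflˡ n a hN′)
        in EqTm-conv n (b · w) c p , EqTm-conv n (b · w) c q , EqTm-conv n (b · w) c s

    EqTm-sym : ∀ n {M M′ T u} a → EqTm n Γ M M′ T u a → EqTm n Γ M′ M T u a
    EqTm-sym zero    _       _ = tt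
    EqTm-sym (suc n) bot     _ = tt
    EqTm-sym (suc n) (lam f) h = h
    EqTm-sym (suc n) {u = u} U (r , h) = r , EqTy-sym (suc n) u h
    EqTm-sym (suc n) {u = u} (Pi a b) hM@(t@(A , B , _ , _ , r , _ , _ , _ , _ , hB) , _) =
      t , A , B , r , λ N N′ w tw e hN →
        let h   = EqTm-fun n {u = u} {a} {b} r hM
            hN′ = EqTm-sym n a hN
            (p , q , _) = h N N′ w tw e hN
            (_ , _ , s) = h N′ N w tw (eq-sym e) hN′
            (c , _)     = hB N′ N w tw (eq-sym e) hN′
        in q , p , EqTm-conv n (b · w) c (EqTm-sym n (b · w) s)

  EqTy-trans : ∀ n {T T′ T″} a → EqTy n Γ T T′ a → EqTy n Γ T′ T″ a → EqTy n Γ T T″ a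
  EqTy-trans zero    _       _ _ = tt
  EqTy-trans (suc n) bot     _ _ = tt
  EqTy-trans (suc n) (lam f) h _ = h
  EqTy-trans (suc n) U (r , _) (_ , r″) = r , r″
  EqTy-trans (suc n) (Pi a b) (A , B , A′ , B′ , r , r′ , eA , eB , hA , hB) (_ , _ , A″ , B″ , r₁ , r″ , eA′ , eB′ , hA′ , hB′)
    with Π-det r′ r₁
  ... | refl = A , B , A″ , B″ , r , r″ , eq-trans eA eA′ ,
      eq-trans eB (ctx-conv-eq (Presup.rhs (presup eA)) (Presup.lhs (presup eA)) (eq-sym eA) eB′) ,
      EqTy-trans n a hA hA′ , λ M M′ v tv e h →
        let (p , _ , _)  = hB M M′ v tv e h
            -- The first relation is used on the diagonal, so that the middle term is `B′ [ M ]` in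
            -- both.
            (_ , _ , s)  = hB M M v tv (reflexive e) (EqTm-reflˡ n a h)
            (_ , q , s′) = hB′ M M′ v tv (eq-conv e eA) (EqTm-conv n a hA h)
        in p , q , EqTy-trans n (b · v) s s′

  EqTm-trans : ∀ n {M M′ M″ T u} a → EqTm n Γ M M′ T u a → EqTm n Γ M′ M″ T u a → EqTm n Γ M M″ T u a
  EqTm-trans zero    _       _ _ = tt
  EqTm-trans (suc n) bot     _ _ = tt
  EqTm-trans (suc n) (lam f) h _ = h
  EqTm-trans (suc n) {u = u} U (r , h) (_ , h′) = r , EqTy-trans (suc n) u h h′
  EqTm-trans (suc n) {u = u} (Pi a b) (t , A , B , r , h) hM′ = t , A , B , r , λ N N′ w tw e hN →
      let h′ = EqTm-fun n {u = u} {a} {b} r hM′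
          (p , _ , _)  = h N N′ w tw e hN
          (_ , _ , s)  = h N N w tw (reflexive e) (EqTm-reflˡ n a hN)
          (_ , q , s′) = h′ N N′ w tw e hN
      in p , q , EqTm-trans n (b · w) s s′

  EqTm-⊥ : ∀ n {M M′ T u} a → IsType n a → u ≤[ C n ] CUSL.⊥ (C n) → EqTy n Γ T T a → EqTm n Γ M M′ T u a
  EqTm-⊥ (suc n) bot     _ _ _ = tt
  EqTm-⊥ (suc n) (lam f) t _ _ = IsType-lam n t
  EqTm-⊥ (suc n) U _ u≤ (r , _) = r , EqTy-⊥ (suc n) u≤
  EqTm-⊥ (suc n) {u = u} (Pi a b) t u≤ tT@(A , B , _ , _ , r , _ , _ , _ , _ , hB) = tT , A , B , r , λ N N′ w tw e hN →
    let (c , _) = hB N N w tw (reflexive e) (EqTm-reflˡ n a hN)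
        bottom : ∀ {P Q} → EqTm n Γ P Q (B [ N ]) (appₙ n u w) (b · w)
        bottom = EqTm-⊥ n (b · w) (PiType.codomain (IsType-Pi n t) w) (appₙ-mono n {w = w} u≤ (CUSL.≤-refl (C n))) c
    in bottom , bottom , bottom

  mutual
    -- Lowering a Π raises its arguments, raising a Π lowers them, and lowering a term at `U` lowers
    -- a type; so the three are proved together.
    EqTy-↓ : ∀ n {T T′ a a′} → IsType n a → IsType n a′ → a′ ≤[ C n ] a → EqTy n Γ T T′ a → EqTy n Γ T T′ a′
    EqTy-↓ (suc n) _ _ bot≤ _ = tt
    EqTy-↓ (suc n) _ _ (lam⊥≤ f≤) _ = f≤
    EqTy-↓ (suc n) _ _ U≤U h = h
    EqTy-↓ (suc n) _ t′ (lam≤lam _) _ = IsType-lam n t′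
    EqTy-↓ (suc n) t t′ (Pi≤Pi {a} {a′} {b} {b′} a≤ b≤) (A , B , A′ , B′ , r , r′ , eA , eB , hA , hB) =
      A , B , A′ , B′ , r , r′ , eA , eB , EqTy-↓ n P.domain P′.domain a≤ hA , λ M M′ v tv e h →
        let (p , q , s) = hB M M′ v (HasType-mono n tv a≤ P.domain) e
              (EqTm-↑ n P′.domain P.domain tv a≤ (EqTy-reflˡ n a′ hA) h)
            lower : ∀ {T T′} → EqTy n Γ T T′ (b′ · v) → EqTy n Γ T T′ (b · v)
            lower = EqTy-↓ n (P.codomain v) (P′.codomain v) (at b≤ v)
        in lower p , lower q , lower s
      where
      module P  = PiType (IsType-Pi n t)
      module P′ = PiType (IsType-Pi n t′)

    EqTm-↑ : ∀ n {M M′ T u a b} → IsType n a → IsType n b → HasType n u a → a ≤[ C n ] b →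
             EqTy n Γ T T b → EqTm n Γ M M′ T u a → EqTm n Γ M M′ T u b
    EqTm-↑ (suc n) {b = b} _ tb tu bot≤ hT _ = EqTm-⊥ (suc n) b tb (HasType-⊥ n tu) hT
    EqTm-↑ (suc n) {b = b} _ tb tu (lam⊥≤ f≤) hT _ = EqTm-⊥ (suc n) b tb (⊥-inv (suc n) (lam⊥≤ f≤) tu) hT
    EqTm-↑ (suc n) _ tb _ (lam≤lam _) _ _ = IsType-lam n tb
    EqTm-↑ (suc n) _ _ _ U≤U _ h = h
    EqTm-↑ (suc n) {u = u} t t′ tu (Pi≤Pi {a} {a′} {b} {b′} a≤ b≤) tT@(A , B , _ , _ , r , _ , _ , _ , _ , hB) hM =
      tT , A , B , r , λ N N′ w tw e hN →
        -- `w` is typed in the larger domain; the domain condition on `u` supplies `v` below it,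
        -- typed in the smaller domain, with the same value.
        let (v , v≤w , tv , eq) = V.dom-fun w
            (p , q , s) = EqTm-fun n {u = u} {a} {b} r hM N N′ v tv e (EqTm-↓ n P′.domain P.domain a≤ tw tv v≤w hN)
            (c , _)     = hB N N w tw (reflexive e) (EqTm-reflˡ n a′ hN)
            b≤b′ = CUSL.≤-trans (C n) (monotone b v≤w) (at b≤ w)
            t₁   = HasType-mono n (V.img-typed v) b≤b′ (P′.codomain w)
            t₂   = HasType-resp n (≈-sym (C n) eq) (≈-refl (C n)) t₁
            raised : ∀ {P Q} → EqTm n Γ P Q (B [ N ]) (appₙ n u v) (b · v) → EqTm n Γ P Q (B [ N ]) (appₙ n u w) (b′ · w)
            -- The values of `u` at `v` and `w` are equal, so `EqTm-↓` at a fixed type acts as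
            -- transport along `≈`.
            raised h = EqTm-↓ n (P′.codomain w) (P′.codomain w) (CUSL.≤-refl (C n)) t₁ t₂ (CUSL.≤-reflexive (C n) eq)
              (EqTm-↑ n (P.codomain v) (P′.codomain w) (V.img-typed v) b≤b′ c h)
        in raised p , raised q , raised s
      where
      module P  = PiType (IsType-Pi n t)
      module P′ = PiType (IsType-Pi n t′)
      module V  = LamType (HasType-Pi n (IsType-Pi n t) tu)

    EqTm-↓ : ∀ n {M M′ T u u′ a b} → IsType n a → IsType n b → b ≤[ C n ] a → HasType n u a → HasType n u′ b →
             u′ ≤[ C n ] u → EqTm n Γ M M′ T u a → EqTm n Γ M M′ T u′ b
    EqTm-↓ (suc n) _ _ bot≤ _ _ _ _ = tt
    EqTm-↓ (suc n) _ _ (lam⊥≤ f≤) _ _ _ _ = f≤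
    EqTm-↓ (suc n) _ tb (lam≤lam _) _ _ _ _ = IsType-lam n tb
    EqTm-↓ (suc n) _ _ U≤U tu tu′ u′≤u (r , h) = r , EqTy-↓ (suc n) tu tu′ u′≤u h
    EqTm-↓ (suc n) {u = u} {u′} t t′ (Pi≤Pi {a′} {a} {b′} {b} a≤ b≤) tu tu′ u′≤u
      hM@(tT@(A , B , _ , _ , r , _ , _ , _ , hA , _) , _) =
      EqTy-↓ (suc n) t t′ (Pi≤Pi a≤ b≤) tT , A , B , r , λ N N′ w tw e hN →
        let (p , q , s) = EqTm-fun n {u = u} {a} {b} r hM N N′ w (HasType-mono n tw a≤ P.domain) e
              (EqTm-↑ n P′.domain P.domain tw a≤ (EqTy-reflˡ n a hA) hN)
            lower : ∀ {P Q} → EqTm n Γ P Q (B [ N ]) (appₙ n u w) (b · w) → EqTm n Γ P Q (B [ N ]) (appₙ n u′ w) (b′ · w)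
            lower = EqTm-↓ n (P.codomain w) (P′.codomain w) (at b≤ w) (V.img-typed w) (V′.img-typed w)
              (appₙ-mono n u′≤u (CUSL.≤-refl (C n)))
        in lower p , lower q , lower s
      where
      module P  = PiType (IsType-Pi n t)
      module P′ = PiType (IsType-Pi n t′)
      module V  = LamType (HasType-Pi n (IsType-Pi n t) tu)
      module V′ = LamType (HasType-Pi n (IsType-Pi n t′) tu′)

  ⇝*-trans : ∀ {M M′ M″ A} → Γ ⊢ M ⇝* M′ ∶ A → Γ ⊢ M′ ⇝* M″ ∶ A → Γ ⊢ M ⇝* M″ ∶ A
  ⇝*-trans (r , e) (r′ , e′) = r ◅◅ r′ , eq-trans e e′

  ⇝*-conv : ∀ {M M′ A A′} → Γ ⊢ M ⇝* M′ ∶ A → Γ ⊢ A ≐ A′ ∶ 𝒰 → Γ ⊢ M ⇝* M′ ∶ A′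
  ⇝*-conv (r , e) e′ = r , eq-conv e e′

  EqTy-expand : ∀ n {S S′ T T′} a → Γ ⊢ S ⇝* T ∶ 𝒰 → Γ ⊢ S′ ⇝* T′ ∶ 𝒰 → EqTy n Γ T T′ a → EqTy n Γ S S′ a
  EqTy-expand zero    _       _ _ _ = tt
  EqTy-expand (suc n) bot     _ _ _ = tt
  EqTy-expand (suc n) (lam f) _ _ h = h
  EqTy-expand (suc n) U s s′ (r , r′) = ⇝*-trans s r , ⇝*-trans s′ r′
  EqTy-expand (suc n) (Pi a b) s s′ (A , B , A′ , B′ , r , r′ , h) = A , B , A′ , B′ , ⇝*-trans s r , ⇝*-trans s′ r′ , h

  -- A head step of `M` is one of `M ∙ L`, so expansion passes to applications; the one to `L′` is
  -- typed at `B [ L′ ]` and converted to `B [ L ]`.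
  EqTm-expand : ∀ n {M M′ N N′ T u} a → Γ ⊢ M ⇝* N ∶ T → Γ ⊢ M′ ⇝* N′ ∶ T → EqTm n Γ N N′ T u a → EqTm n Γ M M′ T u a
  EqTm-expand zero    _       _ _ _ = tt
  EqTm-expand (suc n) bot     _ _ _ = tt
  EqTm-expand (suc n) (lam f) _ _ h = h
  EqTm-expand (suc n) {u = u} U s s′ (r , h) = r , EqTy-expand (suc n) u (⇝*-conv s (proj₂ r)) (⇝*-conv s′ (proj₂ r)) h
  EqTm-expand (suc n) {M} {M′} {N} {N′} {T} (Pi a b) s s′ (tT , A , B , r , h) = tT , A , B , r , λ L L′ w tw e hL →
      let (p , q , o) = h L L′ w tw e hL in
      EqTm-expand n (b · w) (argˡ s e) (argʳ s e) p ,
      EqTm-expand n (b · w) (argˡ s′ e) (argʳ s′ e) q ,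
      EqTm-expand n (b · w) (argˡ s e) (argʳ s′ e) o
    where
    argˡ : ∀ {P Q L L′} → Γ ⊢ P ⇝* Q ∶ T → Γ ⊢ L ≐ L′ ∶ A → Γ ⊢ P ∙ L ⇝* Q ∙ L ∶ B [ L ]
    argˡ s e = ∙-↝* (proj₁ s) , eq-app (eq-conv (proj₂ s) (proj₂ r)) (reflexive e)
    argʳ : ∀ {P Q L L′} → Γ ⊢ P ⇝* Q ∶ T → Γ ⊢ L ≐ L′ ∶ A → Γ ⊢ P ∙ L′ ⇝* Q ∙ L′ ∶ B [ L ]
    argʳ s e = ⇝*-conv (argˡ s (eq-sym e))
      (eq-sym ([]-eq (proj₂ (Π-inv (Presup.rhs (presup (proj₂ r))))) (Presup.lhs (presup e)) (Presup.rhs (presup e)) e))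

-- Independence of the stage

fnₙ : ∀ n → ∣ C (suc n) ∣ → Step (C n) (C n)
fnₙ n bot      = ⊥ₛ
fnₙ n U        = ⊥ₛ
fnₙ n (lam f)  = f
fnₙ n (Pi _ _) = ⊥ₛ

-- Presents application maps as step functions, to which `restrict₂` and `constant-above` apply.
appₙ-fnₙ : ∀ n u w → appₙ n u w ≡ fnₙ n u · w
appₙ-fnₙ n bot w      = refl
appₙ-fnₙ n U w        = refl
appₙ-fnₙ n (lam f) w  = refl
appₙ-fnₙ n (Pi _ _) w = refl

module _ {n k} (p : n ℕ.≤ k) where
  private
    module Li = Emb (lift p)
    module Cₙ = CUSL (C n)

  fnₙ-lift : ∀ u w → appₙ k (Emb.to (lift (s≤s p)) u) w ≈[ C k ] liftₛ p (fnₙ n u) · w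
  fnₙ-lift bot w      = ≈-sym (C k) (≤⊥⇒≈ (C k) (mapStep-lub (dec-C k) (lift p) (lift p) ⊥ₛ w λ ()))
  fnₙ-lift U w        = ≈-sym (C k) (≤⊥⇒≈ (C k) (mapStep-lub (dec-C k) (lift p) (lift p) ⊥ₛ w λ ()))
  fnₙ-lift (lam f) w  = ≈-refl (C k)
  fnₙ-lift (Pi _ _) w = ≈-sym (C k) (≤⊥⇒≈ (C k) (mapStep-lub (dec-C k) (lift p) (lift p) ⊥ₛ w λ ()))

  appₙ-lift : ∀ u w → appₙ k (Emb.to (lift (s≤s p)) u) (Li.to w) ≈[ C k ] Li.to (appₙ n u w)
  appₙ-lift u w rewrite appₙ-fnₙ n u w = ≈-trans (C k) (fnₙ-lift u (Li.to w)) (liftₛ-lift p (fnₙ n u) w)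

  -- The larger stage has more arguments, but the domain conditions reduce each of them to a typed
  -- argument of the smaller stage: this makes the logical relation independent of the stage.
  fun-restrict : ∀ {u a b} → PiType n a b → LamType n (appₙ n u) a b → ∀ w →
    ∃[ v ] Li.to v ≤[ C k ] w × HasType n v a ×
      liftₛ p b · w ≈[ C k ] Li.to (b · v) × appₙ k (Emb.to (lift (s≤s p)) u) w ≈[ C k ] Li.to (appₙ n u v)
  fun-restrict {u} {a} {b} P V w =
    let (s , s≤w , e₁ , e₂)      = restrict₂ p (fnₙ n u) b w
        (v₁ , v₁≤s , t₁ , d₁)    = LamType.dom-fun V s
        (v₂ , v₂≤s , t₂ , d₂)    = PiType.dom-cod P s
        (v , v∨)                 = Cₙ.sup v₁≤s v₂≤s
        v≤s                      = proj₂ (proj₂ v∨) v₁≤s v₂≤s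
        d₁′ = subst (λ x → x ≈[ C n ] fnₙ n u · v₁) (appₙ-fnₙ n u s)
                (subst (λ x → appₙ n u s ≈[ C n ] x) (appₙ-fnₙ n u v₁) d₁)
        f₁ = constant-above (fnₙ n u) (proj₁ v∨) v≤s d₁′
        f₂ = constant-above b (proj₁ (proj₂ v∨)) v≤s d₂
    in v , CUSL.≤-trans (C k) (Li.mono v≤s) s≤w , HasType-sup n t₁ t₂ v∨ ,
       ≈-trans (C k) e₂ (Emb-≈ (lift p) f₂) ,
       ≈-trans (C k) (fnₙ-lift u w) (≈-trans (C k) e₁ (Emb-≈ (lift p)
         (subst (λ x → fnₙ n u · s ≈[ C n ] x) (sym (appₙ-fnₙ n u v)) f₁)))

module _ {m} {Γ : Ctx m} where
  mutual
    -- Arguments travel the other way: raising a Π drops them and dropping a Π raises them, whence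
    -- the mutual recursion.
    EqTy-raise : ∀ {n k} (p : n ℕ.≤ k) {T T′} a → IsType n a → EqTy n Γ T T′ a → EqTy k Γ T T′ (Emb.to (lift p) a)
    EqTy-raise {suc n} {suc k} (s≤s p) bot _ _ = tt
    EqTy-raise {suc n} {suc k} (s≤s p) (lam f) t _ = IsType-lam k (IsType-lift (s≤s p) t)
    EqTy-raise {suc n} {suc k} (s≤s p) U _ h = h
    EqTy-raise {suc n} {suc k} (s≤s p) (Pi a b) t (A , B , A′ , B′ , r , r′ , eA , eB , hA , hB) =
      A , B , A′ , B′ , r , r′ , eA , eB , EqTy-raise p a P.domain hA , λ M M′ v tv e h →
        let (v₀ , v₀≤v , tv₀ , eq) = dom-restrict p {f = b} P.dom-cod v
            (x , y , z) = hB M M′ v₀ tv₀ e (EqTm-drop p a P.domain tv₀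
              (EqTm-↓ k Q.domain Q.domain (CUSL.≤-refl (C k)) tv (HasType-lift p tv₀) v₀≤v h))
            raised : ∀ {T T′} → EqTy n Γ T T′ (b · v₀) → EqTy k Γ T T′ (liftₛ p b · v)
            raised h = EqTy-↓ k (IsType-lift p (P.codomain v₀)) (Q.codomain v) (CUSL.≤-reflexive (C k) eq)
              (EqTy-raise p (b · v₀) (P.codomain v₀) h)
        in raised x , raised y , raised z
      where
      module P = PiType (IsType-Pi n t)
      module Q = PiType (IsType-Pi k (IsType-lift (s≤s p) t))

    EqTy-drop : ∀ {n k} (p : n ℕ.≤ k) {T T′} a → IsType n a → EqTy k Γ T T′ (Emb.to (lift p) a) → EqTy n Γ T T′ a
    EqTy-drop {suc n} {suc k} (s≤s p) bot _ _ = tt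
    EqTy-drop {suc n} {suc k} (s≤s p) (lam f) t _ = IsType-lam n t
    EqTy-drop {suc n} {suc k} (s≤s p) U _ h = h
    EqTy-drop {suc n} {suc k} (s≤s p) (Pi a b) t (A , B , A′ , B′ , r , r′ , eA , eB , hA , hB) =
      A , B , A′ , B′ , r , r′ , eA , eB , EqTy-drop p a P.domain hA , λ M M′ v tv e h →
        let (x , y , z) = hB M M′ (Li.to v) (HasType-lift p tv) e (EqTm-raise p a P.domain tv h)
            dropped : ∀ {T T′} → EqTy k Γ T T′ (liftₛ p b · Li.to v) → EqTy n Γ T T′ (b · v)
            dropped h = EqTy-drop p (b · v) (P.codomain v)
              (EqTy-↓ k (Q.codomain (Li.to v)) (IsType-lift p (P.codomain v)) (CUSL.≥-reflexive (C k) (liftₛ-lift p b v)) h)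
        in dropped x , dropped y , dropped z
      where
      module Li = Emb (lift p)
      module P = PiType (IsType-Pi n t)
      module Q = PiType (IsType-Pi k (IsType-lift (s≤s p) t))

    EqTm-raise : ∀ {n k} (p : n ℕ.≤ k) {M M′ T u} a → IsType n a → HasType n u a → EqTm n Γ M M′ T u a →
                 EqTm k Γ M M′ T (Emb.to (lift p) u) (Emb.to (lift p) a)
    EqTm-raise {suc n} {suc k} (s≤s p) bot _ _ _ = tt
    EqTm-raise {suc n} {suc k} (s≤s p) (lam f) t _ _ = IsType-lam k (IsType-lift (s≤s p) t)
    EqTm-raise {suc n} {suc k} (s≤s p) {u = u} U _ tu (r , h) = r , EqTy-raise (s≤s p) u tu h
    EqTm-raise {suc n} {suc k} (s≤s p) {u = u} (Pi a b) t tu (tT , A , B , r , h) =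
      EqTy-raise (s≤s p) (Pi a b) t tT , A , B , r , λ N N′ w tw e hN →
        let (v , v≤w , tv , eb , eu) = fun-restrict p {u} tΠ (HasType-Pi n tΠ tu) w
            (x , y , z) = h N N′ v tv e (EqTm-drop p a P.domain tv
              (EqTm-↓ k Q.domain Q.domain (CUSL.≤-refl (C k)) tw (HasType-lift p tv) v≤w hN))
            raised : ∀ {M M′ T} → EqTm n Γ M M′ T (appₙ n u v) (b · v) →
                     EqTm k Γ M M′ T (appₙ k (Emb.to (lift (s≤s p)) u) w) (liftₛ p b · w)
            raised h = EqTm-↓ k (IsType-lift p (P.codomain v)) (Q.codomain w) (CUSL.≤-reflexive (C k) eb)
              (HasType-lift p (V.img-typed v)) (W.img-typed w) (CUSL.≤-reflexive (C k) eu)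
              (EqTm-raise p (b · v) (P.codomain v) (V.img-typed v) h)
        in raised x , raised y , raised z
      where
      tΠ = IsType-Pi n t
      module P = PiType tΠ
      module Q = PiType (IsType-Pi k (IsType-lift (s≤s p) t))
      module V = LamType (HasType-Pi n tΠ tu)
      module W = LamType (HasType-Pi k (IsType-Pi k (IsType-lift (s≤s p) t)) (HasType-lift (s≤s p) tu))

    EqTm-drop : ∀ {n k} (p : n ℕ.≤ k) {M M′ T u} a → IsType n a → HasType n u a →
                EqTm k Γ M M′ T (Emb.to (lift p) u) (Emb.to (lift p) a) → EqTm n Γ M M′ T u a
    EqTm-drop {suc n} {suc k} (s≤s p) bot _ _ _ = tt
    EqTm-drop {suc n} {suc k} (s≤s p) (lam f) t _ _ = IsType-lam n t
    EqTm-drop {suc n} {suc k} (s≤s p) {u = u} U _ tu (r , h) = r , EqTy-drop (s≤s p) u tu h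
    EqTm-drop {suc n} {suc k} (s≤s p) {u = u} (Pi a b) t tu (tT , A , B , r , h) =
      EqTy-drop (s≤s p) (Pi a b) t tT , A , B , r , λ N N′ w tw e hN →
        let (x , y , z) = h N N′ (Li.to w) (HasType-lift p tw) e (EqTm-raise p a P.domain tw hN)
            dropped : ∀ {M M′ T} → EqTm k Γ M M′ T (appₙ k (Emb.to (lift (s≤s p)) u) (Li.to w)) (liftₛ p b · Li.to w) →
                      EqTm n Γ M M′ T (appₙ n u w) (b · w)
            dropped h = EqTm-drop p (b · w) (P.codomain w) (V.img-typed w)
              (EqTm-↓ k (Q.codomain (Li.to w)) (IsType-lift p (P.codomain w)) (CUSL.≥-reflexive (C k) (liftₛ-lift p b w))
                (W.img-typed (Li.to w)) (HasType-lift p (V.img-typed w)) (CUSL.≥-reflexive (C k) (appₙ-lift p u w)) h)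
        in dropped x , dropped y , dropped z
      where
      tΠ = IsType-Pi n t
      module Li = Emb (lift p)
      module P = PiType tΠ
      module Q = PiType (IsType-Pi k (IsType-lift (s≤s p) t))
      module V = LamType (HasType-Pi n tΠ tu)
      module W = LamType (HasType-Pi k (IsType-Pi k (IsType-lift (s≤s p) t)) (HasType-lift (s≤s p) tu))

-- The logical relation on 𝒞

module _ {m} {Γ : Ctx m} where
  -- The stage in `⊩` is existential. Passing through a common later stage gives the relation at
  -- every representative and at every smaller type.
  ⊩-at-↓ : ∀ {A A′ a n bₙ} → Γ ⊩ A ≐ A′ ▷ a → (n , bₙ) ⊑ a → IsType n bₙ → EqTy n Γ A A′ bₙ
  ⊩-at-↓ {n = n} {bₙ} (k , aₖ , a≈ , ta , h) b⊑a tb = EqTy-drop q bₙ tb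
    (EqTy-↓ (k ⊔ n) (IsType-lift p ta) (IsType-lift q tb)
      (reflect-stage (⊑-trans (lift-⊒ q bₙ) (⊑-trans b⊑a (𝒞.≥-reflexive (raise-≈ p a≈)))))
      (EqTy-raise p aₖ ta h))
    where
    p = ℕₚ.m≤m⊔n k n
    q = ℕₚ.m≤n⊔m k n

  ⊩-at : ∀ {A A′ a n aₙ} → Γ ⊩ A ≐ A′ ▷ a → (n , aₙ) 𝒞.≈ a → IsType n aₙ → EqTy n Γ A A′ aₙ
  ⊩-at h a≈ = ⊩-at-↓ h (𝒞.≤-reflexive a≈)

  ⊩∶-at-↓ : ∀ {M M′ A u a n vₙ bₙ} → Γ ⊩ M ≐ M′ ∶ A ▷ u ∶ a → (n , bₙ) ⊑ a → IsType n bₙ →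
            (n , vₙ) ⊑ u → HasType n vₙ bₙ → EqTm n Γ M M′ A vₙ bₙ
  ⊩∶-at-↓ {n = n} {vₙ} {bₙ} (_ , k , uₖ , aₖ , u≈ , a≈ , ta , tu , h) b⊑a tb v⊑u tv = EqTm-drop q bₙ tb tv
    (EqTm-↓ (k ⊔ n) (IsType-lift p ta) (IsType-lift q tb)
      (reflect-stage (⊑-trans (lift-⊒ q bₙ) (⊑-trans b⊑a (𝒞.≥-reflexive (raise-≈ p a≈)))))
      (HasType-lift p tu) (HasType-lift q tv)
      (reflect-stage (⊑-trans (lift-⊒ q vₙ) (⊑-trans v⊑u (𝒞.≥-reflexive (raise-≈ p u≈)))))
      (EqTm-raise p aₖ ta tu h))
    where
    p = ℕₚ.m≤m⊔n k n
    q = ℕₚ.m≤n⊔m k n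

  ⊩∶-at : ∀ {M M′ A u a n uₙ aₙ} → Γ ⊩ M ≐ M′ ∶ A ▷ u ∶ a → (n , uₙ) 𝒞.≈ u → (n , aₙ) 𝒞.≈ a →
          IsType n aₙ → HasType n uₙ aₙ → EqTm n Γ M M′ A uₙ aₙ
  ⊩∶-at h u≈ a≈ ta tu = ⊩∶-at-↓ h (𝒞.≤-reflexive a≈) ta (𝒞.≤-reflexive u≈) tu

  ⊩-↓ : ∀ {A A′ a b} → Γ ⊩ A ≐ A′ ▷ a → b ⊑ a → b ∶𝒞 U𝒞 → Γ ⊩ A ≐ A′ ▷ b
  ⊩-↓ h b⊑a tb = let (n , bₙ , b≈ , t) = stage-of tb in
    n , bₙ , b≈ , t , ⊩-at-↓ h (⊑-trans (𝒞.≤-reflexive b≈) b⊑a) t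

  typed-stage : ∀ {u a} → u ∶𝒞 a → a ∶𝒞 U𝒞 →
                ∃[ n ] ∃[ uₙ ] ∃[ aₙ ] (n , uₙ) 𝒞.≈ u × (n , aₙ) 𝒞.≈ a × IsType n aₙ × HasType n uₙ aₙ
  typed-stage {u} {a} (n , tu) ta = go (raise (ℕₚ.m≤m⊔n n _) tu) (raiseᵀ (ℕₚ.m≤n⊔m n _) (proj₂ (stage-of ta)))
    where
    go : ∀ {k} → HasTypeAt k u a → IsTypeAt k a → _
    go {k} (uₖ , aₖ , u≈ , a≈ , tu) ta = k , uₖ , aₖ , u≈ , a≈ , at-repᵀ ta a≈ , tu

  ⊩∶-↓ : ∀ {M M′ A u u′ a b} → Γ ⊩ M ≐ M′ ∶ A ▷ u ∶ a → b ⊑ a → b ∶𝒞 U𝒞 → u′ ⊑ u → u′ ∶𝒞 b → Γ ⊩ M ≐ M′ ∶ A ▷ u′ ∶ b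
  ⊩∶-↓ h b⊑a tb u′⊑u tu′ = let (n , uₙ , bₙ , u≈ , b≈ , t , t′) = typed-stage tu′ tb in
    proj₁ h , n , uₙ , bₙ , u≈ , b≈ , t , t′ ,
    ⊩∶-at-↓ h (⊑-trans (𝒞.≤-reflexive b≈) b⊑a) t (⊑-trans (𝒞.≤-reflexive u≈) u′⊑u) t′

  ⊩∶-↑ : ∀ {M M′ A u a b} → Γ ⊩ M ≐ M′ ∶ A ▷ u ∶ a → a ⊑ b → Γ ⊩ A ≐ A ▷ b → Γ ⊩ M ≐ M′ ∶ A ▷ u ∶ b
  ⊩∶-↑ (e , k , uₖ , aₖ , u≈ , a≈ , ta , tu , h) a⊑b hA@(n , bₙ , b≈ , tb , _) =
    e , k ⊔ n , _ , _ , raise-≈ p u≈ , raise-≈ q b≈ , IsType-lift q tb ,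
    HasType-mono (k ⊔ n) (HasType-lift p tu) a≤b (IsType-lift q tb) ,
    EqTm-↑ (k ⊔ n) (IsType-lift p ta) (IsType-lift q tb) (HasType-lift p tu) a≤b
      (⊩-at hA (raise-≈ q b≈) (IsType-lift q tb)) (EqTm-raise p aₖ ta tu h)
    where
    p = ℕₚ.m≤m⊔n k n
    q = ℕₚ.m≤n⊔m k n
    a≤b : Emb.to (lift p) aₖ ≤[ C (k ⊔ n) ] Emb.to (lift q) bₙ
    a≤b = reflect-stage (⊑-trans (𝒞.≤-reflexive (raise-≈ p a≈)) (⊑-trans a⊑b (𝒞.≥-reflexive (raise-≈ q b≈))))

  ⊩-sym : ∀ {A A′ a} → Γ ⊩ A ≐ A′ ▷ a → Γ ⊩ A′ ≐ A ▷ a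
  ⊩-sym (n , aₙ , a≈ , t , h) = n , aₙ , a≈ , t , EqTy-sym n aₙ h

  ⊩-trans : ∀ {A A′ A″ a} → Γ ⊩ A ≐ A′ ▷ a → Γ ⊩ A′ ≐ A″ ▷ a → Γ ⊩ A ≐ A″ ▷ a
  ⊩-trans (n , aₙ , a≈ , t , h) h′ = n , aₙ , a≈ , t , EqTy-trans n aₙ h (⊩-at h′ a≈ t)

  ⊩∶-sym : ∀ {M M′ A u a} → Γ ⊩ M ≐ M′ ∶ A ▷ u ∶ a → Γ ⊩ M′ ≐ M ∶ A ▷ u ∶ a
  ⊩∶-sym (e , n , uₙ , aₙ , u≈ , a≈ , t , t′ , h) = eq-sym e , n , uₙ , aₙ , u≈ , a≈ , t , t′ , EqTm-sym n aₙ h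

  ⊩∶-trans : ∀ {M M′ M″ A u a} → Γ ⊩ M ≐ M′ ∶ A ▷ u ∶ a → Γ ⊩ M′ ≐ M″ ∶ A ▷ u ∶ a → Γ ⊩ M ≐ M″ ∶ A ▷ u ∶ a
  ⊩∶-trans (e , n , uₙ , aₙ , u≈ , a≈ , t , t′ , h) h′ =
    eq-trans e (proj₁ h′) , n , uₙ , aₙ , u≈ , a≈ , t , t′ , EqTm-trans n aₙ h (⊩∶-at h′ u≈ a≈ t t′)

  ⊩∶-conv : ∀ {M M′ A A′ u a} → Γ ⊢ A ≐ A′ ∶ 𝒰 → Γ ⊩ A ≐ A′ ▷ a → Γ ⊩ M ≐ M′ ∶ A ▷ u ∶ a → Γ ⊩ M ≐ M′ ∶ A′ ▷ u ∶ a
  ⊩∶-conv eA hA (e , n , uₙ , aₙ , u≈ , a≈ , t , t′ , h) =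
    eq-conv e eA , n , uₙ , aₙ , u≈ , a≈ , t , t′ , EqTm-conv n aₙ (⊩-at hA a≈ t) h

  ⊩∶-expand : ∀ {M M′ N N′ A u a} → Γ ⊢ M ⇝* N ∶ A → Γ ⊢ M′ ⇝* N′ ∶ A → Γ ⊩ N ≐ N′ ∶ A ▷ u ∶ a → Γ ⊩ M ≐ M′ ∶ A ▷ u ∶ a
  ⊩∶-expand r r′ (e , n , uₙ , aₙ , u≈ , a≈ , t , t′ , h) =
    eq-trans (proj₂ r) (eq-trans e (eq-sym (proj₂ r′))) , n , uₙ , aₙ , u≈ , a≈ , t , t′ , EqTm-expand n aₙ r r′ h

  ⊩-⊥ : ∀ {A A′ a} → a ⊑ 𝒞.⊥ → a ∶𝒞 U𝒞 → Γ ⊩ A ≐ A′ ▷ a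
  ⊩-⊥ a⊑⊥ ta = let (n , aₙ , a≈ , t) = stage-of ta in
    n , aₙ , a≈ , t , EqTy-⊥ n (reflect-stage (⊑-trans (𝒞.≤-reflexive a≈) (⊑-trans a⊑⊥ (𝒞.min _))))

  ⊩∶-⊥ : ∀ {M M′ A u a} → Γ ⊢ M ≐ M′ ∶ A → a ⊑ 𝒞.⊥ → a ∶𝒞 U𝒞 → u ∶𝒞 a → Γ ⊩ M ≐ M′ ∶ A ▷ u ∶ a
  ⊩∶-⊥ e a⊑⊥ ta tu = let (n , uₙ , aₙ , u≈ , a≈ , t , t′) = typed-stage tu ta in
    e , n , uₙ , aₙ , u≈ , a≈ , t , t′ ,
    EqTm-⊥ᵗ n (reflect-stage (⊑-trans (𝒞.≤-reflexive a≈) (⊑-trans a⊑⊥ (𝒞.min _))))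

  EqTy-fun : ∀ n {T T′ A B A′ B′ a b} → Γ ⊢ T ⇝* Π A B ∶ 𝒰 → Γ ⊢ T′ ⇝* Π A′ B′ ∶ 𝒰 → EqTy (suc n) Γ T T′ (Pi a b) →
             EqTy n Γ A A′ a ×
             (∀ M M′ v → HasType n v a → Γ ⊢ M ≐ M′ ∶ A → EqTm n Γ M M′ A v a → EqTy n Γ (B [ M ]) (B′ [ M′ ]) (b · v))
  EqTy-fun n r r′ (_ , _ , _ , _ , r₁ , r₁′ , _ , _ , hA , hB) with Π-det r r₁ | Π-det r′ r₁′
  ... | refl | refl = hA , λ M M′ v tv e h → proj₂ (proj₂ (hB M M′ v tv e h))

  -- By symmetry and transitivity only the last of the three relations in the clauses for Π has
  -- to be established.
  EqTy-Π : ∀ n {T T′ A B A′ B′ a b} → Γ ⊢ T ⇝* Π A B ∶ 𝒰 → Γ ⊢ T′ ⇝* Π A′ B′ ∶ 𝒰 →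
           Γ ⊢ A ≐ A′ ∶ 𝒰 → (Γ ▹ A) ⊢ B ≐ B′ ∶ 𝒰 → EqTy n Γ A A′ a →
           (∀ M M′ v → HasType n v a → Γ ⊢ M ≐ M′ ∶ A → EqTm n Γ M M′ A v a → EqTy n Γ (B [ M ]) (B′ [ M′ ]) (b · v)) →
           EqTy (suc n) Γ T T′ (Pi a b)
  EqTy-Π n {A = A} {B} {A′} {B′} {a} {b} r r′ eA eB hA h = A , B , A′ , B′ , r , r′ , eA , eB , hA , λ M M′ v tv e hM →
    let hM′ = EqTm-sym n a hM
        reflˡ = eq-refl (Presup.lhs (presup e))
        reflʳ = eq-refl (Presup.rhs (presup e))
        s  = h M M′ v tv e hM
        s₁ = h M′ M′ v tv reflʳ (EqTm-reflˡ n a hM′)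
        s₂ = h M M v tv reflˡ (EqTm-reflˡ n a hM)
    in EqTy-trans n (b · v) s (EqTy-sym n (b · v) s₁) , EqTy-trans n (b · v) (EqTy-sym n (b · v) s₂) s , s

  EqTm-Π : ∀ n {M M′ T A B u a b} → Γ ⊢ T ⇝* Π A B ∶ 𝒰 → EqTy (suc n) Γ T T (Pi a b) →
           (∀ N N′ w → HasType n w a → Γ ⊢ N ≐ N′ ∶ A → EqTm n Γ N N′ A w a →
             EqTm n Γ (M ∙ N) (M′ ∙ N′) (B [ N ]) (appₙ n u w) (b · w)) →
           EqTm (suc n) Γ M M′ T u (Pi a b)
  EqTm-Π n {A = A} {B} {u} {a} {b} r hT h = hT , A , B , r , λ N N′ w tw e hN →
    let hN′ = EqTm-sym n a hN
        reflˡ = eq-refl (Presup.lhs (presup e))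
        reflʳ = eq-refl (Presup.rhs (presup e))
        c  = proj₂ (EqTy-fun n {a = a} {b} r r hT) N′ N w tw (eq-sym e) hN′
        s  = h N N′ w tw e hN
        s₁ = EqTm-conv n (b · w) c (h N′ N′ w tw reflʳ (EqTm-reflˡ n a hN′))
        s₂ = h N N w tw reflˡ (EqTm-reflˡ n a hN)
    in EqTm-trans n (b · w) s (EqTm-sym n (b · w) s₁) , EqTm-trans n (b · w) (EqTm-sym n (b · w) s₂) s , s

-- Related substitutions and validity

⊩-cast : ∀ {n} {Γ : Ctx n} {A A′ B B′ a} → A ≡ B → A′ ≡ B′ → Γ ⊩ A ≐ A′ ▷ a → Γ ⊩ B ≐ B′ ▷ a
⊩-cast refl refl h = h

⊩∶-cast : ∀ {n} {Γ : Ctx n} {M M′ N N′ A B u a} → M ≡ N → M′ ≡ N′ → A ≡ B → Γ ⊩ M ≐ M′ ∶ A ▷ u ∶ a → Γ ⊩ N ≐ N′ ∶ B ▷ u ∶ a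
⊩∶-cast refl refl refl h = h

sub≐ : ∀ {m n} {Γ : Ctx m} {Δ : Ctx n} {σ σ′ M M′ A} → Γ ⊢ M ≐ M′ ∶ A → Wt≐ Γ Δ σ σ′ → ⊢ Δ → Δ ⊢ M / σ ≐ M′ / σ′ ∶ A / σ
sub≐ e w ⊢Δ = eq-trans (sub-eq (Wt≐.left w) ⊢Δ e) (functional (Presup.rhs (presup e)) w ⊢Δ)

-- Unlike Related, this includes the relatedness of the types of the variables under σ and σ′, so
-- that symmetry needs no induction on Γ.
record RelSub {m n} (Γ : Ctx m) (Δ : Ctx n) (ρ : Env m) (σ σ′ : Sub Tm m n) : Set where
  field
    ⊢Γ   : ⊢ Γ
    ⊢Δ   : ⊢ Δ
    fits : Fits ρ Γ
    wt   : Wt≐ Γ Δ σ σ′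
    ty   : ∀ x a → a ∈ᴰ ⟦ type Γ x ⟧ ρ → a ∶𝒞 U𝒞 → Δ ⊩ type Γ x / σ ≐ type Γ x / σ′ ▷ a
    tm   : ∀ x u a → u ∈ᴰ ρ x → a ∈ᴰ ⟦ type Γ x ⟧ ρ → a ∶𝒞 U𝒞 → u ∶𝒞 a →
           Δ ⊩ lookup σ x ≐ lookup σ′ x ∶ type Γ x / σ ▷ u ∶ a

  cong-ty : ∀ {A} → Γ ⊢ A ∶ 𝒰 → Δ ⊢ A / σ ≐ A / σ′ ∶ 𝒰
  cong-ty a = functional a wt ⊢Δ

module _ {m n} {Γ : Ctx m} {Δ : Ctx n} {ρ : Env m} where
  RelSub-sym : ∀ {σ σ′} → RelSub Γ Δ ρ σ σ′ → RelSub Γ Δ ρ σ′ σ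
  RelSub-sym {σ} {σ′} R = record
    { ⊢Γ = R.⊢Γ ; ⊢Δ = R.⊢Δ ; fits = R.fits
    ; wt = record
      { left = Wt≐.right R.wt ; right = Wt≐.left R.wt
      ; equal = λ x → eq-conv (eq-sym (Wt≐.equal R.wt x)) (R.cong-ty (type-ty R.⊢Γ x)) }
    ; ty = λ x a ∈a ta → ⊩-sym (R.ty x a ∈a ta)
    ; tm = λ x u a ∈u ∈a ta tu → ⊩∶-conv (R.cong-ty (type-ty R.⊢Γ x)) (R.ty x a ∈a ta) (⊩∶-sym (R.tm x u a ∈u ∈a ta tu))
    }
    where module R = RelSub R

  RelSub-reflˡ : ∀ {σ σ′} → RelSub Γ Δ ρ σ σ′ → RelSub Γ Δ ρ σ σ
  RelSub-reflˡ {σ} {σ′} R = record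
    { ⊢Γ = R.⊢Γ ; ⊢Δ = R.⊢Δ ; fits = R.fits
    ; wt = Wt≐-refl (Wt≐.left R.wt)
    ; ty = λ x a ∈a ta → let h = R.ty x a ∈a ta in ⊩-trans h (⊩-sym h)
    ; tm = λ x u a ∈u ∈a ta tu → let h = R.tm x u a ∈u ∈a ta tu in ⊩∶-trans h (⊩∶-sym h)
    }
    where module R = RelSub R

-- The two sides carry different substitutions, as the clauses for Π compare codomains at two
-- related arguments. Membership is stated for the left side; `sound-eq` moves it to the right.
TyValid : ∀ {m} → Ctx m → Tm m → Tm m → Set₁
TyValid {m} Γ A A′ = ∀ {n} {Δ : Ctx n} {ρ : Env m} {σ σ′} → RelSub Γ Δ ρ σ σ′ →
  ∀ a → a ∈ᴰ ⟦ A ⟧ ρ → a ∶𝒞 U𝒞 → Δ ⊩ A / σ ≐ A′ / σ′ ▷ a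

TmValid : ∀ {m} → Ctx m → Tm m → Tm m → Tm m → Set₁
TmValid {m} Γ M M′ A = ∀ {n} {Δ : Ctx n} {ρ : Env m} {σ σ′} → RelSub Γ Δ ρ σ σ′ →
  ∀ u a → u ∈ᴰ ⟦ M ⟧ ρ → a ∈ᴰ ⟦ A ⟧ ρ → a ∶𝒞 U𝒞 → u ∶𝒞 a → Δ ⊩ M / σ ≐ M′ / σ′ ∶ A / σ ▷ u ∶ a

module _ {m} {Γ : Ctx m} where
  TyValid-sym : ∀ {A A′} → Γ ⊢ A ≐ A′ ∶ 𝒰 → TyValid Γ A A′ → TyValid Γ A′ A
  TyValid-sym e V {ρ = ρ} R a ∈a ta =
    ⊩-sym (V (RelSub-sym R) a (at⊆ (proj₂ (proj₂ (proj₂ (sound-eq {ρ = ρ} e (RelSub.fits R))))) a ∈a) ta)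

  -- The first relation is used with `σ` on both sides, so that the middle term is `A′ / σ`.
  TyValid-trans : ∀ {A A′ A″} → Γ ⊢ A ≐ A′ ∶ 𝒰 → TyValid Γ A A′ → TyValid Γ A′ A″ → TyValid Γ A A″
  TyValid-trans e V W {ρ = ρ} R a ∈a ta = ⊩-trans (V (RelSub-reflˡ R) a ∈a ta)
    (W R a (at⊆ (proj₁ (proj₂ (proj₂ (sound-eq {ρ = ρ} e (RelSub.fits R))))) a ∈a) ta)

  TmValid-sym : ∀ {M M′ A} → Γ ⊢ M ≐ M′ ∶ A → TyValid Γ A A → TmValid Γ M M′ A → TmValid Γ M′ M A
  TmValid-sym e VA V {ρ = ρ} R u a ∈u ∈a ta tu =
    ⊩∶-conv (RelSub.cong-ty (RelSub-sym R) (Presup.ty (presup e))) (VA (RelSub-sym R) a ∈a ta)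
      (⊩∶-sym (V (RelSub-sym R) u a (at⊆ (proj₂ (proj₂ (proj₂ (sound-eq {ρ = ρ} e (RelSub.fits R))))) u ∈u) ∈a ta tu))

  TmValid-trans : ∀ {M M′ M″ A} → Γ ⊢ M ≐ M′ ∶ A → TmValid Γ M M′ A → TmValid Γ M′ M″ A → TmValid Γ M M″ A
  TmValid-trans e V W {ρ = ρ} R u a ∈u ∈a ta tu = ⊩∶-trans (V (RelSub-reflˡ R) u a ∈u ∈a ta tu)
    (W R u a (at⊆ (proj₁ (proj₂ (proj₂ (sound-eq {ρ = ρ} e (RelSub.fits R))))) u ∈u) ∈a ta tu)

  TyValid-reflˡ : ∀ {A A′} → Γ ⊢ A ≐ A′ ∶ 𝒰 → TyValid Γ A A′ → TyValid Γ A A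
  TyValid-reflˡ {A} {A′} e V = TyValid-trans {A} {A′} {A} e V (TyValid-sym e V)

  TmValid-reflˡ : ∀ {M M′ A} → Γ ⊢ M ≐ M′ ∶ A → TyValid Γ A A → TmValid Γ M M′ A → TmValid Γ M M A
  TmValid-reflˡ {M} {M′} e VA V = TmValid-trans {M} {M′} {M} e V (TmValid-sym e VA V)

  ⊩-𝒰 : ∀ {n} {Δ : Ctx n} {T a} → ⊢ Δ → Δ ⊢ T ⇝* 𝒰 ∶ 𝒰 → a ∈ᴰ 𝐔 → a ∶𝒞 U𝒞 → Δ ⊩ T ≐ T ▷ a
  ⊩-𝒰 ⊢Δ r (inj₁ a≈⊥) ta = ⊩-⊥ (𝒞.≤-reflexive a≈⊥) ta
  ⊩-𝒰 ⊢Δ r (inj₂ a≈U) ta = 1 , U , ≈-sym 𝒞 a≈U , rule-Univ (≈-refl (C 1)) (≈-refl (C 1)) , r , r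

  𝒰-valid : TyValid Γ 𝒰 𝒰
  𝒰-valid {Δ = Δ} R a ∈a ta = ⊩-𝒰 ⊢Δ (ε , eq-refl (ty-univ ⊢Δ)) ∈a ta
    where open RelSub R using (⊢Δ)

  -- The clause for terms at `U` contains the relation of types. With `code` this exchanges the two
  -- readings of `Γ ⊢ A ≐ A′ ∶ 𝒰`.
  El : ∀ {A A′} → TmValid Γ A A′ 𝒰 → TyValid Γ A A′
  El V R a ∈a ta with stage-of ta
  ... | zero , _ , _ , ()
  ... | suc k , aₖ , a≈ , t =
    suc k , aₖ , a≈ , t ,
    proj₂ (⊩∶-at (V R a U𝒞 ∈a U∈𝐔 U∶U ta) a≈ (raise-≈ {x = U} (s≤s z≤n) (≈-refl 𝒞))
      (rule-Univ (≈-refl (C (suc k))) (≈-refl (C (suc k)))) t)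

  code : ∀ {A A′} → Γ ⊢ A ≐ A′ ∶ 𝒰 → TyValid Γ A A′ → TmValid Γ A A′ 𝒰
  code e V R u a ∈u (inj₁ a≈⊥) ta tu = ⊩∶-⊥ (sub≐ e wt ⊢Δ) (𝒞.≤-reflexive a≈⊥) ta tu
    where open RelSub R
  code {A} {A′} e V {Δ = Δ} {σ = σ} {σ′} R u a ∈u (inj₂ a≈U) ta tu = go (stage-of (∶𝒞-resp (≈-refl 𝒞) a≈U tu))
    where
    open RelSub R
    go : _ → Δ ⊩ A / σ ≐ A′ / σ′ ∶ 𝒰 ▷ u ∶ a
    go (suc k , uₖ , u≈ , t) =
      sub≐ e wt ⊢Δ , suc k , uₖ , U , u≈ , ≈-trans 𝒞 (raise-≈ {x = U} (s≤s z≤n) (≈-refl 𝒞)) (≈-sym 𝒞 a≈U) ,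
      rule-Univ (≈-refl (C (suc k))) (≈-refl (C (suc k))) , t ,
      (ε , eq-refl (ty-univ ⊢Δ)) ,
      ⊩-at (V R u ∈u (∶𝒞-resp (≈-refl 𝒞) a≈U tu)) u≈ t

-- The fundamental theorem

-- A nontrivial `c` in `⟦ Π A B ⟧ ρ` seen at one stage, with an element `u` of it; `u` is taken to
-- be `⊥` where only the type is of interest.
record ΠData {m} (A : Tm m) (B : Tm (suc m)) (ρ : Env m) (u c : ∣ 𝒞 ∣) : Set where
  field
    F : FunStage u c 0
  open FunStage F public renaming (z≈ to c≈; v≈ to u≈; tz to tΠ; tv to tu; vₗ to uₗ)
  field
    b∈ : (l , bₗ) ∈ᴰ ⟦ A ⟧ ρ
    g∈ : ∀ w → (l , gₗ · w) ∈ᴰ body A B ρ (↓ (l , w))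

  open PiType tΠ public using (domain; codomain)

  b∶U : (l , bₗ) ∶𝒞 U𝒞
  b∶U = U-of-stage {l} (bₗ , ≈-refl 𝒞 , domain)

  g∶U : ∀ w → (l , gₗ · w) ∶𝒞 U𝒞
  g∶U w = U-of-stage {l} (gₗ · w , ≈-refl 𝒞 , codomain w)

  img : ∀ w → HasType l (appₙ l uₗ w) (gₗ · w)
  img = LamType.img-typed values-typed

  img∶ : ∀ w → (l , appₙ l uₗ w) ∶𝒞 (l , gₗ · w)
  img∶ w = l , appₙ l uₗ w , gₗ · w , ≈-refl 𝒞 , ≈-refl 𝒞 , img w

  app≈ : ∀ w → (l , appₙ l uₗ w) 𝒞.≈ app u (l , w)
  app≈ w = ≈-trans 𝒞 (≈-sym 𝒞 (app-appₙ l uₗ w)) (app-resp u≈ (≈-refl 𝒞))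

Π-view : ∀ {m} {A : Tm m} {B ρ u c} → c ∈ᴰ ⟦ Π A B ⟧ ρ → c ∶𝒞 U𝒞 → u ∶𝒞 c → c ⊑ 𝒞.⊥ ⊎ ΠData A B ρ u c
Π-view (inj₁ c≈⊥) _ _ = inj₁ (𝒞.≤-reflexive c≈⊥)
Π-view {A = A} {B} {ρ} {u} {c} (inj₂ (m , a , s , c≈ , ∈a , ∈s)) tc tu = inj₂ (build (fun-stage {s = s} tu tc c≈ 0))
  where
  build : FunStage u c 0 → ΠData A B ρ u c
  build F = record
    { F  = F
    ; b∈ = ∈-resp (⟦ A ⟧ ρ) (≈-sym 𝒞 (stage-dom≈ F {s = s} c≈)) ∈a
    ; g∈ = λ w → ∈-resp (body A B ρ (↓ (l , w))) (≈-sym 𝒞 (stage-cod≈ F {s = s} c≈ w (≈-refl 𝒞))) (∈s (l , w))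
    }
    where open FunStage F using (l)

module _ {m n} {Γ : Ctx m} {Δ : Ctx n} {ρ : Env m} {σ σ′ : Sub Tm m n} (R : RelSub Γ Δ ρ σ σ′)
         {A : Tm m} (a : Γ ⊢ A ∶ 𝒰) (VA : TyValid Γ A A) where
  open RelSub R

  RelSub-∷ : ∀ {N N′} ω → ω ∶ᴰ ⟦ A ⟧ ρ → Δ ⊢ N ≐ N′ ∶ A / σ →
    (∀ u c → u ∈ᴰ ω → c ∈ᴰ ⟦ A ⟧ ρ → c ∶𝒞 U𝒞 → u ∶𝒞 c → Δ ⊩ N ≐ N′ ∶ A / σ ▷ u ∶ c) →
    RelSub (Γ ▹ A) Δ (ρ ▸ ω) (N ∷ σ) (N′ ∷ σ′)
  RelSub-∷ {N} {N′} ω tω e h = record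
    { ⊢Γ   = ⊢▹ ⊢Γ a
    ; ⊢Δ   = ⊢Δ
    ; fits = Fits-▸ {A = A} {ω} fits (proj₂ (sound-ty {ρ = ρ} a fits)) tω
    ; wt   = Wt≐-∷ {A = A} wt (Presup.lhs (presup e)) (ty-conv (Presup.rhs (presup e)) (cong-ty a)) e
    ; ty   = λ where
        zero c ∈c tc → ⊩-cast (sym (weaken-∷ A N σ)) (sym (weaken-∷ A N′ σ′))
          (VA R c (at⊆ (proj₁ (⟦weaken⟧ A ρ ω)) c ∈c) tc)
        (suc x) c ∈c tc → ⊩-cast (sym (weaken-∷ (type Γ x) N σ)) (sym (weaken-∷ (type Γ x) N′ σ′))
          (ty x c (at⊆ (proj₁ (⟦weaken⟧ (type Γ x) ρ ω)) c ∈c) tc)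
    ; tm   = λ where
        zero u c ∈u ∈c tc tu → ⊩∶-cast refl refl (sym (weaken-∷ A N σ))
          (h u c ∈u (at⊆ (proj₁ (⟦weaken⟧ A ρ ω)) c ∈c) tc tu)
        (suc x) u c ∈u ∈c tc tu → ⊩∶-cast refl refl (sym (weaken-∷ (type Γ x) N σ))
          (tm x u c ∈u (at⊆ (proj₁ (⟦weaken⟧ (type Γ x) ρ ω)) c ∈c) tc tu)
    }

  -- An element `u ∶ c` of the projection lies below `w`, but `c` is unrelated to `b`. Both types
  -- lie below a type `d` in `⟦ A ⟧ ρ`: the relation at `w ∶ b` is raised to `d`, where `A` is
  -- related to itself, and then lowered to `u ∶ c`.
  RelSub-𝐩 : ∀ {N N′ l} b w → (l , b) ∈ᴰ ⟦ A ⟧ ρ → IsType l b → HasType l w b → Δ ⊢ N ≐ N′ ∶ A / σ →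
    EqTm l Δ N N′ (A / σ) w b → RelSub (Γ ▹ A) Δ (ρ ▸ 𝐩 (⟦ A ⟧ ρ) (↓ (l , w))) (N ∷ σ) (N′ ∷ σ′)
  RelSub-𝐩 {N} {N′} {l} b w ∈b tb tw e h = RelSub-∷ (𝐩 (⟦ A ⟧ ρ) (↓ (l , w)))
    (𝐩-∶ {⟦ A ⟧ ρ} (↓ (l , w)) (proj₂ (sound-ty {ρ = ρ} a fits))) e λ u c ∈u ∈c tc tu →
      let (d , ∈d , b⊑d , c⊑d , td) = type-join {⟦ A ⟧ ρ} ∈b ∈c (U-of-stage {l} (b , ≈-refl 𝒞 , tb)) tc
      in ⊩∶-↓ (⊩∶-↑ {a = l , b} {d} (e , l , w , b , ≈-refl 𝒞 , ≈-refl 𝒞 , tb , tw , h) b⊑d (VA (RelSub-reflˡ R) d ∈d td))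
           c⊑d tc (at⊆ (𝐩⊆ {⟦ A ⟧ ρ} {↓ (l , w)}) u ∈u) tu

β-sub : ∀ {m n} {Γ : Ctx m} {Δ : Ctx n} {σ A B M N} → Γ ⊢ A ∶ 𝒰 → (Γ ▹ A) ⊢ M ∶ B → Wt Γ Δ σ → ⊢ Δ → Δ ⊢ N ∶ A / σ →
        Δ ⊢ (ƛ A M / σ) ∙ N ⇝* (M / σ ↑) [ N ] ∶ (B / σ ↑) [ N ]
β-sub {A = A} a p w ⊢Δ q = β ◅ ε , eq-β a′ (sub-ty (Wt-↑ {A = A} w ⊢Δ′) ⊢Δ′ p) q
  where
  a′  = sub-ty w ⊢Δ a
  ⊢Δ′ = ⊢▹ ⊢Δ a′

conv-valid : ∀ {m} {Γ : Ctx m} {M M′ A B} → Γ ⊢ A ≐ B ∶ 𝒰 → TyValid Γ A B → TmValid Γ M M′ A → TyValid Γ B B × TmValid Γ M M′ B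
conv-valid {A = A} {B} e V W =
  TyValid-reflˡ {A = B} {A} (eq-sym e) (TyValid-sym {A = A} {B} e V) ,
  λ {_} {_} {ρ} {σ} R u a ∈u ∈a ta tu →
    let ∈a′ = at⊆ (proj₂ (proj₂ (proj₂ (sound-eq {ρ = ρ} e (RelSub.fits R))))) a ∈a in
    ⊩∶-conv (sub-eq (Wt≐.left (RelSub.wt R)) (RelSub.⊢Δ R) e) (V (RelSub-reflˡ R) a ∈a′ ta) (W R u a ∈u ∈a′ ta tu)

module _ {m} {Γ : Ctx m} {A A′ : Tm m} (eA : Γ ⊢ A ≐ A′ ∶ 𝒰) (VA : TyValid Γ A A′) where
  private
    a  = Presup.lhs (presup eA)
    VAA : TyValid Γ A A
    VAA = TyValid-reflˡ {A = A} {A′} eA VA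

  Π-valid : ∀ {B B′} → (Γ ▹ A) ⊢ B ≐ B′ ∶ 𝒰 → TyValid (Γ ▹ A) B B′ → TyValid Γ (Π A B) (Π A′ B′)
  Π-valid {B} {B′} eB VB {Δ = Δ} {ρ} {σ} {σ′} R c ∈c tc = go (Π-view {A = A} {B} {ρ} {𝒞.⊥} {c} ∈c tc (⊥∶𝒞 tc))
    where
    open RelSub R
    eΠ = presup (sub≐ (eq-Π eA eB) wt ⊢Δ)
    ⊢Δ′ : ⊢ (Δ ▹ A / σ)
    ⊢Δ′ = ⊢▹ ⊢Δ (Presup.lhs (presup (cong-ty a)))
    go : c ⊑ 𝒞.⊥ ⊎ ΠData A B ρ 𝒞.⊥ c → Δ ⊩ Π A B / σ ≐ Π A′ B′ / σ′ ▷ c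
    go (inj₁ c⊑⊥) = ⊩-⊥ c⊑⊥ tc
    go (inj₂ D) = suc l , Pi bₗ gₗ , c≈ , Pi-IsType l tΠ ,
      EqTy-Π l {a = bₗ} {gₗ} (ε , eq-refl (Presup.lhs eΠ)) (ε , eq-refl (Presup.rhs eΠ)) (sub≐ eA wt ⊢Δ)
        (sub≐ eB (Wt≐-↑ wt ⊢Δ′ (cong-ty a)) ⊢Δ′) (⊩-at (VA R (l , bₗ) b∈ b∶U) (≈-refl 𝒞) domain)
        λ M M′ v tv e h → ⊩-at
          (⊩-cast (sym (/-∷ B M σ)) (sym (/-∷ B′ M′ σ′))
            (VB (RelSub-𝐩 R a VAA bₗ v b∈ domain tv e h) (l , gₗ · v) (g∈ v) (g∶U v)))
          (≈-refl 𝒞) (codomain v)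
      where open ΠData D

  ƛ-valid : ∀ {B M M′} → (Γ ▹ A) ⊢ M ≐ M′ ∶ B → TyValid (Γ ▹ A) B B → TmValid (Γ ▹ A) M M′ B →
            TmValid Γ (ƛ A M) (ƛ A′ M′) (Π A B)
  ƛ-valid {B} {M} {M′} eM VB VM {Δ = Δ} {ρ} {σ} {σ′} R u c ∈u ∈c tc tu = go (Π-view {A = A} {B} {ρ} {u} {c} ∈c tc tu)
    where
    open RelSub R
    eƛ = sub≐ (eq-ƛ eA eM) wt ⊢Δ
    b  = Presup.ty (presup eM)
    a′ = Presup.rhs (presup eA)
    VΠ : TyValid Γ (Π A B) (Π A B)
    VΠ = TyValid-reflˡ {A = Π A B} {Π A′ B} (eq-Π eA (eq-refl b)) (Π-valid {B} {B} (eq-refl b) VB)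
    go : c ⊑ 𝒞.⊥ ⊎ ΠData A B ρ u c → Δ ⊩ ƛ A M / σ ≐ ƛ A′ M′ / σ′ ∶ Π A B / σ ▷ u ∶ c
    go (inj₁ c⊑⊥) = ⊩∶-⊥ eƛ c⊑⊥ tc tu
    go (inj₂ D) = eƛ , suc l , uₗ , Pi bₗ gₗ , u≈ , c≈ , Pi-IsType l tΠ , tuₗ ,
      EqTm-Π l {u = uₗ} {bₗ} {gₗ} (ε , eq-refl (Presup.ty (presup eƛ)))
        (⊩-at (VΠ (RelSub-reflˡ R) c ∈c tc) c≈ (Pi-IsType l tΠ)) cross
      where
      open ΠData D renaming (tu to tuₗ)
      app∈ : ∀ w → (l , appₙ l uₗ w) ∈ᴰ body A M ρ (↓ (l , w))
      app∈ w = let (n , s , u≈′ , ∈s) = ∈u in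
        ∈-resp (body A M ρ (↓ (l , w))) (≈-sym 𝒞 (≈-trans 𝒞 (app≈ w) (app-resp u≈′ (≈-refl 𝒞)))) (∈s (l , w))
      cross : ∀ N N′ w → HasType l w bₗ → Δ ⊢ N ≐ N′ ∶ A / σ → EqTm l Δ N N′ (A / σ) w bₗ →
              EqTm l Δ ((ƛ A M / σ) ∙ N) ((ƛ A′ M′ / σ′) ∙ N′) ((B / σ ↑) [ N ]) (appₙ l uₗ w) (gₗ · w)
      cross N N′ w tw e hN = ⊩∶-at
        (⊩∶-expand
          (β-sub a (Presup.lhs (presup eM)) (Wt≐.left wt) ⊢Δ (Presup.lhs (presup e)))
          -- The right-hand β-step is typed at the `σ′`-instance of `B` with `N′`; functionality
          -- converts it to the left-hand type.
          (⇝*-conv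
            (β-sub a′ (ctx-conv-ty a a′ eA (Presup.rhs (presup eM))) (Wt≐.right wt) ⊢Δ
              (ty-conv (Presup.rhs (presup e)) (sub≐ eA wt ⊢Δ)))
            (eq-sym (cast-eq (sym (/-∷ B N σ)) (sym (/-∷ B N′ σ′)) refl (functional b (RelSub.wt X) ⊢Δ))))
          (⊩∶-cast (sym (/-∷ M N σ)) (sym (/-∷ M′ N′ σ′)) (sym (/-∷ B N σ))
            (VM X (l , appₙ l uₗ w) (l , gₗ · w) (app∈ w) (g∈ w) (g∶U w) (img∶ w))))
        (≈-refl 𝒞) (≈-refl 𝒞) (codomain w) (img w)
        where
        X = RelSub-𝐩 R a VAA bₗ w b∈ domain tw e hN

-- The premise is applied to the substitutions extended by `L` and `L′`, where the weakenings
-- cancel. As `w` is typed in `⟦ A ⟧ ρ` it survives the projection, so `u(w)` belongs to the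
-- interpretation of `weaken M ∙ var zero`.
η-valid : ∀ {m} {Γ : Ctx m} {A B M N} → Γ ⊢ A ∶ 𝒰 → TyValid Γ A A → TyValid Γ (Π A B) (Π A B) → Γ ⊢ M ≐ N ∶ Π A B →
          TmValid (Γ ▹ A) (weaken M ∙ var zero) (weaken N ∙ var zero) B → TmValid Γ M N (Π A B)
η-valid {Γ = Γ} {A} {B} {M} {N} a VA VΠ eM V {Δ = Δ} {ρ} {σ} {σ′} R u c ∈u ∈c tc tu = go (Π-view {A = A} {B} {ρ} {u} {c} ∈c tc tu)
  where
  open RelSub R
  e = sub≐ eM wt ⊢Δ
  go : c ⊑ 𝒞.⊥ ⊎ ΠData A B ρ u c → Δ ⊩ M / σ ≐ N / σ′ ∶ Π A B / σ ▷ u ∶ c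
  go (inj₁ c⊑⊥) = ⊩∶-⊥ e c⊑⊥ tc tu
  go (inj₂ D) = e , suc l , uₗ , Pi bₗ gₗ , u≈ , c≈ , Pi-IsType l tΠ , tuₗ ,
    EqTm-Π l {u = uₗ} {bₗ} {gₗ} (ε , eq-refl (Presup.ty (presup e)))
      (⊩-at (VΠ (RelSub-reflˡ R) c ∈c tc) c≈ (Pi-IsType l tΠ)) cross
    where
    open ΠData D renaming (tu to tuₗ)
    cross : ∀ L L′ w → HasType l w bₗ → Δ ⊢ L ≐ L′ ∶ A / σ → EqTm l Δ L L′ (A / σ) w bₗ →
            EqTm l Δ ((M / σ) ∙ L) ((N / σ′) ∙ L′) ((B / σ ↑) [ L ]) (appₙ l uₗ w) (gₗ · w)
    cross L L′ w tw e hL = ⊩∶-at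
      (⊩∶-cast (cong (_∙ L) (weaken-∷ M L σ)) (cong (_∙ L′) (weaken-∷ N L′ σ′)) (sym (/-∷ B L σ))
        (V (RelSub-𝐩 R a VA bₗ w b∈ domain tw e hL) (l , appₙ l uₗ w) (l , gₗ · w)
          (u , (l , w) , at⊆ (proj₂ (⟦weaken⟧ M ρ ω)) u ∈u ,
           𝐩-intro {⟦ A ⟧ ρ} {↓ (l , w)} ⊑-refl b∈ (l , w , bₗ , ≈-refl 𝒞 , ≈-refl 𝒞 , tw) , app≈ w)
          (g∈ w) (g∶U w) (img∶ w)))
      (≈-refl 𝒞) (≈-refl 𝒞) (codomain w) (img w)
      where ω = 𝐩 (⟦ A ⟧ ρ) (↓ (l , w))

-- `Pi a ⊥ₛ` is a type in `⟦ Π A B ⟧ ρ` with domain `a`. For the rule of η, the derivation for `A`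
-- recovered from its Π-type is not a subderivation, so validity of `A` is extracted from that of
-- the Π-type.
dom-valid : ∀ {m} {Γ : Ctx m} {A B} → Γ ⊢ Π A B ∶ 𝒰 → TyValid Γ (Π A B) (Π A B) → TyValid Γ A A
dom-valid {Γ = Γ} {A} {B} p V {Δ = Δ} {ρ} {σ} {σ′} R a ∈a ta = go (stage-of ta)
  where
  open RelSub R
  e = presup (cong-ty p)
  go : ∃[ n ] IsTypeAt n a → Δ ⊩ A / σ ≐ A / σ′ ▷ a
  go (n , aₙ , a≈ , t) = n , aₙ , a≈ , t ,
    proj₁ (EqTy-fun n {a = aₙ} {⊥ₛ} (ε , eq-refl (Presup.lhs e)) (ε , eq-refl (Presup.rhs e))
      (⊩-at (V R (suc n , Pi aₙ ⊥ₛ)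
        (inj₂ (n , aₙ , ⊥ₛ , ≈-refl 𝒞 , ∈-resp (⟦ A ⟧ ρ) (≈-sym 𝒞 a≈) ∈a ,
          ∈-pres n ⊥ₛ (λ u → body A B ρ (↓ u)) (binder-mono A B ρ) λ ()))
        (U-of-stage {suc n} (_ , ≈-refl 𝒞 , tΠ))) (≈-refl 𝒞) tΠ))
    where
    tΠ : IsType (suc n) (Pi aₙ ⊥ₛ)
    tΠ = Pi-IsType n record
      { domain   = t
      ; dom-cod  = λ u → CUSL.⊥ (C n) , CUSL.min (C n) _ , ⊥-typed n (CUSL.≤-refl (C n)) t , ≈-refl (C n)
      ; codomain = λ _ → ⊥-IsType n t
      }

module _ {m} {Γ : Ctx m} {A : Tm m} {B : Tm (suc m)} (p : Γ ⊢ Π A B ∶ 𝒰) (VΠ : TyValid Γ (Π A B) (Π A B)) where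
  private
    a = proj₁ (Π-inv p)
    b = proj₂ (Π-inv p)

  module _ {N N′ : Tm m} (eN : Γ ⊢ N ≐ N′ ∶ A) (VN : TmValid Γ N N′ A)
           {n} {Δ : Ctx n} {ρ : Env m} {σ σ′ : Sub Tm m n} (R : RelSub Γ Δ ρ σ σ′)
           (tA : ⟦ A ⟧ ρ ∶ᴰ 𝐔) {c u v : ∣ 𝒞 ∣} (P : Π-Above {ρ = ρ} {A} tA B (⟦ N ⟧ ρ) c u v) where
    open RelSub R
    private
      module P = Π-Above P
      eΠ = presup (cong-ty p)
      reflˡ = eq-refl (Presup.lhs eΠ)
      reflʳ = eq-refl (Presup.rhs eΠ)

    module _ {n₀} (th₀ : HasTypeAt n₀ P.t (P.m , P.a)) {x} (F : FunStage x P.z n₀) where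
      open FunStage F renaming (z≈ to zₗ≈; tz to tΠ; tv to tx)
      open PiType tΠ
      private
        tt′ = raise j≤l th₀
        tₗ : ∣ C l ∣
        tₗ = proj₁ tt′
        t≈ : (l , tₗ) 𝒞.≈ P.t
        t≈ = proj₁ (proj₂ (proj₂ tt′))
        b≈ : (l , bₗ) 𝒞.≈ (P.m , P.a)
        b≈ = stage-dom≈ F {s = P.s} P.z≈
        th : HasType l tₗ bₗ
        th = at-rep tt′ t≈ b≈
        eN′ = sub≐ eN wt ⊢Δ
        hN : EqTm l Δ (N / σ) (N′ / σ′) (A / σ) tₗ bₗ
        hN = ⊩∶-at (VN R P.t (P.m , P.a) P.∈t P.∈a (domain-∶U {s = P.s} (⊥∶𝒞 P.tz) P.tz P.z≈) P.t∶) t≈ b≈ domain th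
        c⊑ : c ⊑ (l , gₗ · tₗ)
        c⊑ = ⊑-trans P.b⊑ (𝒞.≥-reflexive (stage-cod≈ F {s = P.s} P.z≈ tₗ t≈))

      -- The codomain clause at `t` relates the instances at `g(t)`, which dominates `c`.
      []-cross : c ∶𝒞 U𝒞 → Δ ⊩ B [ N ] / σ ≐ B [ N′ ] / σ′ ▷ c
      []-cross tc = ⊩-cast (sym (/-[] B N σ)) (sym (/-[] B N′ σ′))
        (⊩-↓ (l , gₗ · tₗ , ≈-refl 𝒞 , codomain tₗ ,
          proj₂ (EqTy-fun l {a = bₗ} {gₗ} (ε , reflˡ) (ε , reflʳ) (⊩-at (VΠ R P.z P.∈z P.tz) zₗ≈ (Pi-IsType l tΠ)))
            (N / σ) (N′ / σ′) tₗ th eN′ hN) c⊑ tc)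

      -- `x` and `t` dominate the given function and argument, so the applications are related at
      -- `x(t) ∶ g(t)` and then at `w ∶ c` by lowering.
      app-cross : ∀ {M M′ w} → Γ ⊢ M ≐ M′ ∶ Π A B → TmValid Γ M M′ (Π A B) → x ∈ᴰ ⟦ M ⟧ ρ → x ∶𝒞 P.z →
                  w ⊑ app x P.t → w ∶𝒞 c → c ∶𝒞 U𝒞 → Δ ⊩ M ∙ N / σ ≐ M′ ∙ N′ / σ′ ∶ B [ N ] / σ ▷ w ∶ c
      app-cross {M} {M′} {w} eM VM ∈x tx′ w⊑ tw tc = ⊩∶-cast refl refl (sym (/-[] B N σ))
        (⊩∶-↓ {u = l , appₙ l vₗ tₗ}
          (cast-eq refl refl (/-[] B N σ) (sub≐ (eq-app eM eN) wt ⊢Δ) ,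
           l , appₙ l vₗ tₗ , gₗ · tₗ , ≈-refl 𝒞 , ≈-refl 𝒞 , codomain tₗ , LamType.img-typed values-typed tₗ ,
           proj₂ (proj₂ (EqTm-fun l {u = vₗ} {bₗ} {gₗ} (ε , reflˡ)
             (⊩∶-at (VM R x P.z ∈x P.∈z P.tz tx′) v≈ zₗ≈ (Pi-IsType l tΠ) tx) (N / σ) (N′ / σ′) tₗ th eN′ hN)))
          c⊑ tc (⊑-trans w⊑ (𝒞.≥-reflexive (stage-app≈ F {s = P.s} P.z≈ tₗ t≈))) tw)

  []-valid : ∀ {N N′} → Γ ⊢ N ≐ N′ ∶ A → TmValid Γ N N′ A → TyValid Γ (B [ N ]) (B [ N′ ])
  []-valid {N} {N′} eN VN {Δ = Δ} {ρ} {σ} {σ′} R c ∈c tc =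
    -- No argument and no element of the Π-type are prescribed here; `⊥` fills both places.
    go (Π-above {ρ = ρ} {A} tA {B} {⟦ N ⟧ ρ} {c} {𝒞.⊥} {𝒞.⊥} tΠ tN (at⊆ (proj₁ (⟦[]⟧ B N ρ)) c ∈c)
      (𝒟.mem-⊥ (⟦ N ⟧ ρ)) (𝒟.mem-⊥ (⟦ Π A B ⟧ ρ)))
    where
    open RelSub R
    tΠ = proj₂ (sound-ty {ρ = ρ} p fits)
    tA = proj₁ (sound-eq {ρ = ρ} eN fits)
    tN = proj₁ (proj₂ (sound-eq {ρ = ρ} eN fits))
    go : Π-Above {ρ = ρ} {A} tA B (⟦ N ⟧ ρ) c 𝒞.⊥ 𝒞.⊥ → Δ ⊩ B [ N ] / σ ≐ B [ N′ ] / σ′ ▷ c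
    go P = []-cross eN VN R tA P (proj₂ t∶) (fun-stage {s = s} (⊥∶𝒞 tz) tz z≈ (proj₁ t∶)) tc
      where open Π-Above P

  app-valid : ∀ {M M′ N N′} → Γ ⊢ M ≐ M′ ∶ Π A B → TmValid Γ M M′ (Π A B) → Γ ⊢ N ≐ N′ ∶ A → TmValid Γ N N′ A →
              TmValid Γ (M ∙ N) (M′ ∙ N′) (B [ N ])
  app-valid {M} {M′} {N} {N′} eM VM eN VN {Δ = Δ} {ρ} {σ} {σ′} R w c (x , u , ∈x , ∈u , w≈) ∈c tc tw =
    -- `x` is enlarged to a typed `y`. Its type `d` is handed to `Π-above`, so that the Π found
    -- there dominates `d` and types `y` as well.
    let (y , d , ∈y , ∈d , x⊑y , ty) = tM x ∈x in
    go y ∈y ty (⊑-trans (𝒞.≤-reflexive w≈) (app-mono x⊑y ⊑-refl))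
      (Π-above {ρ = ρ} {A} tA {B} {⟦ N ⟧ ρ} {c} {u} {d} tΠ tN (at⊆ (proj₁ (⟦[]⟧ B N ρ)) c ∈c) ∈u ∈d)
    where
    open RelSub R using (fits)
    tΠ = proj₂ (sound-ty {ρ = ρ} p fits)
    tM = proj₁ (proj₂ (sound-eq {ρ = ρ} eM fits))
    tA = proj₁ (sound-eq {ρ = ρ} eN fits)
    tN = proj₁ (proj₂ (sound-eq {ρ = ρ} eN fits))
    go : ∀ y {d} → y ∈ᴰ ⟦ M ⟧ ρ → y ∶𝒞 d → w ⊑ app y u → Π-Above {ρ = ρ} {A} tA B (⟦ N ⟧ ρ) c u d →
         Δ ⊩ M ∙ N / σ ≐ M′ ∙ N′ / σ′ ∶ B [ N ] / σ ▷ w ∶ c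
    go y ∈y ty w⊑ P = app-cross eN VN R tA P (proj₂ t∶) (fun-stage {s = s} ty′ tz z≈ (proj₁ t∶)) eM VM ∈y ty′
      (⊑-trans w⊑ (app-mono {y} ⊑-refl u⊑t)) tw tc
      where
      open Π-Above P
      ty′ = ∶𝒞-mono ty c⊑z tz

module _ {m} {Γ : Ctx m} {A : Tm m} {B : Tm (suc m)} {N : Tm m} (a : Γ ⊢ A ∶ 𝒰) (VA : TyValid Γ A A)
         (q : Γ ⊢ N ∶ A) (VN : TmValid Γ N N A) where
  -- The contractum `M [ N ]` under `σ` is `M` under this extended substitution, which reduces β to
  -- the validity of `M`.
  RelSub-[] : ∀ {n} {Δ : Ctx n} {ρ σ σ′} → RelSub Γ Δ ρ σ σ′ → RelSub (Γ ▹ A) Δ (ρ ▸ ⟦ N ⟧ ρ) (N / σ ∷ σ) (N / σ′ ∷ σ′)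
  RelSub-[] {ρ = ρ} R = RelSub-∷ R a VA (⟦ N ⟧ ρ) (proj₂ (sound-ty {ρ = ρ} q fits)) (functional q wt ⊢Δ) (VN R)
    where open RelSub R

  β-ty-valid : TyValid (Γ ▹ A) B B → TyValid Γ (B [ N ]) (B [ N ])
  β-ty-valid V {ρ = ρ} {σ} {σ′} R c ∈c tc = ⊩-cast (sym (/-[]∷ B N σ)) (sym (/-[]∷ B N σ′))
    (V (RelSub-[] R) c (at⊆ (proj₁ (⟦[]⟧ B N ρ)) c ∈c) tc)

  β-valid : ∀ {M} → (Γ ▹ A) ⊢ M ∶ B → TmValid (Γ ▹ A) M M B → TmValid Γ (ƛ A M ∙ N) (M [ N ]) (B [ N ])
  β-valid {M} p V {Δ = Δ} {ρ} {σ} {σ′} R u c ∈u ∈c tc tu =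
    ⊩∶-cast refl refl (sym (/-[] B N σ))
      (⊩∶-expand (β-sub a p (Wt≐.left wt) ⊢Δ (Presup.lhs (presup (functional q wt ⊢Δ))))
        (ε , eq-refl (Presup.rhs (presup e)))
        (⊩∶-cast (sym (/-∷ M (N / σ) σ)) (sym (/-[]∷ M N σ′)) (sym (/-∷ B (N / σ) σ)) h))
    where
    open RelSub R
    h = V (RelSub-[] R) u c
      (at⊆ (proj₁ (β-sound {ρ = ρ} {A} (proj₂ (sound-ty {ρ = ρ} a fits)) {M} {N} (proj₂ (sound-ty {ρ = ρ} q fits)))) u ∈u)
      (at⊆ (proj₁ (⟦[]⟧ B N ρ)) c ∈c) tc tu
    e = cast-eq (sym (/-∷ M (N / σ) σ)) (sym (/-[]∷ M N σ′)) (sym (/-∷ B (N / σ) σ)) (proj₁ h)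

-- The statement about the type is carried along because neither the rule for ƛ nor the one for
-- application has a derivation of its type among its premises.
mutual
  fund-ty : ∀ {m} {Γ : Ctx m} {M A} → Γ ⊢ M ∶ A → TyValid Γ A A × TmValid Γ M M A
  fund-ty (ty-var x _) = (λ R → RelSub.ty R x) , (λ R → RelSub.tm R x)
  fund-ty (ty-univ ⊢Γ) = 𝒰-valid , code (eq-refl (ty-univ ⊢Γ)) 𝒰-valid
  fund-ty (ty-Π {A = A} {B} a b) = 𝒰-valid , code (eq-refl (ty-Π a b))
    (Π-valid {A = A} (eq-refl a) (El {A = A} {A} (proj₂ (fund-ty a))) {B} {B} (eq-refl b) (El {A = B} {B} (proj₂ (fund-ty b))))
  fund-ty (ty-ƛ {A = A} {B} {M} a p) =
    let VA = El {A = A} {A} (proj₂ (fund-ty a))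
        (VB , VM) = fund-ty p
    in Π-valid {A = A} (eq-refl a) VA {B} {B} (eq-refl (validity p)) VB ,
       ƛ-valid {A = A} (eq-refl a) VA {B} {M} {M} (eq-refl p) VB VM
  fund-ty (ty-app {A = A} {B} {M} {N} p q) =
    let (VΠ , VM) = fund-ty p
        (VA , VN) = fund-ty q
    in []-valid {A = A} {B} (validity p) VΠ {N} {N} (eq-refl q) VN ,
       app-valid {A = A} {B} (validity p) VΠ {M} {M} {N} {N} (eq-refl p) VM (eq-refl q) VN
  fund-ty (ty-conv {A = A} {B} {M} p e) = conv-valid {M = M} {M} e (El {A = A} {B} (proj₂ (fund-eq e))) (proj₂ (fund-ty p))

  fund-eq : ∀ {m} {Γ : Ctx m} {M N A} → Γ ⊢ M ≐ N ∶ A → TyValid Γ A A × TmValid Γ M N A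
  fund-eq (eq-refl p) = fund-ty p
  fund-eq (eq-sym {M = M} {N} e) = let (VA , V) = fund-eq e in VA , TmValid-sym {M = M} {N} e VA V
  fund-eq (eq-trans {M = M} {N} {P} e e′) = let (VA , V) = fund-eq e in
    VA , TmValid-trans {M = M} {N} {P} e V (proj₂ (fund-eq e′))
  fund-eq (eq-conv {A = A} {B} {M} {N} e e′) = conv-valid {M = M} {N} e′ (El {A = A} {B} (proj₂ (fund-eq e′))) (proj₂ (fund-eq e))
  fund-eq (eq-Π {A = A} {A′} {B} {B′} e e′) = 𝒰-valid , code (eq-Π e e′)
    (Π-valid {A = A} {A′} e (El {A = A} {A′} (proj₂ (fund-eq e))) {B} {B′} e′ (El {A = B} {B′} (proj₂ (fund-eq e′))))
  fund-eq (eq-ƛ {A = A} {A′} {B} {M} {M′} e e′) =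
    let VA = El {A = A} {A′} (proj₂ (fund-eq e))
        (VB , VM) = fund-eq e′
        b = eq-refl (Presup.ty (presup e′))
    in Π-valid {A = A} (eq-refl (Presup.lhs (presup e))) (TyValid-reflˡ {A = A} {A′} e VA) {B} {B} b VB ,
       ƛ-valid {A = A} {A′} e VA {B} {M} {M′} e′ VB VM
  fund-eq (eq-app {A = A} {B} {M} {M′} {N} {N′} p q) =
    let (VΠ , VM) = fund-eq p
        (VA , VN) = fund-eq q
        tΠ = Presup.ty (presup p)
    in []-valid {A = A} {B} tΠ VΠ {N} {N} (eq-refl (Presup.lhs (presup q))) (TmValid-reflˡ {M = N} {N′} q VA VN) ,
       app-valid {A = A} {B} tΠ VΠ {M} {M′} {N} {N′} p VM q VN
  fund-eq (eq-β {A = A} {B} {M} {N} a p q) =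
    let VA = El {A = A} {A} (proj₂ (fund-ty a))
        (VB , VM) = fund-ty p
        VN = proj₂ (fund-ty q)
    in β-ty-valid {A = A} {B} {N} a VA q VN VB , β-valid {A = A} {B} {N} a VA q VN {M} p VM
  fund-eq (eq-η {A = A} {B} {M} {N} p q e) =
    let VΠ = proj₁ (fund-ty p)
        tΠ = validity p
    in VΠ , η-valid {A = A} {B} {M} {N} (proj₁ (Π-inv tΠ)) (dom-valid {A = A} {B} tΠ VΠ) VΠ (eq-η p q e) (proj₂ (fund-eq e))

-- From `Related` to `RelSub`

module _ {m} {Γ : Ctx m} {ρ ρ′ : Env m} (ρ≐ : ∀ x → ρ x ≐ᴰ ρ′ x) where
  Fits-cong : Fits ρ Γ → Fits ρ′ Γ
  Fits-cong ft x = let e = ⟦⟧-cong (type Γ x) ρ≐ in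
    ∶ᴰ-resp e (≐ᴰ-refl {𝐔}) (proj₁ (ft x)) , ∶ᴰ-resp (ρ≐ x) e (proj₂ (ft x))

  -- An environment and its recomposition from head and tail agree pointwise, which is all that
  -- relatedness sees.
  RelSub-cong : ∀ {n} {Δ : Ctx n} {σ σ′} → RelSub Γ Δ ρ σ σ′ → RelSub Γ Δ ρ′ σ σ′
  RelSub-cong R = record
    { ⊢Γ = ⊢Γ ; ⊢Δ = ⊢Δ ; fits = Fits-cong fits ; wt = wt
    ; ty = λ x a ∈a → ty x a (at⊆ (proj₂ (⟦⟧-cong (type Γ x) ρ≐)) a ∈a)
    ; tm = λ x u a ∈u ∈a → tm x u a (at⊆ (proj₂ (ρ≐ x)) u ∈u) (at⊆ (proj₂ (⟦⟧-cong (type Γ x) ρ≐)) a ∈a)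
    }
    where open RelSub R

-- The relations between the types of the variables come from the fundamental theorem for the types
-- declared in `Γ`, each under the substitutions for the preceding part of the context.
Related⇒RelSub : ∀ {m n} {Γ : Ctx m} {Δ : Ctx n} {ρ : Env m} {σ σ′} →
                 ⊢ Γ → ⊢ Δ → Fits ρ Γ → Related Γ Δ ρ σ σ′ → RelSub Γ Δ ρ σ σ′
Related⇒RelSub ⊢∅ ⊢Δ ft r = record
  { ⊢Γ = ⊢∅ ; ⊢Δ = ⊢Δ ; fits = ft ; wt = record { left = λ () ; right = λ () ; equal = λ () } ; ty = λ () ; tm = λ () }
Related⇒RelSub {Γ = Γ ▹ A} {Δ} {ρ} {N ∷ σ} {N′ ∷ σ′} (⊢▹ ⊢Γ a) ⊢Δ ft r =
  RelSub-cong ρ≐ (RelSub-∷ R a (El {A = A} {A} (proj₂ (fund-ty a))) (ρ zero)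
    (∶ᴰ-resp (≐ᴰ-refl {ρ zero}) (⟦weaken⟧′ A) (proj₂ (ft zero)))
    (cast-eq refl refl (weaken-∷ A N σ) (proj₁ (r zero)))
    λ u c ∈u ∈c tc tu → ⊩∶-cast refl refl (weaken-∷ A N σ) (proj₂ (r zero) u c ∈u (at⊆ (proj₂ (⟦weaken⟧′ A)) c ∈c) tc tu))
  where
  ρ₀ : Env _
  ρ₀ x = ρ (suc x)
  ρ≐ : ∀ x → (ρ₀ ▸ ρ zero) x ≐ᴰ ρ x
  ρ≐ zero    = ≐ᴰ-refl
  ρ≐ (suc x) = ≐ᴰ-refl
  ⟦weaken⟧′ : ∀ M → ⟦ weaken M ⟧ ρ ≐ᴰ ⟦ M ⟧ ρ₀
  ⟦weaken⟧′ M = ≐ᴰ-trans (⟦⟧-cong (weaken M) (λ x → ≐ᴰ-sym (ρ≐ x))) (⟦weaken⟧ M ρ₀ (ρ zero))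
  R : RelSub Γ Δ ρ₀ σ σ′
  R = Related⇒RelSub ⊢Γ ⊢Δ
    (λ x → ∶ᴰ-resp (⟦weaken⟧′ (type Γ x)) (≐ᴰ-refl {𝐔}) (proj₁ (ft (suc x))) ,
           ∶ᴰ-resp (≐ᴰ-refl {ρ₀ x}) (⟦weaken⟧′ (type Γ x)) (proj₂ (ft (suc x))))
    λ x → cast-eq refl refl (weaken-∷ (type Γ x) N σ) (proj₁ (r (suc x))) ,
      λ u c ∈u ∈c tc tu → ⊩∶-cast refl refl (weaken-∷ (type Γ x) N σ)
        (proj₂ (r (suc x)) u c ∈u (at⊆ (proj₂ (⟦weaken⟧′ (type Γ x))) c ∈c) tc tu)

theorem2p35 : ∀ {m n : ℕ} {Γ : Ctx m} {Δ : Ctx n} {ρ : Env m} {σ σ′ : Sub Tm m n} →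
    ⊢ Γ → ⊢ Δ → Fits ρ Γ → Related Γ Δ ρ σ σ′ →
    (∀ A A′ a → a ∈ᴰ ⟦ A ⟧ ρ → a ∶𝒞 U𝒞 →
    Γ ⊢ A ≐ A′ ∶ 𝒰 → Δ ⊩ A / σ ≐ A′ / σ′ ▷ a) ×
    (∀ A M M′ a u → a ∈ᴰ ⟦ A ⟧ ρ → a ∶𝒞 U𝒞 → u ∈ᴰ ⟦ M ⟧ ρ → u ∶𝒞 a →
    Γ ⊢ M ≐ M′ ∶ A → Δ ⊩ M / σ ≐ M′ / σ′ ∶ A / σ ▷ u ∶ a)
theorem2p35 ⊢Γ ⊢Δ ft r =
  (λ A A′ a ∈a ta e → El {A = A} {A′} (proj₂ (fund-eq e)) R a ∈a ta) ,
  (λ A M M′ a u ∈a ta ∈u tu e → proj₂ (fund-eq e) R u a ∈u ∈a ta tu)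
  where R = Related⇒RelSub ⊢Γ ⊢Δ ft r
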